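{- For every integer $k\geq 3$: (i) $\delta_{\mathrm{hom}}(C_{2k-1})\leq \frac{1}{2k-1}$; (ii) $\delta_{\mathrm{hom}}(\mathscr{C}_{2k-1})=\frac{1}{2k-1}$, where $\mathscr{C}_{2k-1}=\{C_3,C_5,\dots,C_{2k-1}\}$ is the family of all odd cycles of length at most $2k-1$.
   Context: All graphs are finite and simple; $C_\ell$ denotes the cycle of length $\ell$. For a family of graphs $\mathscr{F}$, a graph is $\mathscr{F}$-free if it contains no (not necessarily induced) subgraph isomorphic to a member of $\mathscr{F}$. For $\alpha\in[0,1]$ let $\mathscr{G}_{\mathscr{F}}(\alpha)$ be the class of all $\mathscr{F}$-free graphs $G$ with minimum degree $\delta(G)\geq \alpha|V(G)|$. Write $G\to H$ if there is a graph homomorphism from $G$ to $H$. The homomorphism threshold of $\mathscr{F}$ is $\delta_{\mathrm{hom}}(\mathscr{F})=\inf\{\alpha\in[0,1]\colon$ there is a (finite) $\mathscr{F}$-free graph $H=H(\mathscr{F},\alpha)$ such that $G\to H$ for every $G\in\mathscr{G}_{\mathscr{F}}(\alpha)\}$, and $\delta_{\mathrm{hom}}(F)=\delta_{\mathrm{hom}}(\{F\})$ for a single graph $F$. -}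

module Defs where

open import Level using (0ℓ)
open import Data.Nat using (ℕ; zero; suc; _+_; _*_; _∸_; _≤_; _<_; z≤n; s≤s; _%_)
open import Data.Nat.Properties using (_≟_; 1+n≢n)
open import Data.Fin using (Fin; toℕ)
open import Data.List using (List; length; filter; allFin)
open import Data.Product using (Σ; _×_; _,_; proj₁; proj₂)
open import Data.Sum using (_⊎_; inj₁; inj₂)
open import Data.Unit using (⊤)
open import Data.Empty using (⊥)
open import Relation.Nullary using (¬_; Dec)
open import Relation.Nullary.Decidable using (_⊎-dec_; _×-dec_)
open import Relation.Binary.PropositionalEquality using (_≡_; refl; trans) renaming (sym to ≡-sym)
open import Function.Definitions using (Injective)

record Graph : Set₁ where
  field
    n      : ℕ
    Adj    : Fin n → Fin n → Set
    adj?   : ∀ i j → Dec (Adj i j)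
    adj-sym : ∀ {i j} → Adj i j → Adj j i
    irrefl : ∀ {i} → ¬ Adj i i
open Graph public

∣_∣ᵥ : Graph → ℕ
∣ G ∣ᵥ = n G

degree : (G : Graph) → Fin (n G) → ℕ
degree G v = length (filter (adj? G v) (allFin (n G)))

-- minimum degree at least α·|V(G)| with α = p / q  (q > 0):
-- every vertex v satisfies  p · |V(G)| ≤ q · deg(v)
MinDegAtLeast : Graph → ℕ → ℕ → Set
MinDegAtLeast G p q = ∀ v → p * n G ≤ q * degree G v

_⟶_ : Graph → Graph → Set
G ⟶ H = Σ (Fin (n G) → Fin (n H)) λ f → ∀ {i j} → Adj G i j → Adj H (f i) (f j)

_⊆_ : Graph → Graph → Set
F ⊆ G = Σ (Fin (n F) → Fin (n G)) λ f →
          Injective _≡_ _≡_ f × (∀ {i j} → Adj F i j → Adj G (f i) (f j))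

module _ (ℓ : ℕ) (h : 3 ≤ ℓ) where
  private
    Step : Fin ℓ → Fin ℓ → Set
    Step i j = (suc (toℕ i) ≡ toℕ j) ⊎ ((toℕ i ≡ ℓ ∸ 1) × (toℕ j ≡ 0))

    step? : ∀ i j → Dec (Step i j)
    step? i j = (suc (toℕ i) ≟ toℕ j) ⊎-dec ((toℕ i ≟ ℓ ∸ 1) ×-dec (toℕ j ≟ 0))

    CAdj : Fin ℓ → Fin ℓ → Set
    CAdj i j = Step i j ⊎ Step j i

    noLoop : ∀ {i} → ¬ Step i i
    noLoop (inj₁ e) = 1+n≢n e
    noLoop {i} (inj₂ (a , b)) = bad h (trans (≡-sym a) b)
      where
      bad : ∀ {m} → 3 ≤ m → ¬ (m ∸ 1 ≡ 0)
      bad (s≤s (s≤s (s≤s _))) ()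

    swap : ∀ {i j} → CAdj i j → CAdj j i
    swap (inj₁ x) = inj₂ x
    swap (inj₂ x) = inj₁ x

    irr : ∀ {i} → ¬ CAdj i i
    irr (inj₁ x) = noLoop x
    irr (inj₂ x) = noLoop x

  Cycle : Graph
  Cycle = record
    { n = ℓ ; Adj = CAdj ; adj? = λ i j → step? i j ⊎-dec step? j i
    ; adj-sym = swap ; irrefl = irr }

Family : Set₁
Family = Σ Set λ I → (I → Graph)

Free : Family → Graph → Set
Free (I , F) G = ∀ i → ¬ (F i ⊆ G)

Good : Family → ℕ → ℕ → Set₁
Good 𝓕 p q = Σ Graph λ H → Free 𝓕 H ×
               (∀ (G : Graph) → Free 𝓕 G → MinDegAtLeast G p q → G ⟶ H)

-- δ_hom(𝓕) ≤ a/b : every rational α = p/q ∈ [0,1] with α > a/b is good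
HomThresholdAtMost : Family → ℕ → ℕ → Set₁
HomThresholdAtMost 𝓕 a b =
  ∀ p q → 0 < q → p ≤ q → a * q < p * b → Good 𝓕 p q

-- δ_hom(𝓕) ≥ a/b : no rational α = p/q ∈ [0,1] with α < a/b is good
HomThresholdAtLeast : Family → ℕ → ℕ → Set₁
HomThresholdAtLeast 𝓕 a b =
  ∀ p q → 0 < q → p ≤ q → p * b < a * q → ¬ Good 𝓕 p q

3≤2k∸1 : ∀ {k} → 3 ≤ k → 3 ≤ 2 * k ∸ 1
3≤2k∸1 {suc (suc (suc k))} (s≤s (s≤s (s≤s _))) = s≤s (s≤s (≤-trans (s≤s z≤n) (m≤n+m (1 * suc (suc (suc k))) k)))
  where open import Data.Nat.Properties using (m≤n+m; ≤-trans)

SingleCycle : (k : ℕ) → 3 ≤ k → Family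
SingleCycle k hk = ⊤ , λ _ → Cycle (2 * k ∸ 1) (3≤2k∸1 hk)

OddCyclesUpTo : ℕ → Family
OddCyclesUpTo m =
  (Σ ℕ λ ℓ → Σ (3 ≤ ℓ) λ _ → (ℓ % 2 ≡ 1) × (ℓ ≤ m)) ,
  λ { (ℓ , h , _) → Cycle ℓ h }

{-# OPTIONS --safe #-}
module Submission where

-- Write ℓ = 2k − 1.
--
-- Lower bound: in the generalised Andrásfai graph of degree t + 1 on ℓ t + 2 vertices any two distinct
-- vertices are joined by a walk of length ℓ, so a homomorphism that identifies two of them creates a
-- closed walk of length ℓ in its image.
--
-- Upper bounds: let G be dense without odd closed walks of length ≤ ℓ. Cover the vertices by boundedly
-- many classes that are uniform, i.e. every neighbourhood meeting a class substantially reaches by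
-- walks of length j ≤ ℓ almost everything the class does. Since ℓ sets of size > n / ℓ cannot be
-- almost disjoint, two vertices with many neighbours in a common class are not joined by odd walks of
-- length ≤ ℓ − 2. Colour a vertex by the classes in which it has many neighbours and refine this
-- colouring so that walks can be copied to vertices of equal colour; the same count shows that equally
-- coloured vertices are not joined by odd walks of length ≤ ℓ. After further refinement a closed odd
-- walk of the quotient would lift to such a walk, so the quotient is a bounded image without short odd
-- cycles. A disjoint union of all admissible graphs of bounded order is then a common target.
--
-- If only the cycle of length ℓ is excluded, vertices joined by an odd path of length ≤ ℓ − 2 have
-- boundedly many common neighbours. It follows that only boundedly many vertices lie on shorter odd
-- cycles; these get colours of their own and are removed before the argument above is applied.

open import Defs
open import Data.Nat using (ℕ; zero; suc; _+_; _*_; _∸_; _^_; _/_; _%_; _≤_; _<_; z≤n; s≤s; s≤s⁻¹; ∣_-_∣; _⊓_; NonZero; >-nonZero; >-nonZero⁻¹; _≟_; _≤?_; _<?_)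
open import Data.Nat.Properties hiding (_≟_; _≤?_; _<?_)
open import Data.Nat.DivMod
open import Data.Nat.Induction using (<-rec)
open import Data.Nat.ListAction as ListAction using ()
open import Data.Nat.ListAction.Properties using (sum-++)
open import Data.Nat.Tactic.RingSolver using (solve-∀)
open import Data.Bool as Bool using (Bool; true; false; not; _xor_)
open import Data.Fin as Fin using (Fin; zero; suc; toℕ; fromℕ<; inject≤; _↑ˡ_; _↑ʳ_; splitAt; combine; remQuot; quotient; remainder; funToFin; finToFun)
open import Data.Fin.Properties as Finₚ using (any?; all?)
open import Data.List as List using (List; []; _∷_; _++_; length; map; filter; tabulate)
open import Data.List.Base using (applyUpTo)
open import Data.List.Properties using (length-++; map-++; length-applyUpTo)
open import Data.List.Membership.Propositional using (_∈_; _∉_; find; lose)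
open import Data.List.Membership.Propositional.Properties using (∈-lookup; ∈-++⁺ˡ; ∈-++⁺ʳ; ∈-applyUpTo⁻; ∈-applyUpTo⁺)
open import Data.List.Relation.Unary.All using ([]; _∷_)
open import Data.List.Relation.Unary.All.Properties using (¬Any⇒All¬; All¬⇒¬Any)
open import Data.List.Relation.Unary.AllPairs using ([]; _∷_)
open import Data.List.Relation.Unary.Any as Any using (Any; here; there)
open import Data.List.Relation.Unary.Any.Properties as Anyₚ using ()
open import Data.List.Relation.Unary.Unique.Propositional using (Unique)
open import Data.List.Relation.Unary.Unique.Propositional.Properties as Uniqueₚ using ()
open import Data.Product using (∃; ∃₂; Σ-syntax; _×_; _,_; proj₁; proj₂)
open import Data.Sum using (_⊎_; inj₁; inj₂; [_,_]′)
open import Data.Empty using (⊥)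
open import Data.Unit using (⊤; tt)
open import Function using (_∘_; id)
open import Function.Definitions using (Injective)
open import Relation.Nullary using (¬_; Dec; yes; no; contradiction)
open import Relation.Nullary.Decidable using (_×-dec_; _→-dec_; ¬?; map′)
open import Relation.Binary.Definitions using (tri<; tri≈; tri>)
open import Relation.Binary.PropositionalEquality using (_≡_; _≢_; refl; sym; trans; cong; cong₂; subst; subst₂; module ≡-Reasoning)
open import Algebra.Properties.CommutativeMonoid.Sum +-0-commutativeMonoid using (sum; sum-cong-≗; ∑-distrib-+; ∑-comm)
open import Algebra.Properties.Semiring.Sum +-*-semiring using (*-distribˡ-sum)

-- Finite sums and cardinalities

-- The target must avoid the forbidden cycles itself, while a quotient can acquire cycles that the
-- graph does not have. A cycle of the quotient is a walk in the graph that may jump inside a colour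
-- class after each edge. A refined colouring undoes such a jump by copying the rest of the walk
-- from the other vertex, at the price of one refinement level per step. What remains is a single
-- jump, between the two ends of the lifted walk, and this is what the counting excludes.
--
-- In the single-cycle case the removed vertices do not spoil the quotient. Shorter odd cycles are
-- allowed there, and as the removed vertices have private colours, a lifted closed walk of length
-- `ℓ` that repeats one of them forces the cycle of the quotient to repeat a vertex.
--
-- Densities are compared without division: an error `n / c` appears as an additive `n` beside terms
-- multiplied by `c`.

sum-mono : ∀ {n} {f g : Fin n → ℕ} → (∀ i → f i ≤ g i) → sum f ≤ sum g
sum-mono {zero}  le = z≤n
sum-mono {suc n} le = +-mono-≤ (le zero) (sum-mono (le ∘ suc))

sum-mono-gap : ∀ {n} {f g : Fin n → ℕ} {e} → (∀ i → f i ≤ g i) → ∀ i → f i + e ≤ g i → sum f + e ≤ sum g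
sum-mono-gap {suc n} {f} {g} {e} le zero gap = begin
  f zero + sum (f ∘ suc) + e   ≡⟨ lemma (f zero) _ e ⟩
  f zero + e + sum (f ∘ suc)   ≤⟨ +-mono-≤ gap (sum-mono (le ∘ suc)) ⟩
  g zero + sum (g ∘ suc)       ∎
  where
  open ≤-Reasoning
  lemma : ∀ a b c → a + b + c ≡ a + c + b
  lemma = solve-∀
sum-mono-gap {suc n} {f} {g} {e} le (suc i) gap = begin
  f zero + sum (f ∘ suc) + e     ≡⟨ +-assoc (f zero) _ e ⟩
  f zero + (sum (f ∘ suc) + e)   ≤⟨ +-mono-≤ (le zero) (sum-mono-gap (le ∘ suc) i gap) ⟩
  g zero + sum (g ∘ suc)         ∎
  where open ≤-Reasoning

sum-const : ∀ n c → sum {n} (λ _ → c) ≡ n * c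
sum-const zero    c = refl
sum-const (suc n) c = cong (c +_) (sum-const n c)

𝟙 : ∀ {A : Set} → Dec A → ℕ
𝟙 (yes _) = 1
𝟙 (no _)  = 0

𝟙-yes : ∀ {A : Set} (A? : Dec A) → A → 𝟙 A? ≡ 1
𝟙-yes (yes _) a = refl
𝟙-yes (no ¬a) a = contradiction a ¬a

𝟙-mono : ∀ {A B : Set} (A? : Dec A) (B? : Dec B) → (A → B) → 𝟙 A? ≤ 𝟙 B?
𝟙-mono (yes a) B? f = ≤-reflexive (sym (𝟙-yes B? (f a)))
𝟙-mono (no _)  B? f = z≤n

𝟙≤1 : ∀ {A : Set} (A? : Dec A) → 𝟙 A? ≤ 1
𝟙≤1 (yes _) = ≤-refl
𝟙≤1 (no _)  = z≤n

𝟙-× : ∀ {A B : Set} (A? : Dec A) (B? : Dec B) → 𝟙 (A? ×-dec B?) ≡ 𝟙 A? * 𝟙 B?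
𝟙-× (yes a) (yes b) = refl
𝟙-× (yes a) (no b)  = refl
𝟙-× (no a)  B?      = refl

card : ∀ {n} {P : Fin n → Set} → (∀ i → Dec (P i)) → ℕ
card P? = sum (λ i → 𝟙 (P? i))

module _ {n : ℕ} {P Q : Fin n → Set} (P? : ∀ i → Dec (P i)) (Q? : ∀ i → Dec (Q i)) where

  card-mono : (∀ i → P i → Q i) → card P? ≤ card Q?
  card-mono f = sum-mono (λ i → 𝟙-mono (P? i) (Q? i) (f i))

  card-+ : ∀ {R S : Fin n → Set} (R? : ∀ i → Dec (R i)) (S? : ∀ i → Dec (S i)) →
           (∀ i → P i ⊎ Q i → R i) → (∀ i → P i → Q i → S i) → card P? + card Q? ≤ card R? + card S?
  card-+ R? S? f g = begin
    card P? + card Q?                    ≡⟨ ∑-distrib-+ (λ i → 𝟙 (P? i)) (λ i → 𝟙 (Q? i)) ⟨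
    sum (λ i → 𝟙 (P? i) + 𝟙 (Q? i))      ≤⟨ sum-mono pointwise ⟩
    sum (λ i → 𝟙 (R? i) + 𝟙 (S? i))      ≡⟨ ∑-distrib-+ (λ i → 𝟙 (R? i)) (λ i → 𝟙 (S? i)) ⟩
    card R? + card S?                    ∎
    where
    open ≤-Reasoning
    pointwise : ∀ i → 𝟙 (P? i) + 𝟙 (Q? i) ≤ 𝟙 (R? i) + 𝟙 (S? i)
    pointwise i with P? i | Q? i
    ... | yes p | yes q = ≤-reflexive (sym (cong₂ _+_ (𝟙-yes (R? i) (f i (inj₁ p))) (𝟙-yes (S? i) (g i p q))))
    ... | yes p | no _  = ≤-trans (≤-reflexive (sym (𝟙-yes (R? i) (f i (inj₁ p))))) (m≤m+n _ _)
    ... | no _  | yes q = ≤-trans (≤-reflexive (sym (𝟙-yes (R? i) (f i (inj₂ q))))) (m≤m+n _ _)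
    ... | no _  | no _  = z≤n

card-∪ : ∀ {n} {P Q R : Fin n → Set}
         (P? : ∀ i → Dec (P i)) (Q? : ∀ i → Dec (Q i)) (R? : ∀ i → Dec (R i)) →
         (∀ i → R i → P i ⊎ Q i) → card R? ≤ card P? + card Q?
card-∪ P? Q? R? f = ≤-trans (sum-mono pointwise) (≤-reflexive (∑-distrib-+ (λ i → 𝟙 (P? i)) (λ i → 𝟙 (Q? i))))
  where
  pointwise : ∀ i → 𝟙 (R? i) ≤ 𝟙 (P? i) + 𝟙 (Q? i)
  pointwise i with R? i
  ... | no _  = z≤n
  ... | yes r with f i r
  ...   | inj₁ p = ≤-trans (≤-reflexive (sym (𝟙-yes (P? i) p))) (m≤m+n _ _)
  ...   | inj₂ q = ≤-trans (≤-reflexive (sym (𝟙-yes (Q? i) q))) (m≤n+m _ _)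

card-∅ : ∀ {n} {P : Fin n → Set} (P? : ∀ i → Dec (P i)) → (∀ i → ¬ P i) → card P? ≡ 0
card-∅ {zero}  P? none = refl
card-∅ {suc n} P? none with P? zero
... | yes p = contradiction p (none zero)
... | no _  = card-∅ (P? ∘ suc) (none ∘ suc)

card≤n : ∀ {n} {P : Fin n → Set} (P? : ∀ i → Dec (P i)) → card P? ≤ n
card≤n {n} P? = ≤-trans (sum-mono (λ i → 𝟙≤1 (P? i))) (≤-reflexive (trans (sum-const n 1) (*-identityʳ n)))

card>0⇒∃ : ∀ {n} {P : Fin n → Set} (P? : ∀ i → Dec (P i)) → 0 < card P? → ∃ P
card>0⇒∃ P? pos with any? P?
... | yes e = e
... | no ¬e = contradiction (card-∅ P? (λ i p → ¬e (i , p))) (λ eq → <-irrefl (sym eq) pos)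

card-disjoint : ∀ {n} {P Q R : Fin n → Set}
                (P? : ∀ i → Dec (P i)) (Q? : ∀ i → Dec (Q i)) (R? : ∀ i → Dec (R i)) →
                (∀ i → P i ⊎ Q i → R i) → (∀ i → P i → ¬ Q i) → card P? + card Q? ≤ card R?
card-disjoint P? Q? R? f disj = begin
  card P? + card Q?         ≤⟨ card-+ P? Q? R? none f disj ⟩
  card R? + card none       ≡⟨ cong (card R? +_) (card-∅ none (λ _ ())) ⟩
  card R? + 0               ≡⟨ +-identityʳ _ ⟩
  card R?                   ∎
  where
  open ≤-Reasoning
  none : Fin _ → Dec ⊥
  none _ = no (λ ())

length-filter : ∀ {n} {P : Fin n → Set} (P? : ∀ i → Dec (P i)) {m} (g : Fin m → Fin n) →
                length (filter P? (tabulate g)) ≡ card (P? ∘ g)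
length-filter P? {zero}  g = refl
length-filter P? {suc m} g with P? (g zero)
... | yes _ = cong suc (length-filter P? (g ∘ suc))
... | no _  = length-filter P? (g ∘ suc)

degree≡card : ∀ (G : Graph) v → degree G v ≡ card (adj? G v)
degree≡card G v = length-filter (adj? G v) id

pairSum : ∀ {t} → (Fin t → Fin t → ℕ) → ℕ
pairSum {zero}  w = 0
pairSum {suc t} w = sum (w zero ∘ suc) + pairSum (λ i j → w (suc i) (suc j))

pairSum-bound : ∀ {t} (w : Fin t → Fin t → ℕ) {e} → (∀ i j → i Fin.< j → w i j ≤ e) → pairSum w ≤ t * t * e
pairSum-bound {zero}  w le = z≤n
pairSum-bound {suc t} w {e} le = begin
  sum (w zero ∘ suc) + pairSum (λ i j → w (suc i) (suc j))
    ≤⟨ +-mono-≤ (sum-mono (λ j → le zero (suc j) (s≤s z≤n))) (pairSum-bound _ (λ i j i<j → le (suc i) (suc j) (s≤s i<j))) ⟩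
  sum {t} (λ _ → e) + t * t * e   ≡⟨ cong (_+ t * t * e) (sum-const t e) ⟩
  t * e + t * t * e               ≤⟨ m≤m+n _ (e + t * e) ⟩
  t * e + t * t * e + (e + t * e) ≡⟨ lemma t e ⟩
  suc t * suc t * e               ∎
  where
  open ≤-Reasoning
  lemma : ∀ t e → t * e + t * t * e + (e + t * e) ≡ (1 + t) * (1 + t) * e
  lemma = solve-∀

-- For m ones this is m ≤ 1 + m (m - 1) / 2, the pointwise form of the Bonferroni inequality.
sum≤1+pairSum : ∀ {t} (b : Fin t → ℕ) → (∀ i → b i ≤ 1) → sum b ≤ 1 + pairSum (λ i j → b i * b j)
sum≤1+pairSum {zero}  b le = z≤n
sum≤1+pairSum {suc t} b le with b zero | le zero
... | 0 | _ = ≤-trans (sum≤1+pairSum (b ∘ suc) (le ∘ suc)) (s≤s (m≤n+m _ (sum (λ (j : Fin t) → 0))))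
... | 1 | _ = s≤s (≤-trans (≤-reflexive (sum-cong-≗ (λ i → sym (+-identityʳ (b (suc i)))))) (m≤m+n _ _))
... | suc (suc _) | s≤s ()

sum-pairSum : ∀ {t n} (w : Fin n → Fin t → Fin t → ℕ) →
              sum (λ x → pairSum (w x)) ≡ pairSum (λ i j → sum (λ x → w x i j))
sum-pairSum {zero}  {n} w = trans (sum-const n 0) (*-zeroʳ n)
sum-pairSum {suc t} {n} w =
  trans (∑-distrib-+ (λ x → sum (w x zero ∘ suc)) _)
        (cong₂ _+_ (∑-comm (λ x j → w x zero (suc j))) (sum-pairSum (λ x i j → w x (suc i) (suc j))))

-- The pointwise bound is summed over `x` and the sums are exchanged. Intersections have size at
-- most `e / c`, and `t * t` is a crude count of the pairs.
bonferroni : ∀ {t n c e} (w : Fin n → Fin t → ℕ) → (∀ x i → w x i ≤ 1) →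
             (∀ i j → i Fin.< j → c * sum (λ x → w x i * w x j) ≤ e) →
             c * sum (λ i → sum (λ x → w x i)) ≤ c * n + t * t * e
bonferroni {t} {n} {c} {e} w le meet = begin
  c * sum (λ i → sum (λ x → w x i))      ≡⟨ cong (c *_) (∑-comm w) ⟨
  c * sum (λ x → sum (w x))              ≤⟨ *-monoʳ-≤ c (sum-mono (λ x → sum≤1+pairSum (w x) (le x))) ⟩
  c * sum (λ x → 1 + pairSum (v x))      ≡⟨ cong (c *_) (∑-distrib-+ (λ _ → 1) (λ x → pairSum (v x))) ⟩
  c * (sum {n} (λ _ → 1) + sum (λ x → pairSum (v x)))
    ≡⟨ cong (c *_) (cong₂ _+_ (trans (sum-const n 1) (*-identityʳ n)) (sum-pairSum v)) ⟩
  c * (n + pairSum v′)                   ≡⟨ *-distribˡ-+ c n _ ⟩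
  c * n + c * pairSum v′                 ≡⟨ cong (c * n +_) (scale v′) ⟩
  c * n + pairSum (λ i j → c * v′ i j)   ≤⟨ +-monoʳ-≤ (c * n) (pairSum-bound _ meet) ⟩
  c * n + t * t * e                      ∎
  where
  open ≤-Reasoning
  v : Fin n → Fin t → Fin t → ℕ
  v x i j = w x i * w x j
  v′ : Fin t → Fin t → ℕ
  v′ i j = sum (λ x → v x i j)
  scale : ∀ {t} (u : Fin t → Fin t → ℕ) → c * pairSum u ≡ pairSum (λ i j → c * u i j)
  scale {zero}  u = *-zeroʳ c
  scale {suc t} u = trans (*-distribˡ-+ c (sum (u zero ∘ suc)) _)
                          (cong₂ _+_ (*-distribˡ-sum c (u zero ∘ suc)) (scale (λ i j → u (suc i) (suc j))))

module _ {t n : ℕ} {A : Fin t → Fin n → Set} (A? : ∀ a i → Dec (A a i)) where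

  card-bonferroni : ∀ {c e} → (∀ a b → a Fin.< b → c * card (λ i → A? a i ×-dec A? b i) ≤ e) →
                    c * sum (λ a → card (A? a)) ≤ c * n + t * t * e
  card-bonferroni {c} meet =
    bonferroni {c = c} (λ i a → 𝟙 (A? a i)) (λ i a → 𝟙≤1 (A? a i))
      (λ a b a<b → ≤-trans (≤-reflexive (cong (c *_) (sum-cong-≗ (λ i → sym (𝟙-× (A? a i) (A? b i)))))) (meet a b a<b))

-- Parity

odd : ℕ → Bool
odd zero    = false
odd (suc n) = not (odd n)

odd-+ : ∀ m n → odd (m + n) ≡ odd m xor odd n
odd-+ zero    n = refl
odd-+ (suc m) n rewrite odd-+ m n with odd m
... | true  = not-not (odd n)
  where
  not-not : ∀ b → not (not b) ≡ b
  not-not true  = refl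
  not-not false = refl
... | false = refl

odd-drop-even : ∀ i d g → odd d ≡ false → odd (i + d + g) ≡ true → odd (i + g) ≡ true
odd-drop-even i d g even total = begin
  odd (i + g)             ≡⟨ odd-+ i g ⟩
  odd i xor odd g         ≡⟨ cong (_xor odd g) (lemma (odd i) even) ⟩
  (odd i xor odd d) xor odd g ≡⟨ cong (_xor odd g) (odd-+ i d) ⟨
  odd (i + d) xor odd g   ≡⟨ odd-+ (i + d) g ⟨
  odd (i + d + g)         ≡⟨ total ⟩
  true ∎
  where
  open ≡-Reasoning
  lemma : ∀ a {b} → b ≡ false → a ≡ a xor b
  lemma true  refl = refl
  lemma false refl = refl

odd-complement : ∀ i d → odd i ≡ false → odd (i + d) ≡ true → odd d ≡ true
odd-complement i d even total = trans (sym (trans (odd-+ i d) (cong (_xor odd d) even))) total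

even-complement : ∀ i d → odd i ≡ true → odd (i + d) ≡ true → odd d ≡ false
even-complement i d oddi total with odd d in eq
... | false = refl
... | true  = contradiction (trans (sym total) (trans (odd-+ i d) (cong₂ _xor_ oddi eq))) (λ ())

odd-gap : ∀ {m n} → odd m ≡ true → odd n ≡ true → m < n → 2 + m ≤ n
odd-gap {m} {n} om on m<n with m≤n⇒m<n∨m≡n m<n
... | inj₁ lt   = lt
... | inj₂ refl = contradiction (trans (sym on) (cong not om)) (λ ())

-- Walks

module _ {V : Set} (E : V → V → Set) where

  data Walk : ℕ → V → V → Set where
    []  : ∀ {x} → Walk 0 x x
    _∷_ : ∀ {m x y z} → E x y → Walk m y z → Walk (suc m) x z

  infixr 5 _∷_

module _ {V : Set} {E : V → V → Set} where

  infixr 5 _⊕_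

  _⊕_ : ∀ {m m′ x y z} → Walk E m x y → Walk E m′ y z → Walk E (m + m′) x z
  []      ⊕ w′ = w′
  (e ∷ w) ⊕ w′ = e ∷ (w ⊕ w′)

  reverse : (∀ {x y} → E x y → E y x) → ∀ {m x y} → Walk E m x y → Walk E m y x
  reverse E-sym []                = []
  reverse E-sym {x = x} {y} (_∷_ {m = m} e w) =
    subst (λ l → Walk E l y x) (+-comm m 1) (reverse E-sym w ⊕ (E-sym e ∷ []))

  -- Indices beyond the length give the endpoint, so positions carry no bounds.
  at : ∀ {m x y} → Walk E m x y → ℕ → V
  at {x = x} []      _       = x
  at {x = x} (e ∷ w) zero    = x
  at         (e ∷ w) (suc i) = at w i

  at-start : ∀ {m x y} (w : Walk E m x y) → at w 0 ≡ x
  at-start []      = refl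
  at-start (_ ∷ _) = refl

  at-end : ∀ {m x y} (w : Walk E m x y) → at w m ≡ y
  at-end []      = refl
  at-end (_ ∷ w) = at-end w

  at-step : ∀ {m x y} (w : Walk E m x y) i → i < m → E (at w i) (at w (suc i))
  at-step (e ∷ w) zero    _         = subst (E _) (sym (at-start w)) e
  at-step (e ∷ w) (suc i) (s≤s i<m) = at-step w i i<m

  segment : ∀ {r} (z : ℕ → V) → (∀ i → i < r → E (z i) (z (suc i))) →
            ∀ i d → i + d ≤ r → Walk E d (z i) (z (i + d))
  segment z step i zero    le = subst (λ j → Walk E 0 (z i) (z j)) (sym (+-identityʳ i)) []
  segment z step i (suc d) le =
    step i (≤-trans (s≤s (m≤m+n i d)) le′) ∷
      subst (λ j → Walk E d (z (suc i)) (z j)) (sym (+-suc i d)) (segment z step (suc i) d le′)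
    where le′ = ≤-trans (≤-reflexive (sym (+-suc i d))) le

  module _ {m x y} (w : Walk E m x y) where

    at-segment : ∀ i d → i + d ≤ m → Walk E d (at w i) (at w (i + d))
    at-segment = segment (at w) (at-step w)

    at-prefix : ∀ i → i ≤ m → Walk E i x (at w i)
    at-prefix i i≤m = subst (λ v → Walk E i v (at w i)) (at-start w) (at-segment 0 i i≤m)

    at-suffix : ∀ i d → i + d ≡ m → Walk E d (at w i) y
    at-suffix i d refl = subst (Walk E d (at w i)) (at-end w) (at-segment i d ≤-refl)

walk? : ∀ {n} {E : Fin n → Fin n → Set} → (∀ x y → Dec (E x y)) → ∀ m x y → Dec (Walk E m x y)
walk? E? zero    x y = map′ (λ { refl → [] }) (λ { [] → refl }) (x Finₚ.≟ y)
walk? E? (suc m) x y = map′ (λ { (_ , e , w) → e ∷ w }) (λ { (e ∷ w) → _ , e , w })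
                            (any? (λ z → E? x z ×-dec walk? E? m z y))

-- Covers by uniform classes

m<n*suc[m/n] : ∀ m n .{{_ : NonZero n}} → m < n * suc (m / n)
m<n*suc[m/n] m n = begin-strict
  m                       ≡⟨ m≡m%n+[m/n]*n m n ⟩
  m % n + m / n * n       <⟨ +-monoˡ-< (m / n * n) (m%n<n m n) ⟩
  n + m / n * n           ≡⟨ cong (n +_) (*-comm (m / n) n) ⟩
  n + n * (m / n)         ≡⟨ *-suc n (m / n) ⟨
  n * suc (m / n)         ∎
  where open ≤-Reasoning

module _ (q : ℕ) where

  -- `L` counts the levels of potential left and `f` the parts that may still be split off at the
  -- current level. A part that is split off starts afresh one level lower, with `q` splits.
  peelSize : ℕ → ℕ → ℕ
  peelSize zero    f       = 1
  peelSize (suc L) zero    = 1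
  peelSize (suc L) (suc f) = peelSize L q + peelSize (suc L) f

  coverSize : ℕ → ℕ
  coverSize L = peelSize L q

  1≤peelSize : ∀ L f → 1 ≤ peelSize L f
  1≤peelSize zero    f       = ≤-refl
  1≤peelSize (suc L) zero    = ≤-refl
  1≤peelSize (suc L) (suc f) = ≤-trans (1≤peelSize (suc L) f) (m≤n+m _ (peelSize L q))

module Uniformity {n : ℕ} {E : Fin n → Fin n → Set} (E? : ∀ x y → Dec (E x y)) (ℓ c : ℕ) where

  Reach : ℕ → (Fin n → Set) → Fin n → Set
  Reach j Q v = ∃ λ u → Q u × Walk E j u v

  reach? : ∀ j {Q : Fin n → Set} → (∀ v → Dec (Q v)) → ∀ v → Dec (Reach j Q v)
  reach? j Q? v = any? (λ u → Q? u ×-dec walk? E? j u v)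

  Reach-mono : ∀ j {P Q : Fin n → Set} → (∀ v → P v → Q v) → ∀ v → Reach j P v → Reach j Q v
  Reach-mono j f v (u , p , w) = u , f u p , w

  nbrs? : ∀ u {Q : Fin n → Set} → (∀ v → Dec (Q v)) → ∀ v → Dec (E u v × Q v)
  nbrs? u Q? v = E? u v ×-dec Q? v

  -- The additive `n` is an error of `n / c` vertices; `suc j` runs over the walk lengths from 1 to
  -- `ℓ`.
  Uniform : ∀ {Q : Fin n → Set} → (∀ v → Dec (Q v)) → ℕ → Set
  Uniform Q? τ = ∀ u → τ < card (nbrs? u Q?) → ∀ j → j < ℓ →
    c * card (reach? (suc j) Q?) ≤ c * card (reach? (suc j) (nbrs? u Q?)) + n

  record Class : Set₁ where
    field
      {mem}   : Fin n → Set
      mem?    : ∀ v → Dec (mem v)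
      τ       : ℕ
      uniform : Uniform mem? τ
  open Class public

  totalτ : List Class → ℕ
  totalτ Cs = ListAction.sum (map τ Cs)

  record Cover {Q : Fin n → Set} (Q? : ∀ v → Dec (Q v)) (q bound size : ℕ) : Set₁ where
    field
      classes : List Class
      covers  : ∀ v → Q v → Any (λ C → mem C v) classes
      small   : q * totalτ classes ≤ bound
      few     : length classes ≤ size
  open Cover public

  weight : ∀ {Q : Fin n → Set} → (∀ v → Dec (Q v)) → Fin ℓ → ℕ
  weight Q? j = c * card (reach? (suc (toℕ j)) Q?)

  -- A violation lowers one weight by more than `n` and raises none, so splits are nested at most
  -- `ℓ * c` deep.
  potential : ∀ {Q : Fin n → Set} → (∀ v → Dec (Q v)) → ℕ
  potential Q? = sum (weight Q?)

  potential≤ : ∀ {Q : Fin n → Set} (Q? : ∀ v → Dec (Q v)) → potential Q? ≤ ℓ * c * n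
  potential≤ Q? = begin
    potential Q?          ≤⟨ sum-mono {f = weight Q?} {g = λ _ → c * n} (λ j → *-monoʳ-≤ c (card≤n (reach? (suc (toℕ j)) Q?))) ⟩
    sum {ℓ} (λ _ → c * n) ≡⟨ sum-const ℓ (c * n) ⟩
    ℓ * (c * n)           ≡⟨ *-assoc ℓ c n ⟨
    ℓ * c * n             ∎
    where open ≤-Reasoning

  weight-mono : ∀ {P Q : Fin n → Set} (P? : ∀ v → Dec (P v)) (Q? : ∀ v → Dec (Q v)) →
                (∀ v → P v → Q v) → ∀ j → weight P? j ≤ weight Q? j
  weight-mono P? Q? f j = *-monoʳ-≤ c (card-mono (reach? (suc (toℕ j)) P?) (reach? (suc (toℕ j)) Q?) (Reach-mono (suc (toℕ j)) f))

  Violation : ∀ {Q : Fin n → Set} → (∀ v → Dec (Q v)) → ℕ → Fin n → Fin ℓ → Set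
  Violation Q? τ u j = τ < card (nbrs? u Q?) × weight (nbrs? u Q?) j + n < weight Q? j

  violation? : ∀ {Q : Fin n → Set} (Q? : ∀ v → Dec (Q v)) τ → Dec (∃₂ (Violation Q? τ))
  violation? Q? τ = any? (λ u → any? (λ j → (_ <? _) ×-dec (_ <? _)))

  no-violation : ∀ {Q : Fin n → Set} (Q? : ∀ v → Dec (Q v)) τ → ¬ ∃₂ (Violation Q? τ) → Uniform Q? τ
  no-violation Q? τ none u big j j<ℓ = ≮⇒≥ (λ lt → none (u , Fin.fromℕ< j<ℓ , big ,
    subst (λ i → c * card (reach? (suc i) (nbrs? u Q?)) + n < c * card (reach? (suc i) Q?))
          (sym (Finₚ.toℕ-fromℕ< j<ℓ)) lt))

  relax : ∀ {Q : Fin n → Set} {Q? : ∀ v → Dec (Q v)} {q b b′ s} → b ≤ b′ → Cover Q? q b s → Cover Q? q b′ s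
  relax le C = record { classes = classes C ; covers = covers C ; small = ≤-trans (small C) le ; few = few C }

  merge : ∀ {P Q R : Fin n → Set} {P? : ∀ v → Dec (P v)} {Q? : ∀ v → Dec (Q v)} {R? : ∀ v → Dec (R v)} {q b b′ s s′} →
          (∀ v → R v → P v ⊎ Q v) → Cover P? q b s → Cover Q? q b′ s′ → Cover R? q (b + b′) (s + s′)
  merge {q = q} {b} {b′} {s} {s′} split C D = record
    { classes = classes C ++ classes D
    ; covers  = λ v Rv → [ Anyₚ.++⁺ˡ ∘ covers C v , Anyₚ.++⁺ʳ (classes C) ∘ covers D v ]′ (split v Rv)
    ; small   = begin
        q * totalτ (classes C ++ classes D)
          ≡⟨ cong (q *_) (trans (cong ListAction.sum (map-++ τ (classes C) (classes D))) (sum-++ (map τ (classes C)) _)) ⟩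
        q * (totalτ (classes C) + totalτ (classes D))      ≡⟨ *-distribˡ-+ q (totalτ (classes C)) _ ⟩
        q * totalτ (classes C) + q * totalτ (classes D)    ≤⟨ +-mono-≤ (small C) (small D) ⟩
        b + b′                                             ∎
    ; few     = begin
        length (classes C ++ classes D)           ≡⟨ length-++ (classes C) ⟩
        length (classes C) + length (classes D)   ≤⟨ +-mono-≤ (few C) (few D) ⟩
        s + s′                                    ∎
    }
    where open ≤-Reasoning

  module _ (q : ℕ) .{{_ : NonZero q}} where

    -- As long as a set violates uniformity, the offending neighbourhood (whose potential is lower
    -- by n) is split off; it has more than τ elements, so at most q parts are split off at each level.
    mutual
      cover : ∀ L {Q : Fin n → Set} (Q? : ∀ v → Dec (Q v)) → potential Q? ≤ L * n →
              Cover Q? q (suc L * card Q?) (coverSize q L)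
      -- The class that remains costs `q * τ ≤ card Q?`. The parts split off are disjoint subsets
      -- treated one level lower, so together they cost at most `L * card Q?`.
      cover L Q? pot = relax
        (+-monoˡ-≤ (L * card Q?) (≤-trans (≤-reflexive (*-comm q _)) (m/n*n≤m (card Q?) q)))
        (peel L q (card Q? / q) Q? (m<n*suc[m/n] (card Q?) q) pot)

      peel : ∀ L f τ {Q : Fin n → Set} (Q? : ∀ v → Dec (Q v)) → card Q? < f * suc τ → potential Q? ≤ L * n →
             Cover Q? q (q * τ + L * card Q?) (peelSize q L f)
      peel L f τ {Q} Q? fuel pot with violation? Q? τ
      ... | no none = record
        { classes = record { mem? = Q? ; τ = τ ; uniform = no-violation Q? τ none } ∷ []
        ; covers = λ v Qv → here Qv
        ; small = ≤-trans (≤-reflexive (cong (q *_) (+-identityʳ τ))) (m≤m+n (q * τ) (L * card Q?))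
        ; few = 1≤peelSize q L f
        }
      -- At level 0 the potential is 0, so no weight can have dropped.
      peel zero f τ Q? fuel pot | yes (u , j , big , drop) = contradiction drop (≤⇒≯ (≤-trans
        (≤-trans (m≤n+m _ (sum {ℓ} (λ _ → 0)))
                 (sum-mono-gap {f = λ _ → 0} {g = weight Q?} (λ _ → z≤n) j ≤-refl))
        (≤-trans pot z≤n)))
      peel (suc L) zero τ Q? () pot | yes _
      peel (suc L) (suc f) τ {Q} Q? fuel pot | yes (u , j , big , drop) = relax bound
        (merge split (cover L D? potD) (peel (suc L) f τ rest? fuel′ potR))
        where
        D? : ∀ v → Dec (E u v × Q v)
        D? = nbrs? u Q?
        rest? : ∀ v → Dec (¬ E u v × Q v)
        rest? v = ¬? (E? u v) ×-dec Q? v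
        split : ∀ v → Q v → (E u v × Q v) ⊎ (¬ E u v × Q v)
        split v Qv with E? u v
        ... | yes e = inj₁ (e , Qv)
        ... | no ¬e = inj₂ (¬e , Qv)
        sizes : card D? + card rest? ≤ card Q?
        sizes = card-disjoint D? rest? Q? (λ _ → [ proj₂ , proj₂ ]′) (λ _ d r → proj₁ r (proj₁ d))
        fuel′ : card rest? < f * suc τ
        fuel′ = +-cancelˡ-< (suc τ) _ _ (≤-<-trans (≤-trans (+-monoˡ-≤ _ big) sizes) fuel)
        gap : potential D? + n ≤ potential Q?
        gap = sum-mono-gap {f = weight D?} {g = weight Q?} (weight-mono D? Q? (λ _ → proj₂)) j (<⇒≤ drop)
        potD : potential D? ≤ L * n
        potD = +-cancelʳ-≤ n _ _ (≤-trans gap (≤-trans pot (≤-reflexive (+-comm n (L * n)))))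
        potR : potential rest? ≤ suc L * n
        potR = ≤-trans (sum-mono {f = weight rest?} {g = weight Q?} (weight-mono rest? Q? (λ _ → proj₂))) pot
        bound : suc L * card D? + (q * τ + suc L * card rest?) ≤ q * τ + suc L * card Q?
        bound = begin
          suc L * card D? + (q * τ + suc L * card rest?)   ≡⟨ lemma (suc L) (card D?) (q * τ) (card rest?) ⟩
          q * τ + suc L * (card D? + card rest?)           ≤⟨ +-monoʳ-≤ (q * τ) (*-monoʳ-≤ (suc L) sizes) ⟩
          q * τ + suc L * card Q?                          ∎
          where
          open ≤-Reasoning
          lemma : ∀ a b c d → a * b + (c + a * d) ≡ c + a * (b + d)
          lemma = solve-∀

snoc : ∀ {V : Set} {E : V → V → Set} {m x y z} → Walk E m x y → E y z → Walk E (suc m) x z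
snoc {E = E} {m} {x} {z = z} w e = subst (λ l → Walk E l x z) (+-comm m 1) (w ⊕ (e ∷ []))

∃-summand : ∀ {m n} → m ≤ n → ∃ λ g → m + g ≡ n
∃-summand {m} {n} m≤n = n ∸ m , m+[n∸m]≡n m≤n

-- Odd walks between vertices with many neighbours in a common class

module Dense {n : ℕ} {E : Fin n → Fin n → Set} (E? : ∀ x y → Dec (E x y)) (E-sym : ∀ {x y} → E x y → E y x)
             (ℓ c d : ℕ) (ℓ-odd : odd ℓ ≡ true)
             -- Asked only of endpoints of edges: in the application an exceptional set of vertices
             -- is isolated for `E`.
             (degree≥d : ∀ {x y} → E x y → d ≤ card (E? x))
             (no-odd : ∀ {m v} → Walk E m v v → odd m ≡ true → ¬ m ≤ ℓ)
             -- `ℓ * d` exceeds `n` by more than ℓ² + ℓ errors of `n / c`: one for the size of each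
             -- of `ℓ` sets and one for each of at most ℓ² pairs.
             (dense : c * n + (ℓ * ℓ * n + ℓ * n) < ℓ * (c * d))
  where

  open Uniformity E? ℓ c public

  n<c*d : n < c * d
  n<c*d with n <? c * d
  ... | yes lt = lt
  ... | no ¬lt = contradiction dense (≤⇒≯ (begin
    ℓ * (c * d)                      ≤⟨ *-monoʳ-≤ ℓ (≮⇒≥ ¬lt) ⟩
    ℓ * n                            ≤⟨ m≤n+m _ (ℓ * ℓ * n) ⟩
    ℓ * ℓ * n + ℓ * n                ≤⟨ m≤n+m _ (c * n) ⟩
    c * n + (ℓ * ℓ * n + ℓ * n)      ∎))
    where open ≤-Reasoning

  -- Bonferroni against `dense`. The equation `t ≡ ℓ` is kept because the families are indexed by
  -- `Fin (2 + r)` or `Fin (suc r)`.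
  ℓ-sets-meet : ∀ {t} → t ≡ ℓ → {A : Fin t → Fin n → Set} (A? : ∀ a v → Dec (A a v)) →
          (∀ a → c * d ≤ c * card (A? a) + n) →
          ¬ (∀ a b → a Fin.< b → c * card (λ v → A? a v ×-dec A? b v) ≤ n)
  ℓ-sets-meet refl A? large meet = <⇒≱ dense (begin
    ℓ * (c * d)                                ≡⟨ sum-const ℓ (c * d) ⟨
    sum {ℓ} (λ _ → c * d)                      ≤⟨ sum-mono {f = λ _ → c * d} {g = λ a → c * card (A? a) + n} large ⟩
    sum (λ a → c * card (A? a) + n)            ≡⟨ ∑-distrib-+ (λ a → c * card (A? a)) (λ _ → n) ⟩
    sum (λ a → c * card (A? a)) + sum {ℓ} (λ _ → n)
      ≡⟨ cong₂ _+_ (sym (*-distribˡ-sum c (λ a → card (A? a)))) (sum-const ℓ n) ⟩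
    c * sum (λ a → card (A? a)) + ℓ * n        ≤⟨ +-monoˡ-≤ (ℓ * n) (card-bonferroni A? {c} meet) ⟩
    c * n + ℓ * ℓ * n + ℓ * n                  ≡⟨ +-assoc (c * n) _ _ ⟩
    c * n + (ℓ * ℓ * n + ℓ * n)                ∎)
    where open ≤-Reasoning

  c*0≤n : ∀ {P : Fin n → Set} (P? : ∀ v → Dec (P v)) → (∀ v → ¬ P v) → c * card P? ≤ n
  c*0≤n P? none = ≤-trans (≤-reflexive (trans (cong (c *_) (card-∅ P? none)) (*-zeroʳ c))) z≤n

  Big : Class → Fin n → Set
  Big C u = τ C < card (nbrs? u (mem? C))

  big? : ∀ C u → Dec (Big C u)
  big? C u = _ <? _

  -- For 2 + r = ℓ the common neighbours of D and D′ and the neighbourhoods of the 1 + r vertices of the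
  -- walk are ℓ almost disjoint sets: at an odd gap a common neighbour closes a short odd walk, and at an
  -- even gap i , i + d all common neighbours lie in Reach (2 + i) of the class but not in that of D′.
  module _ (C : Class) {r u u′} (w : Walk E r u u′) (r-odd : odd r ≡ true) (big : Big C u) (big′ : Big C u′) where

    private
      z : ℕ → Fin n
      z = at w

      D? : ∀ v → Dec (E u v × mem C v)
      D? = nbrs? u (mem? C)

      D′? : ∀ v → Dec (E u′ v × mem C v)
      D′? = nbrs? u′ (mem? C)

      A₀? : ∀ v → Dec (Reach 1 (λ v → E u v × mem C v) v × Reach 1 (λ v → E u′ v × mem C v) v)
      A₀? v = reach? 1 D? v ×-dec reach? 1 D′? v

      -- Both reached sets lie in `Reach 1` of the class, and by uniformity that of `u` misses at
      -- most `n / c` of it. So the intersection is all but `n / c` of the set of `u′`, which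
      -- contains the whole neighbourhood of some `y`.
      A₀-size : 1 ≤ ℓ → c * d ≤ c * card A₀? + n
      A₀-size 1≤ℓ with card>0⇒∃ D′? (≤-<-trans z≤n big′)
      ... | y , u′y , y∈C = ≤-trans (*-monoʳ-≤ c d≤) (+-cancelˡ-≤ (c * card (reach? 1 D?)) _ _ (begin
        c * card (reach? 1 D?) + c * card (reach? 1 D′?)    ≡⟨ *-distribˡ-+ c (card (reach? 1 D?)) _ ⟨
        c * (card (reach? 1 D?) + card (reach? 1 D′?))
          ≤⟨ *-monoʳ-≤ c (card-+ (reach? 1 D?) (reach? 1 D′?) (reach? 1 (mem? C)) A₀?
               (λ v → [ Reach-mono 1 (λ _ → proj₂) v , Reach-mono 1 (λ _ → proj₂) v ]′) (λ _ → _,_)) ⟩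
        c * (card (reach? 1 (mem? C)) + card A₀?)           ≡⟨ *-distribˡ-+ c (card (reach? 1 (mem? C))) _ ⟩
        c * card (reach? 1 (mem? C)) + c * card A₀?         ≤⟨ +-monoˡ-≤ _ (uniform C u big 0 1≤ℓ) ⟩
        c * card (reach? 1 D?) + n + c * card A₀?           ≡⟨ lemma (c * card (reach? 1 D?)) n (c * card A₀?) ⟩
        c * card (reach? 1 D?) + (c * card A₀? + n)         ∎))
        where
        open ≤-Reasoning
        d≤ : d ≤ card (reach? 1 D′?)
        d≤ = ≤-trans (degree≥d (E-sym u′y))
                     (card-mono (E? y) (reach? 1 D′?) (λ v yv → y , (u′y , y∈C) , yv ∷ []))
        lemma : ∀ a b c → a + b + c ≡ a + (c + b)
        lemma = solve-∀

      -- With room for four more edges one vertex `v` of `A₀` suffices: v, x, u, ..., u′, x′, v is a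
      -- closed walk of odd length `4 + r`.
      short : 4 + r ≤ ℓ → ⊥
      short 4+r≤ℓ with card>0⇒∃ A₀? (n≢0⇒n>0 (λ eq → <⇒≱ n<c*d
        (≤-trans (A₀-size (≤-trans (s≤s z≤n) 4+r≤ℓ)) (≤-reflexive (cong (_+ n) (trans (cong (c *_) eq) (*-zeroʳ c)))))))
      ... | v , (x , (ux , _) , xv ∷ []) , (x′ , (u′x′ , _) , x′v ∷ []) =
        no-odd (E-sym xv ∷ E-sym ux ∷ snoc (snoc w u′x′) x′v) (cong (not ∘ not ∘ not ∘ not) r-odd) 4+r≤ℓ

      module _ (2+r≡ℓ : 2 + r ≡ ℓ) where

        A : Fin (2 + r) → Fin n → Set
        A zero    v = Reach 1 (λ v → E u v × mem C v) v × Reach 1 (λ v → E u′ v × mem C v) v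
        A (suc i) v = E (z (toℕ i)) v

        A? : ∀ a v → Dec (A a v)
        A? zero    = A₀?
        A? (suc i) = E? (z (toℕ i))

        closed : ∀ {m v} → Walk E m v v → odd m ≡ true → m ≤ 2 + r → ⊥
        closed cw m-odd m≤ = no-odd cw m-odd (≤-trans m≤ (≤-reflexive 2+r≡ℓ))

        toℕ≤r : (i : Fin (suc r)) → toℕ i ≤ r
        toℕ≤r i = s≤s⁻¹ (Finₚ.toℕ<n i)

        z-out : ∀ i → i ≤ r → ∃ λ y → E (z i) y
        z-out i i≤r with m≤n⇒m<n∨m≡n i≤r
        ... | inj₁ i<r  = _ , at-step w i i<r
        ... | inj₂ refl with card>0⇒∃ D′? (≤-<-trans z≤n big′)
        ...   | y , u′y , _ = y , subst (λ x → E x y) (sym (at-end w)) u′y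

        -- Two edges lead from `v` to either end of the walk. The end at even distance from `z i` is
        -- chosen, which makes the closed walk odd.
        A₀-disjoint : ∀ i → i ≤ r → ∀ v → ¬ (A zero v × E (z i) v)
        A₀-disjoint i i≤r v (((x , (ux , _) , xv ∷ []) , (x′ , (u′x′ , _) , x′v ∷ [])) , zv)
          with ∃-summand i≤r | odd i in eq
        ... | g , i+g≡r | false =
          closed (E-sym xv ∷ E-sym ux ∷ snoc (at-prefix w i i≤r) zv) (cong (not ∘ not ∘ not) eq)
                 (s≤s (s≤s (≤∧≢⇒< i≤r (λ { refl → contradiction (trans (sym eq) r-odd) (λ ()) }))))
        ... | g , i+g≡r | true =
          closed (E-sym zv ∷ snoc (snoc (at-suffix w i g i+g≡r) u′x′) x′v)
                 (cong (not ∘ not ∘ not) (even-complement i g eq (trans (cong odd i+g≡r) r-odd)))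
                 (s≤s (s≤s (g<r i eq i+g≡r)))
          where
          g<r : ∀ i → odd i ≡ true → i + g ≡ r → g < r
          g<r (suc i) _ refl = s≤s (m≤n+m g i)

        meet-bound : ∀ i d g → 0 < d → i + d + g ≡ r →
                     c * card (λ v → E? (z i) v ×-dec E? (z (i + d)) v) ≤ n
        meet-bound i d g 0<d eq with odd d in d-parity
        ... | true = c*0≤n _ (λ v (zv , z′v) →
          closed (snoc (snoc (at-segment w i d (≤-trans (m≤m+n (i + d) g) (≤-reflexive eq))) z′v) (E-sym zv))
                 (cong (not ∘ not) d-parity)
                 (s≤s (s≤s (≤-trans (m≤n+m d i) (≤-trans (m≤m+n (i + d) g) (≤-reflexive eq))))))
        ... | false = +-cancelˡ-≤ (c * card (reach? (2 + i) D′?)) _ _ (begin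
          c * card (reach? (2 + i) D′?) + c * card M?       ≡⟨ *-distribˡ-+ c (card (reach? (2 + i) D′?)) _ ⟨
          c * (card (reach? (2 + i) D′?) + card M?)         ≤⟨ *-monoʳ-≤ c (card-disjoint (reach? (2 + i) D′?) M? (reach? (2 + i) (mem? C)) inside apart) ⟩
          c * card (reach? (2 + i) (mem? C))                ≤⟨ uniform C u′ big′ (suc i) (≤-trans (s≤s (s≤s i≤r)) (≤-reflexive 2+r≡ℓ)) ⟩
          c * card (reach? (2 + i) D′?) + n                 ∎)
          where
          open ≤-Reasoning
          i≤r : i ≤ r
          i≤r = ≤-trans (m≤m+n i d) (≤-trans (m≤m+n (i + d) g) (≤-reflexive eq))
          M? : ∀ v → Dec (E (z i) v × E (z (i + d)) v)
          M? v = E? (z i) v ×-dec E? (z (i + d)) v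
          inside : ∀ v → Reach (2 + i) (λ v → E u′ v × mem C v) v ⊎ (E (z i) v × E (z (i + d)) v) → Reach (2 + i) (mem C) v
          inside v (inj₁ p) = Reach-mono (2 + i) (λ _ → proj₂) v p
          inside v (inj₂ (zv , _)) with card>0⇒∃ D? (≤-<-trans z≤n big)
          ... | x , ux , x∈C = x , x∈C , E-sym ux ∷ snoc (at-prefix w i i≤r) zv
          -- A positive even gap is at least 2, which keeps the closed walk of length `4 + (i + g)`
          -- within `2 + r`.
          2≤d : ∀ d → 0 < d → odd d ≡ false → 2 ≤ d
          2≤d (suc (suc d)) _ _ = s≤s (s≤s z≤n)
          apart : ∀ v → Reach (2 + i) (λ v → E u′ v × mem C v) v → ¬ (E (z i) v × E (z (i + d)) v)
          apart v (x , (u′x , _) , xv) (_ , z′v) =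
            closed (subst (λ m → Walk E m x x) (lemma i g) (xv ⊕ (E-sym z′v ∷ snoc (at-suffix w (i + d) g eq) u′x)))
                   (cong (not ∘ not ∘ not ∘ not) (odd-drop-even i d g d-parity (trans (cong odd eq) r-odd)))
                   (s≤s (s≤s (≤-trans (≤-trans (≤-reflexive (lemma′ i g)) (+-monoˡ-≤ g (+-monoʳ-≤ i (2≤d d 0<d d-parity)))) (≤-reflexive eq))))
            where
            lemma : ∀ i g → 2 + i + (1 + (1 + g)) ≡ 4 + (i + g)
            lemma = solve-∀
            lemma′ : ∀ i g → 2 + (i + g) ≡ i + 2 + g
            lemma′ = solve-∀

        long : ⊥
        long = ℓ-sets-meet 2+r≡ℓ A? sizes meets
          where
          sizes : ∀ a → c * d ≤ c * card (A? a) + n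
          sizes zero    = A₀-size (≤-trans (s≤s z≤n) (≤-reflexive 2+r≡ℓ))
          sizes (suc i) = ≤-trans (*-monoʳ-≤ c (degree≥d (proj₂ (z-out (toℕ i) (toℕ≤r i))))) (m≤m+n _ n)
          meets : ∀ a b → a Fin.< b → c * card (λ v → A? a v ×-dec A? b v) ≤ n
          meets zero    (suc j) _ = c*0≤n _ (A₀-disjoint (toℕ j) (toℕ≤r j))
          meets (suc i) (suc j) (s≤s i<j) with ∃-summand (<⇒≤ i<j) | ∃-summand (toℕ≤r j)
          ... | d′ , i+d≡j | g , j+g≡r =
            subst (λ k → c * card (λ v → E? (z (toℕ i)) v ×-dec E? (z k) v) ≤ n) i+d≡j
              (meet-bound (toℕ i) d′ g
                (n≢0⇒n>0 (λ { refl → <-irrefl (trans (sym (+-identityʳ _)) i+d≡j) i<j }))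
                (trans (cong (_+ g) i+d≡j) j+g≡r))

    big-ends-far : ¬ 2 + r ≤ ℓ
    big-ends-far 2+r≤ℓ with m≤n⇒m<n∨m≡n 2+r≤ℓ
    ... | inj₁ lt = short (odd-gap (cong (not ∘ not) r-odd) ℓ-odd lt)
    ... | inj₂ eq = long eq

  -- Each class that is small for `Q` accounts for at most `τ` elements. The recursion shrinks only
  -- `P`; `Q` stays fixed, so the smallness conditions do not change.
  small-cover : ∀ (Cs : List Class) {P Q : Fin n → Set} (P? : ∀ v → Dec (P v)) (Q? : ∀ v → Dec (Q v)) →
                (∀ v → P v → Q v) → (∀ v → P v → Any (λ C → mem C v × card (λ v → Q? v ×-dec mem? C v) ≤ τ C) Cs) →
                card P? ≤ totalτ Cs
  small-cover []       P? Q? P⊆Q cov = ≤-reflexive (card-∅ P? (λ v p → contradiction (cov v p) (λ ())))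
  small-cover (C ∷ Cs) {P} {Q} P? Q? P⊆Q cov =
    ≤-trans (card-∪ first? rest? P? split)
            (+-mono-≤ first≤τ (small-cover Cs rest? Q? (λ v → P⊆Q v ∘ proj₁) cov′))
    where
    small? : Dec (card (λ v → Q? v ×-dec mem? C v) ≤ τ C)
    small? = _ ≤? _
    Small = card (λ v → Q? v ×-dec mem? C v) ≤ τ C
    first? : ∀ v → Dec (Q v × mem C v × Small)
    first? v = Q? v ×-dec (mem? C v ×-dec small?)
    rest? : ∀ v → Dec (P v × ¬ (mem C v × Small))
    rest? v = P? v ×-dec ¬? (mem? C v ×-dec small?)
    split : ∀ v → P v → (Q v × mem C v × Small) ⊎ (P v × ¬ (mem C v × Small))
    split v p with mem? C v ×-dec small?
    ... | yes ms = inj₁ (P⊆Q v p , ms)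
    ... | no ¬ms = inj₂ (p , ¬ms)
    first≤τ : card first? ≤ τ C
    first≤τ = bound small?
      where
      bound : Dec Small → card first? ≤ τ C
      bound (yes s) = ≤-trans (card-mono first? (λ v → Q? v ×-dec mem? C v) (λ v (q , m , _) → q , m)) s
      bound (no ¬s) = ≤-trans (≤-reflexive (card-∅ first? (λ v (_ , _ , s) → ¬s s))) z≤n
    cov′ : ∀ v → P v × ¬ (mem C v × Small) → Any (λ C → mem C v × card (λ v → Q? v ×-dec mem? C v) ≤ τ C) Cs
    cov′ v (p , ¬ms) with cov v p
    ... | here ms   = contradiction ms ¬ms
    ... | there any = any

  -- The same count as above with the union of the classes big for x in place of the common neighbours;
  -- at an even gap the walk from x to z i is copied to one from x′ and then closed up by big-ends-far.
  module Classified (Cs : List Class) (covers : ∀ v → Any (λ C → mem C v) Cs) (few : c * totalτ Cs ≤ n)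
                    {x x′ : Fin n}
                    (lift : ∀ i {v} → i ≤ ℓ → Walk E i x v →
                            ∃ λ v′ → Walk E i x′ v′ × (∀ {C} → C ∈ Cs → Big C v → Big C v′))
    where

    private
      transfer : ∀ {C} → C ∈ Cs → Big C x → Big C x′
      transfer C∈ big with lift 0 z≤n []
      ... | _ , [] , f = f C∈ big

      A₀ : Fin n → Set
      A₀ v = ∃ λ i → Big (List.lookup Cs i) x × mem (List.lookup Cs i) v

      A₀? : ∀ v → Dec (A₀ v)
      A₀? v = any? (λ i → big? (List.lookup Cs i) x ×-dec mem? (List.lookup Cs i) v)

      A₀-intro : ∀ {C v} → C ∈ Cs → Big C x → mem C v → A₀ v
      A₀-intro {v = v} C∈ big m = Any.index C∈ , subst (λ C → Big C x × mem C v) (Anyₚ.lookup-index C∈) (big , m)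

      -- Neighbours of `x` outside `A₀` lie in classes where `x` has at most `τ` neighbours, and the
      -- thresholds add up to at most `n / c`.
      A₀-size : ∀ {y} → E x y → c * d ≤ c * card A₀? + n
      A₀-size xy = begin
        c * d                              ≤⟨ *-monoʳ-≤ c (degree≥d xy) ⟩
        c * card (E? x)                    ≤⟨ *-monoʳ-≤ c (card-∪ A₀? missed? (E? x) split) ⟩
        c * (card A₀? + card missed?)      ≤⟨ *-monoʳ-≤ c (+-monoʳ-≤ (card A₀?) missed≤) ⟩
        c * (card A₀? + totalτ Cs)         ≡⟨ *-distribˡ-+ c (card A₀?) _ ⟩
        c * card A₀? + c * totalτ Cs       ≤⟨ +-monoʳ-≤ _ few ⟩
        c * card A₀? + n                   ∎
        where
        open ≤-Reasoning
        missed? : ∀ v → Dec (E x v × ¬ A₀ v)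
        missed? v = E? x v ×-dec ¬? (A₀? v)
        split : ∀ v → E x v → A₀ v ⊎ (E x v × ¬ A₀ v)
        split v xv with A₀? v
        ... | yes a = inj₁ a
        ... | no ¬a = inj₂ (xv , ¬a)
        missed≤ : card missed? ≤ totalτ Cs
        missed≤ = small-cover Cs missed? (E? x) (λ _ → proj₁) λ v (xv , ¬a) →
          let C , C∈ , m = find (covers v) in lose C∈ (m , ≮⇒≥ (λ big → ¬a (A₀-intro C∈ big m)))

      c*card≤n : ∀ {P Q : Fin n → Set} (P? : ∀ v → Dec (P v)) (Q? : ∀ v → Dec (Q v)) → (∀ v → P v → Q v) →
                 (∀ v → P v → ∃ λ C → C ∈ Cs × mem C v × card (λ v → Q? v ×-dec mem? C v) ≤ τ C) → c * card P? ≤ n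
      c*card≤n P? Q? P⊆Q cov =
        ≤-trans (*-monoʳ-≤ c (small-cover Cs P? Q? P⊆Q (λ v p → let _ , C∈ , m = cov v p in lose C∈ m))) few

    -- `A₀` is nonempty, so some class is big for `x`. It is then big for `x′` too, and
    -- `big-ends-far` applies.
    no-short-walk : ∀ {r} → Walk E r x x′ → odd r ≡ true → ¬ 2 + r ≤ ℓ
    no-short-walk w@(xy ∷ _) r-odd 2+r≤ℓ
      with card>0⇒∃ A₀? (n≢0⇒n>0 (λ eq → <⇒≱ n<c*d
             (≤-trans (A₀-size xy) (≤-reflexive (cong (_+ n) (trans (cong (c *_) eq) (*-zeroʳ c)))))))
    ... | _ , i , big , _ = big-ends-far (List.lookup Cs i) w r-odd big (transfer (∈-lookup i) big) 2+r≤ℓ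

    module _ {r : ℕ} (1+r≡ℓ : suc r ≡ ℓ) (w : Walk E (suc r) x x′) where

      private
        r-odd : odd (suc r) ≡ true
        r-odd = trans (cong odd 1+r≡ℓ) ℓ-odd

        z : ℕ → Fin n
        z = at w

        -- `A₀` stands in for the neighbourhood of `x`, and the end of the walk is omitted; this
        -- leaves `ℓ` sets.
        A : Fin (suc r) → Fin n → Set
        A zero    v = A₀ v
        A (suc i) v = E (z (suc (toℕ i))) v

        A? : ∀ a v → Dec (A a v)
        A? zero    = A₀?
        A? (suc i) = E? (z (suc (toℕ i)))

        -- `z i` cuts the walk into two pieces, one of odd length, to which `big-ends-far` is
        -- applied. For the second piece the class is first carried from `x` to `x′`.
        Big-prefix : ∀ {C} i → 0 < i → i < suc r → C ∈ Cs → Big C x → ¬ Big C (z i)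
        Big-prefix {C} i 0<i i<r C∈ big big′ with odd i in eq | ∃-summand (<⇒≤ i<r)
        ... | true | _ = big-ends-far C (at-prefix w i (<⇒≤ i<r)) eq big big′ (≤-trans (odd-gap eq r-odd i<r) (≤-reflexive 1+r≡ℓ))
        ... | false | g , i+g≡r = big-ends-far C (at-suffix w i g i+g≡r) (odd-complement i g eq (trans (cong odd i+g≡r) r-odd))
              big′ (transfer C∈ big) (≤-trans (2+g≤ i 0<i eq) (≤-reflexive (trans i+g≡r 1+r≡ℓ)))
          where
          2+g≤ : ∀ i → 0 < i → odd i ≡ false → 2 + g ≤ i + g
          2+g≤ (suc (suc i)) _ _ = s≤s (s≤s (m≤n+m g i))

        meet-bound : ∀ i d g → 0 < i → 0 < d → i + d + g ≡ suc r →
                     c * card (λ v → E? (z i) v ×-dec E? (z (i + d)) v) ≤ n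
        meet-bound i d g 0<i 0<d eq with odd d in d-parity
        ... | true = c*0≤n _ (λ v (zv , z′v) → no-odd
              (snoc (snoc (at-segment w i d (≤-trans (m≤m+n (i + d) g) (≤-reflexive eq))) z′v) (E-sym zv))
              (cong (not ∘ not) d-parity)
              (≤-trans (odd-gap d-parity r-odd (≤-trans (m<n+m d 0<i) (≤-trans (m≤m+n (i + d) g) (≤-reflexive eq)))) (≤-reflexive 1+r≡ℓ)))
        ... | false = c*card≤n M? M? (λ _ m → m) λ v m → let C , C∈ , Cv = find (covers v) in C , C∈ , Cv , ≮⇒≥ (far C∈)
          where
          M? : ∀ v → Dec (E (z i) v × E (z (i + d)) v)
          M? v = E? (z i) v ×-dec E? (z (i + d)) v
          i≤r : i ≤ suc r
          i≤r = ≤-trans (m≤m+n i d) (≤-trans (m≤m+n (i + d) g) (≤-reflexive eq))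
          2≤d : ∀ d → 0 < d → odd d ≡ false → 2 ≤ d
          2≤d (suc (suc d)) _ _ = s≤s (s≤s z≤n)
          far : ∀ {C} → C ∈ Cs → ¬ τ C < card (λ v → M? v ×-dec mem? C v)
          far {C} C∈ big with lift i (≤-trans i≤r (≤-reflexive 1+r≡ℓ)) (at-prefix w i i≤r)
          ... | z′ , xz′ , same = big-ends-far C (reverse E-sym xz′ ⊕ reverse E-sym (at-suffix w (i + d) g eq))
                (odd-drop-even i d g d-parity (trans (cong odd eq) r-odd))
                (same C∈ (≤-trans big (card-mono _ (nbrs? (z i) (mem? C)) (λ v ((e , _) , m) → e , m))))
                (≤-trans big (card-mono _ (nbrs? (z (i + d)) (mem? C)) (λ v ((_ , e) , m) → e , m)))
                (begin
                  2 + (i + g)   ≡⟨ lemma i g ⟩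
                  i + 2 + g     ≤⟨ +-monoˡ-≤ g (+-monoʳ-≤ i (2≤d d 0<d d-parity)) ⟩
                  i + d + g     ≡⟨ eq ⟩
                  suc r         ≡⟨ 1+r≡ℓ ⟩
                  ℓ             ∎)
            where
            open ≤-Reasoning
            lemma : ∀ i g → 2 + (i + g) ≡ i + 2 + g
            lemma = solve-∀

        sizes : ∀ a → c * d ≤ c * card (A? a) + n
        sizes zero    = A₀-size (subst (λ v → E v (z 1)) (at-start w) (at-step w 0 (s≤s z≤n)))
        sizes (suc i) = ≤-trans (*-monoʳ-≤ c (degree≥d (at-step w (suc (toℕ i)) (s≤s (Finₚ.toℕ<n i))))) (m≤m+n _ n)

        meets : ∀ a b → a Fin.< b → c * card (λ v → A? a v ×-dec A? b v) ≤ n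
        meets zero    (suc j) _ = c*card≤n _ (E? (z (suc (toℕ j)))) (λ _ → proj₂) λ v ((i , big , m) , _) →
          List.lookup Cs i , ∈-lookup i , m , ≮⇒≥ (Big-prefix (suc (toℕ j)) (s≤s z≤n) (s≤s (Finₚ.toℕ<n j)) (∈-lookup i) big)
        meets (suc i) (suc j) (s≤s i<j) with ∃-summand (<⇒≤ i<j) | ∃-summand (Finₚ.toℕ<n j)
        ... | d′ , i+d≡j | g , j+g≡r =
          subst (λ k → c * card (λ v → E? (z (suc (toℕ i))) v ×-dec E? (z k) v) ≤ n) (cong suc i+d≡j)
            (meet-bound (suc (toℕ i)) d′ (suc g) (s≤s z≤n)
              (n≢0⇒n>0 (λ { refl → <-irrefl (trans (sym (+-identityʳ _)) i+d≡j) i<j }))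
              (trans (cong (λ k → suc k + suc g) i+d≡j) (trans (+-suc _ g) (cong suc j+g≡r))))

      no-long-walk : ⊥
      no-long-walk = ℓ-sets-meet 1+r≡ℓ A? sizes meets

    no-odd-walk : ∀ {r} → Walk E r x x′ → odd r ≡ true → ¬ r ≤ ℓ
    no-odd-walk w r-odd r≤ℓ with m≤n⇒m<n∨m≡n r≤ℓ
    ... | inj₁ r<ℓ = no-short-walk w r-odd (odd-gap r-odd ℓ-odd r<ℓ)
    no-odd-walk {suc r} w r-odd r≤ℓ | inj₂ eq = no-long-walk eq w

-- Colour refinement

bit : ∀ {A : Set} → Dec A → Fin 2
bit (yes _) = suc zero
bit (no _)  = zero

bit-transfer : ∀ {A B : Set} (A? : Dec A) (B? : Dec B) → bit A? ≡ bit B? → A → B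
bit-transfer A?      (yes b) _  _ = b
bit-transfer (no ¬a) (no _)  _  a = contradiction a ¬a
bit-transfer (yes _) (no _)  ()

funToFin-injective : ∀ {m n} {f g : Fin m → Fin n} → funToFin f ≡ funToFin g → ∀ i → f i ≡ g i
funToFin-injective {f = f} {g} eq i =
  trans (sym (Finₚ.finToFun-funToFin f i)) (trans (cong (λ k → finToFun k i) eq) (Finₚ.finToFun-funToFin g i))

refineSize : ℕ → ℕ → ℕ
refineSize K zero    = K
refineSize K (suc t) = refineSize K t * 2 ^ refineSize K t

module Refinement (G : Graph) {K : ℕ} (χ₀ : Fin (n G) → Fin K) where

  χ : ∀ t → Fin (n G) → Fin (refineSize K t)

  sees? : ∀ t x a → Dec (∃ λ z → Adj G x z × χ t z ≡ a)
  sees? t x a = any? (λ z → adj? G x z ×-dec χ t z Finₚ.≟ a)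

  χ zero    x = χ₀ x
  χ (suc t) x = combine (χ t x) (funToFin (λ a → bit (sees? t x a)))

  χ-pred : ∀ t {x y} → χ (suc t) x ≡ χ (suc t) y → χ t x ≡ χ t y
  χ-pred t {x} {y} eq = Finₚ.combine-injectiveˡ _ _ _ _ eq

  χ-≤ : ∀ {s t} → s ≤ t → ∀ {x y} → χ t x ≡ χ t y → χ s x ≡ χ s y
  χ-≤ {s} {t} s≤t eq with m≤n⇒m<n∨m≡n s≤t
  ... | inj₂ refl = eq
  χ-≤ {s} {suc t} _ eq | inj₁ (s≤s s≤t) = χ-≤ s≤t (χ-pred t eq)

  χ-base : ∀ t {x y} → χ t x ≡ χ t y → χ₀ x ≡ χ₀ y
  χ-base t = χ-≤ {t = t} z≤n

  χ-lift : ∀ t {x y z} → χ (suc t) x ≡ χ (suc t) y → Adj G x z → ∃ λ z′ → Adj G y z′ × χ t z′ ≡ χ t z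
  χ-lift t {x} {y} {z} eq xz =
    bit-transfer (sees? t x (χ t z)) (sees? t y (χ t z))
      (funToFin-injective (Finₚ.combine-injectiveʳ (χ t x) _ _ _ eq) (χ t z)) (z , xz , refl)

-- A walk in the quotient by a colouring is a sequence of edges x i — y (i + 1) with y (i + 1) and
-- x (i + 1) of equal colour. Closed odd quotient walks shall lift to closed walks of the graph
-- that agree with x, up to a rotation, on the vertices in S.

LiftingColouring : (G : Graph) → (Fin (n G) → Set) → ℕ → ℕ → Set
LiftingColouring G S ℓ K = Σ[ χ ∈ (Fin (n G) → Fin K) ]
  ∀ r → odd r ≡ true → r ≤ ℓ → (x y : ℕ → Fin (n G)) →
  (∀ i → Adj G (x i) (y (suc i))) → (∀ i → χ (y i) ≡ χ (x i)) → (∀ i → χ (x (i + r)) ≡ χ (x i)) →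
  ∃₂ λ a (z : ℕ → Fin (n G)) →
    (∀ i → i < r → Adj G (z i) (z (suc i))) × z r ≡ z 0 × (∀ i → i < r → S (z i) → z i ≡ x (a + i))

-- `s` private colours, and one for each possible set of big classes. Of the `ℓ + ℓ` refinements,
-- `ℓ` are spent on lifting a quotient walk and `ℓ` on copying walks between its ends.
colours : ℕ → ℕ → ℕ → ℕ
colours s ℓ c = refineSize (s + 2 ^ coverSize (suc (ℓ * c) * c) (ℓ * c)) (ℓ + ℓ)

module _ (G : Graph) {S : Fin (n G) → Set} (S? : ∀ v → Dec (S v)) where

  Outside : Fin (n G) → Fin (n G) → Set
  Outside x y = Adj G x y × ¬ S x × ¬ S y

  outside? : ∀ x y → Dec (Outside x y)
  outside? x y = adj? G x y ×-dec (¬? (S? x) ×-dec ¬? (S? y))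

  outside-sym : ∀ {x y} → Outside x y → Outside y x
  outside-sym (e , x∉ , y∉) = adj-sym G e , y∉ , x∉

  module _ {s : ℕ} (idx : ∀ v → S v → Fin s) (idx-inj : ∀ {u v} (p : S u) (q : S v) → idx u p ≡ idx v q → u ≡ v)
           (ℓ c d : ℕ) .{{_ : NonZero c}} (ℓ-odd : odd ℓ ≡ true)
           (degree≥d : ∀ {x y} → Outside x y → d ≤ card (outside? x))
           (no-odd : ∀ {m v} → Walk Outside m v v → odd m ≡ true → ¬ m ≤ ℓ)
           (dense : c * n G + (ℓ * ℓ * n G + ℓ * n G) < ℓ * (c * d))
    where

    open Dense outside? outside-sym ℓ c d ℓ-odd degree≥d no-odd dense

    private
      N = n G

      instance
        q≢0 : NonZero (suc (ℓ * c) * c)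
        q≢0 = m*n≢0 (suc (ℓ * c)) c

      whole? : ∀ (v : Fin N) → Dec ⊤
      whole? _ = yes tt

      -- The factor `suc (ℓ * c)` of the parameter cancels the one in the bound of `cover`, which
      -- leaves thresholds of total at most `N / c`.
      C : Cover whole? (suc (ℓ * c) * c) (suc (ℓ * c) * card whole?) (coverSize (suc (ℓ * c) * c) (ℓ * c))
      C = cover (suc (ℓ * c) * c) (ℓ * c) whole? (potential≤ whole?)

      Cs : List Class
      Cs = classes C

      few-exceptions : c * totalτ Cs ≤ N
      few-exceptions = *-cancelˡ-≤ (suc (ℓ * c)) (begin
        suc (ℓ * c) * (c * totalτ Cs)    ≡⟨ *-assoc (suc (ℓ * c)) c _ ⟨
        suc (ℓ * c) * c * totalτ Cs      ≤⟨ small C ⟩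
        suc (ℓ * c) * card whole?          ≤⟨ *-monoʳ-≤ (suc (ℓ * c)) (card≤n whole?) ⟩
        suc (ℓ * c) * N                  ∎)
        where open ≤-Reasoning

      bigClasses : Fin N → Fin (2 ^ length Cs)
      bigClasses v = funToFin (λ i → bit (big? (List.lookup Cs i) v))

      M = 2 ^ coverSize (suc (ℓ * c) * c) (ℓ * c)

      len≤ : 2 ^ length Cs ≤ M
      len≤ = ^-monoʳ-≤ 2 (few C)

      base : ∀ v → Dec (S v) → Fin (s + M)
      base v (yes v∈S) = idx v v∈S ↑ˡ M
      base v (no _)    = s ↑ʳ inject≤ (bigClasses v) len≤

      χ₀ : Fin N → Fin (s + M)
      χ₀ v = base v (S? v)

      left≢right : ∀ (i : Fin s) (j : Fin M) → ¬ i ↑ˡ M ≡ s ↑ʳ j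
      left≢right i j eq with trans (sym (Finₚ.splitAt-↑ˡ s i M)) (trans (cong (splitAt s) eq) (Finₚ.splitAt-↑ʳ s M j))
      ... | ()

      base-S : ∀ {x y} (x? : Dec (S x)) (y? : Dec (S y)) → base x x? ≡ base y y? → S x → x ≡ y
      base-S (yes p) (yes q) eq _ = idx-inj p q (Finₚ.↑ˡ-injective M _ _ eq)
      base-S (yes p) (no _)  eq _ = contradiction eq (left≢right _ _)
      base-S (no ¬p) _       eq p = contradiction p ¬p

      base-bigClasses : ∀ {x y} (x? : Dec (S x)) (y? : Dec (S y)) → base x x? ≡ base y y? → ¬ S x → bigClasses x ≡ bigClasses y
      base-bigClasses (yes p) _       eq ¬p = contradiction p ¬p
      base-bigClasses (no _)  (yes q) eq _  = contradiction (sym eq) (left≢right _ _)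
      base-bigClasses (no _)  (no _)  eq _  = Finₚ.inject≤-injective len≤ len≤ _ _ (Finₚ.↑ʳ-injective s _ _ eq)

      χ₀-S : ∀ {x y} → χ₀ x ≡ χ₀ y → S x → x ≡ y
      χ₀-S {x} {y} = base-S (S? x) (S? y)

      χ₀-Big : ∀ {x y} → χ₀ x ≡ χ₀ y → ¬ S x → ∀ {C} → C ∈ Cs → Big C x → Big C y
      χ₀-Big {x} {y} eq x∉S {C} C∈ big =
        subst (λ C → Big C y) (sym (Anyₚ.lookup-index C∈))
          (bit-transfer (big? (List.lookup Cs i) x) (big? (List.lookup Cs i) y)
            (funToFin-injective (base-bigClasses (S? x) (S? y) eq x∉S) i)
            (subst (λ C → Big C x) (Anyₚ.lookup-index C∈) big))
        where i = Any.index C∈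

      open Refinement G χ₀

      lift-walk : ∀ i t {x x′ v} → χ (i + t) x ≡ χ (i + t) x′ → Walk Outside i x v →
                  ∃ λ v′ → Walk Outside i x′ v′ × χ t v ≡ χ t v′
      lift-walk zero    t eq [] = _ , [] , eq
      lift-walk (suc i) t {x} {x′} eq ((xy , x∉ , y∉) ∷ w) with χ-lift (i + t) eq xy
      ... | y′ , x′y′ , eq′ with lift-walk i t (sym eq′) w
      ...   | v′ , w′ , eq″ = v′ , (x′y′ , (λ x′∈ → x∉ (subst S (χ₀-S (χ-base (suc (i + t)) (sym eq)) x′∈) x′∈)) ,
                                         (λ y′∈ → y∉ (subst S (χ₀-S (χ-base (i + t) eq′) y′∈) y′∈))) ∷ w′ , eq″

      -- Copying a walk of length `i` uses `i` refinements; the other `ℓ ∸ i` still determine the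
      -- base colour, hence the big classes of the endpoint.
      same-colour⇒far : ∀ {r x x′} → χ ℓ x ≡ χ ℓ x′ → ¬ S x → Walk Outside r x x′ → odd r ≡ true → ¬ r ≤ ℓ
      same-colour⇒far {x = x} {x′} eq x∉S = Classified.no-odd-walk Cs covers-all few-exceptions lift
        where
        covers-all : ∀ v → Any (λ C → mem C v) Cs
        covers-all v = covers C v tt
        -- Base colours record big classes only outside `S`.
        not-S : ∀ {i v} → Walk Outside i x v → ¬ S v
        not-S []                        = x∉S
        not-S ((_ , _ , y∉S) ∷ [])      = y∉S
        not-S (_ ∷ w@(_ ∷ _))           = ends w
          where
          ends : ∀ {i u v} → Walk Outside (suc i) u v → ¬ S v
          ends ((_ , _ , y∉S) ∷ []) = y∉S
          ends (_ ∷ w@(_ ∷ _))      = ends w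
        lift : ∀ i {v} → i ≤ ℓ → Walk Outside i x v →
               ∃ λ v′ → Walk Outside i x′ v′ × (∀ {C} → C ∈ Cs → Big C v → Big C v′)
        lift i {v} i≤ℓ w with lift-walk i (ℓ ∸ i) (subst (λ t → χ t x ≡ χ t x′) (sym (m+[n∸m]≡n i≤ℓ)) eq) w
        ... | v′ , w′ , eq′ = v′ , w′ , χ₀-Big (χ-base (ℓ ∸ i) eq′) (not-S w)

      module _ {x y : ℕ → Fin N} (edge : ∀ i → Adj G (x i) (y (suc i)))
               (same : ∀ i → χ (ℓ + ℓ) (y i) ≡ χ (ℓ + ℓ) (x i)) where

        -- Each edge from `x a` to `y (suc a)` is copied at the cost of one refinement; the jump
        -- from `y (suc a)` to `x (suc a)` costs nothing, by `same`.
        follow : ∀ m a t v → m + t ≤ ℓ + ℓ → χ (m + t) v ≡ χ (m + t) (x a) →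
                 ∃ λ (z : ℕ → Fin N) → z 0 ≡ v × (∀ i → i < m → Adj G (z i) (z (suc i))) ×
                                        (∀ i → i ≤ m → χ t (z i) ≡ χ t (x (a + i)))
        follow zero    a t v le eq = (λ _ → v) , refl , (λ _ ()) ,
          λ { zero _ → subst (λ j → χ t v ≡ χ t (x j)) (sym (+-identityʳ a)) eq }
        follow (suc m) a t v le eq with χ-lift (m + t) (sym eq) (edge a)
        ... | v′ , vv′ , eq′ with follow m (suc a) t v′ (≤-trans (n≤1+n _) le) (trans eq′ (χ-≤ (≤-trans (n≤1+n _) le) (same (suc a))))
        ...   | z , refl , steps , colour = z′ , refl , steps′ , colour′
          where
          z′ : ℕ → Fin N
          z′ zero    = v
          z′ (suc i) = z i
          steps′ : ∀ i → i < suc m → Adj G (z′ i) (z′ (suc i))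
          steps′ zero    _         = vv′
          steps′ (suc i) (s≤s i<m) = steps i i<m
          colour′ : ∀ i → i ≤ suc m → χ t (z′ i) ≡ χ t (x (a + i))
          colour′ zero    _         = subst (λ j → χ t v ≡ χ t (x j)) (sym (+-identityʳ a)) (χ-≤ (m≤n+m t (suc m)) eq)
          colour′ (suc i) (s≤s i≤m) = subst (λ j → χ t (z i) ≡ χ t (x j)) (sym (+-suc a i)) (colour i i≤m)

    lifting-colouring : LiftingColouring G S ℓ (colours s ℓ c)
    lifting-colouring = χ (ℓ + ℓ) , λ r r-odd r≤ℓ x y edge same period → main r r-odd r≤ℓ edge same period
      where
      main : ∀ r → odd r ≡ true → r ≤ ℓ → ∀ {x y : ℕ → Fin N} →
             (∀ i → Adj G (x i) (y (suc i))) → (∀ i → χ (ℓ + ℓ) (y i) ≡ χ (ℓ + ℓ) (x i)) →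
             (∀ i → χ (ℓ + ℓ) (x (i + r)) ≡ χ (ℓ + ℓ) (x i)) →
             ∃₂ λ a (z : ℕ → Fin N) →
               (∀ i → i < r → Adj G (z i) (z (suc i))) × z r ≡ z 0 × (∀ i → i < r → S (z i) → z i ≡ x (a + i))
      main r r-odd r≤ℓ {x} edge same period with any? (λ (i : Fin r) → S? (x (toℕ i)))
      -- The lift starts in a vertex of `S` and ends in one of the same colour; as colours in `S`
      -- are private, it closes up.
      ... | yes (i , xi∈S) with follow edge same r (toℕ i) ℓ (x (toℕ i)) (+-monoˡ-≤ ℓ r≤ℓ) refl
      ...   | z , z0 , steps , colour = toℕ i , z , steps ,
                trans (sym (χ₀-S (sym (trans (χ-base ℓ (colour r ≤-refl)) (χ-base (ℓ + ℓ) (period (toℕ i))))) xi∈S)) (sym z0) ,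
                λ j j<r zj∈S → χ₀-S (χ-base ℓ (colour j (<⇒≤ j<r))) zj∈S
      -- Now the lift avoids `S` and joins equally coloured vertices by a short odd walk, which is
      -- impossible.
      main r r-odd r≤ℓ {x} edge same period | no none with follow edge same r 0 ℓ (x 0) (+-monoˡ-≤ ℓ r≤ℓ) refl
      ... | z , z0 , steps , colour =
        contradiction r≤ℓ (same-colour⇒far ends (z∉S 0 z≤n) (segment z step′ 0 r ≤-refl) r-odd)
        where
        0<r : ∀ {r} → odd r ≡ true → 0 < r
        0<r {suc r} _ = s≤s z≤n
        x∉S : ∀ i → i < r → ¬ S (x i)
        x∉S i i<r xi∈S = none (Fin.fromℕ< i<r , subst (λ j → S (x j)) (sym (Finₚ.toℕ-fromℕ< i<r)) xi∈S)
        z∉S : ∀ i → i ≤ r → ¬ S (z i)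
        z∉S i i≤r zi∈S with m≤n⇒m<n∨m≡n i≤r | χ₀-S (χ-base ℓ (colour i i≤r)) zi∈S
        ... | inj₁ i<r  | eq = x∉S i i<r (subst S eq zi∈S)
        ... | inj₂ refl | eq = x∉S 0 (0<r r-odd) (subst S (χ₀-S (χ-base (ℓ + ℓ) (period 0)) (subst S eq zi∈S)) (subst S eq zi∈S))
        step′ : ∀ i → i < r → Outside (z i) (z (suc i))
        step′ i i<r = steps i i<r , z∉S i (<⇒≤ i<r) , z∉S (suc i) i<r
        ends : χ ℓ (z 0) ≡ χ ℓ (z r)
        ends = trans (colour 0 z≤n) (trans (χ-≤ (m≤n+m ℓ ℓ) (sym (period 0))) (sym (colour r ≤-refl)))

-- Cycles as closed sequences

module _ (G : Graph) where

  ClosedWalk : ℕ → (ℕ → Fin (n G)) → Set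
  ClosedWalk r z = (∀ i → i < r → Adj G (z i) (z (suc i))) × z r ≡ z 0

  Simple : ℕ → (ℕ → Fin (n G)) → Set
  Simple r z = ∀ i j → i < j → j < r → z i ≢ z j

  -- The cycle unrolled along ℕ, so that rotations and arcs past the starting point are mere index
  -- shifts.
  Periodic : ℕ → (ℕ → Fin (n G)) → Set
  Periodic r z = (∀ i → Adj G (z i) (z (suc i))) × (∀ i → z (i + r) ≡ z i) × (∀ i j → i < j → j < i + r → z i ≢ z j)

module _ {G : Graph} where

  closed⇒cycle : ∀ {r z} (h : 3 ≤ r) → ClosedWalk G r z → Simple G r z → Cycle r h ⊆ G
  closed⇒cycle {r} {z} h (step , close) simple = z ∘ toℕ , inj , λ { (inj₁ s) → edge s ; (inj₂ s) → adj-sym G (edge s) }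
    where
    inj : Injective _≡_ _≡_ (z ∘ toℕ)
    inj {i} {j} eq with <-cmp (toℕ i) (toℕ j)
    ... | tri< i<j _ _ = contradiction eq (simple _ _ i<j (Finₚ.toℕ<n j))
    ... | tri≈ _ i≡j _ = Finₚ.toℕ-injective i≡j
    ... | tri> _ _ j<i = contradiction (sym eq) (simple _ _ j<i (Finₚ.toℕ<n i))
    suc-∸1 : ∀ {r} → 3 ≤ r → suc (r ∸ 1) ≡ r
    suc-∸1 (s≤s _) = refl
    edge : ∀ {i j : Fin r} → (suc (toℕ i) ≡ toℕ j) ⊎ ((toℕ i ≡ r ∸ 1) × (toℕ j ≡ 0)) → Adj G (z (toℕ i)) (z (toℕ j))
    edge {i} {j} (inj₁ eq) = subst (λ k → Adj G (z (toℕ i)) (z k)) eq (step (toℕ i) (Finₚ.toℕ<n i))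
    edge {i} {j} (inj₂ (i≡ , j≡)) =
      subst (Adj G (z (toℕ i)))
            (trans (cong z (trans (cong suc i≡) (suc-∸1 h))) (trans close (cong z (sym j≡))))
            (step (toℕ i) (Finₚ.toℕ<n i))

  cycle⇒periodic : ∀ {r} {h : 3 ≤ r} → ((f , _) : Cycle r h ⊆ G) →
                   Σ[ z ∈ (ℕ → Fin (n G)) ] Periodic G r z × (∀ i → ∃ λ k → f i ≡ z k)
  cycle⇒periodic {r@(suc r-1)} {h} (f , inj , hom) =
    z , (edge , (λ i → cong f (mod-≡ {i + r} {i} ([m+n]%n≡m%n i r))) , λ i j i<j j< eq → distinct i j i<j j< (mod-≡⁻¹ {i} {j} (inj eq))) ,
    λ i → toℕ i , cong f (sym (mod-toℕ i))
    where
    md : ℕ → Fin r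
    md i = fromℕ< (m%n<n i r)
    z : ℕ → Fin (n G)
    z i = f (md i)
    mod-≡ : ∀ {i j} → i % r ≡ j % r → md i ≡ md j
    mod-≡ eq = Finₚ.toℕ-injective (trans (Finₚ.toℕ-fromℕ< _) (trans eq (sym (Finₚ.toℕ-fromℕ< _))))
    mod-≡⁻¹ : ∀ {i j} → md i ≡ md j → i % r ≡ j % r
    mod-≡⁻¹ eq = trans (sym (Finₚ.toℕ-fromℕ< _)) (trans (cong toℕ eq) (Finₚ.toℕ-fromℕ< _))
    mod-toℕ : ∀ i → md (toℕ i) ≡ i
    mod-toℕ i = Finₚ.toℕ-injective (trans (Finₚ.toℕ-fromℕ< _) (m<n⇒m%n≡m (Finₚ.toℕ<n i)))
    suc-% : ∀ i → suc i % r ≡ suc (i % r) % r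
    suc-% i = trans (cong (λ k → suc k % r) (m≡m%n+[m/n]*n i r)) ([m+kn]%n≡m%n (suc (i % r)) (i / r) r)
    edge : ∀ i → Adj G (z i) (z (suc i))
    edge i with m≤n⇒m<n∨m≡n (m%n<n i r)
    ... | inj₁ lt = hom (inj₁ (inj₁ (trans (cong suc (Finₚ.toℕ-fromℕ< _))
                      (sym (trans (Finₚ.toℕ-fromℕ< _) (trans (suc-% i) (m<n⇒m%n≡m lt)))))))
    ... | inj₂ eq = hom (inj₁ (inj₂ (trans (Finₚ.toℕ-fromℕ< _) (suc-injective eq) ,
                      trans (Finₚ.toℕ-fromℕ< _) (trans (suc-% i) (trans (cong (_% r) eq) (n%n≡0 r))))))
    distinct : ∀ i j → i < j → j < i + r → i % r ≢ j % r
    distinct i j i<j j<i+r eq with i / r <? j / r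
    ... | yes lt = <⇒≱ j<i+r (begin
        i + r                        ≡⟨ cong (_+ r) (m≡m%n+[m/n]*n i r) ⟩
        i % r + i / r * r + r        ≡⟨ lemma (i % r) (i / r) r ⟩
        i % r + suc (i / r) * r      ≤⟨ +-mono-≤ (≤-reflexive eq) (*-monoˡ-≤ r lt) ⟩
        j % r + j / r * r            ≡⟨ m≡m%n+[m/n]*n j r ⟨
        j                            ∎)
      where
      open ≤-Reasoning
      lemma : ∀ a b r → a + b * r + r ≡ a + (1 + b) * r
      lemma = solve-∀
    ... | no ¬lt = <⇒≱ i<j (begin
        j                            ≡⟨ m≡m%n+[m/n]*n j r ⟩
        j % r + j / r * r            ≤⟨ +-mono-≤ (≤-reflexive (sym eq)) (*-monoˡ-≤ r (≮⇒≥ ¬lt)) ⟩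
        i % r + i / r * r            ≡⟨ m≡m%n+[m/n]*n i r ⟨
        i                            ∎)
      where open ≤-Reasoning

  periodic⇒closed : ∀ {r z} → Periodic G r z → ClosedWalk G r z × Simple G r z
  periodic⇒closed {r} (step , period , inj) =
    ((λ i _ → step i) , period 0) , λ i j i<j j<r → inj i j i<j (≤-trans j<r (m≤n+m r i))

  odd-closed⇒3≤ : ∀ {r z} → ClosedWalk G r z → odd r ≡ true → 3 ≤ r
  odd-closed⇒3≤ {1} {z} (step , close) _ = contradiction (subst (Adj G (z 0)) close (step 0 (s≤s z≤n))) (irrefl G)
  odd-closed⇒3≤ {suc (suc (suc r))} _ _ = s≤s (s≤s (s≤s z≤n))

  Repeat : ℕ → (ℕ → Fin (n G)) → (Fin (n G) → Set) → Set
  Repeat m z P = ∃₂ λ i j → i < j × j < m × z i ≡ z j × P (z i)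

  OddCycleThrough : ℕ → Fin (n G) → Set
  OddCycleThrough m v = ∃₂ λ r z → odd r ≡ true × r < m × ClosedWalk G r z × Simple G r z × ∃ λ k → k < r × z k ≡ v

  repeat? : ∀ m (z : ℕ → Fin (n G)) → Dec (∃₂ λ i j → i < j × j < m × z i ≡ z j)
  repeat? m z = map′ (λ (j , i , eq) → toℕ i , toℕ j , Finₚ.toℕ<n i , Finₚ.toℕ<n j , eq)
                     (λ (i , j , i<j , j<m , eq) → let k = fromℕ< j<m ; k≡j = Finₚ.toℕ-fromℕ< j<m
                                                       i<k = ≤-trans i<j (≤-reflexive (sym k≡j)) in
                       k , fromℕ< i<k , trans (cong z (Finₚ.toℕ-fromℕ< i<k)) (trans eq (cong z (sym k≡j))))
                     (any? {m} (λ j → any? {toℕ j} (λ i → z (toℕ i) Finₚ.≟ z (toℕ j))))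

  -- Splitting an odd closed walk at a repeated vertex leaves a shorter odd closed walk through it.
  odd-closed-walk : ∀ m z → odd m ≡ true → ClosedWalk G m z → Simple G m z ⊎ Repeat m z (OddCycleThrough m)
  odd-closed-walk = <-rec _ λ m rec z m-odd walk → go m (λ k<m → rec k<m _) z m-odd walk
    where
    go : ∀ m → (∀ {k} → k < m → ∀ {z} → odd k ≡ true → ClosedWalk G k z → Simple G k z ⊎ Repeat k z (OddCycleThrough k)) →
         ∀ z → odd m ≡ true → ClosedWalk G m z → Simple G m z ⊎ Repeat m z (OddCycleThrough m)
    go m rec z m-odd (step , close) with repeat? m z
    ... | no none = inj₁ (λ i j i<j j<m eq → none (i , j , i<j , j<m , eq))
    ... | yes (i , j , i<j , j<m , zi≡zj) with ∃-summand (<⇒≤ i<j)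
    ...   | e , refl with ∃-summand (<⇒≤ j<m) | odd e in e-parity
    ...     | g , refl | true = inj₂ inner
      where
      e<m : e < i + e + g
      e<m = ≤-<-trans (m≤n+m e i) j<m
      inner : Repeat (i + e + g) z (OddCycleThrough (i + e + g))
      inner with rec e<m {λ k → z (i + k)} e-parity
                   ((λ k k<e → subst (λ l → Adj G (z (i + k)) (z l)) (sym (+-suc i k)) (step (i + k) (<-trans (+-monoʳ-< i k<e) j<m)))
                   , trans (sym zi≡zj) (cong z (sym (+-identityʳ i))))
      ... | inj₁ simple = i , i + e , i<j , j<m , zi≡zj ,
            (e , (λ k → z (i + k)) , e-parity , e<m ,
              ((λ k k<e → subst (λ l → Adj G (z (i + k)) (z l)) (sym (+-suc i k)) (step (i + k) (<-trans (+-monoʳ-< i k<e) j<m)))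
                   , trans (sym zi≡zj) (cong z (sym (+-identityʳ i)))) ,
              simple , 0 , m<n+m⇒0<n , cong z (+-identityʳ i))
        where
        m<n+m⇒0<n : 0 < e
        m<n+m⇒0<n = n≢0⇒n>0 (λ { refl → contradiction e-parity (λ ()) })
      ... | inj₂ (a , b , a<b , b<e , eq , r , z′ , r-odd , r<e , rest) =
            i + a , i + b , +-monoʳ-< i a<b , <-trans (+-monoʳ-< i b<e) j<m , eq , (r , z′ , r-odd , <-trans r<e e<m , rest)
    ...     | g , refl | false = inj₂ outer
      where
      -- The even piece from `i` to `i + e` is cut out, which keeps the parity. `pos` translates
      -- positions back and is strictly monotone, so repeats in the rest are repeats of `z`.
      pos : ℕ → ℕ
      pos k with k <? i
      ... | yes _ = k
      ... | no _  = k + e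
      pos-< : ∀ {k} → k < i → pos k ≡ k
      pos-< {k} k<i with k <? i
      ... | yes _ = refl
      ... | no ¬p = contradiction k<i ¬p
      pos-≥ : ∀ {k} → i ≤ k → pos k ≡ k + e
      pos-≥ {k} i≤k with k <? i
      ... | yes k<i = contradiction k<i (≤⇒≯ i≤k)
      ... | no _    = refl
      pos-mono : ∀ {k l} → k < l → pos k < pos l
      pos-mono {k} {l} k<l with k <? i | l <? i
      ... | yes _ | yes _ = k<l
      ... | yes _ | no _  = ≤-trans k<l (m≤m+n l e)
      ... | no ¬p | yes q = contradiction (<-trans k<l q) ¬p
      ... | no _  | no _  = +-monoˡ-< e k<l
      swap : ∀ i e g → i + e + g ≡ i + g + e
      swap = solve-∀
      0<e : 0 < e
      0<e = n≢0⇒n>0 (λ { refl → <-irrefl (sym (+-identityʳ i)) i<j })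
      0<g : 0 < g
      0<g = n≢0⇒n>0 (λ { refl → <-irrefl (sym (+-identityʳ (i + e))) j<m })
      short : i + g < i + e + g
      short = ≤-trans (m<m+n (i + g) 0<e) (≤-reflexive (sym (swap i e g)))
      pos-bound : ∀ {k} → k < i + g → pos k < i + e + g
      pos-bound k< = ≤-trans (pos-mono k<) (≤-reflexive (trans (pos-≥ (m≤m+n i g)) (sym (swap i e g))))
      o-odd : odd (i + g) ≡ true
      o-odd = odd-drop-even i e g e-parity m-odd
      step′ : ∀ k → k < i + g → Adj G (z (pos k)) (z (pos (suc k)))
      step′ k k< with <-cmp (suc k) i
      ... | tri< lt _ _ = subst₂ (λ a b → Adj G (z a) (z b)) (sym (pos-< (<⇒≤ lt))) (sym (pos-< lt)) (step k (<-trans k< short))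
      ... | tri≈ _ refl _ = subst₂ (Adj G) (cong z (sym (pos-< ≤-refl))) (trans zi≡zj (cong z (sym (pos-≥ ≤-refl)))) (step k (<-trans k< short))
      ... | tri> _ _ (s≤s i≤k) = subst₂ (λ a b → Adj G (z a) (z b)) (sym (pos-≥ i≤k)) (sym (pos-≥ (m≤n⇒m≤1+n i≤k)))
                         (step (k + e) (≤-trans (+-monoˡ-< e k<) (≤-reflexive (sym (swap i e g)))))
      z-start : z (pos 0) ≡ z 0
      z-start with 0 <? i
      ... | yes _ = refl
      ... | no ¬p with n≤0⇒n≡0 (≮⇒≥ ¬p)
      ...   | refl = sym zi≡zj
      walk′ : ClosedWalk G (i + g) (z ∘ pos)
      walk′ = step′ , trans (cong z (trans (pos-≥ (m≤m+n i g)) (sym (swap i e g)))) (trans close (sym z-start))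
      outer : Repeat (i + e + g) z (OddCycleThrough (i + e + g))
      outer with rec short {z ∘ pos} o-odd walk′
      ... | inj₁ simple = i , i + e , i<j , j<m , zi≡zj ,
            (i + g , z ∘ pos , o-odd , short , walk′ , simple , i , m<m+n i 0<g , trans (cong z (pos-≥ ≤-refl)) (sym zi≡zj))
      ... | inj₂ (a , b , a<b , b< , eq , r , z′ , r-odd , r< , rest) =
            pos a , pos b , pos-mono a<b , pos-bound b< , eq , (r , z′ , r-odd , <-trans r< short , rest)

-- A universal cycle-free target

-- Decoding `funToFin f` returns `f` only pointwise; hence the condition that `P` respects pointwise
-- equality.
any-function? : ∀ {m n} {P : (Fin m → Fin n) → Set} → (∀ {f g} → (∀ i → f i ≡ g i) → P f → P g) →
                (∀ f → Dec (P f)) → Dec (∃ P)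
any-function? {P = P} respects P? = map′ (λ (k , p) → finToFun k , p)
  (λ (f , p) → funToFin f , respects (λ i → sym (Finₚ.finToFun-funToFin f i)) p) (any? (λ k → P? (finToFun k)))

module _ (F G : Graph) where

  Embedding : (Fin (n F) → Fin (n G)) → Set
  Embedding f = Injective _≡_ _≡_ f × (∀ {i j} → Adj F i j → Adj G (f i) (f j))

  embedding-respects : ∀ {f g} → (∀ i → f i ≡ g i) → Embedding f → Embedding g
  embedding-respects {f} {g} f≗g (inj , hom) =
    (λ {i} {j} eq → inj (trans (f≗g i) (trans eq (sym (f≗g j))))) ,
    (λ {i} {j} e → subst₂ (Adj G) (f≗g i) (f≗g j) (hom e))

  embedding? : ∀ f → Dec (Embedding f)
  embedding? f =
    map′ (λ h {i} {j} → h i j) (λ h i j → h {i} {j}) (all? (λ i → all? (λ j → (f i Finₚ.≟ f j) →-dec (i Finₚ.≟ j)))) ×-dec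
    map′ (λ h {i} {j} → h i j) (λ h i j → h {i} {j}) (all? (λ i → all? (λ j → adj? F i j →-dec adj? G (f i) (f j))))

_⊆?_ : ∀ F G → Dec (F ⊆ G)
F ⊆? G = any-function? (embedding-respects F G) (embedding? F G)

CycleFree : (ℕ → Set) → Graph → Set
CycleFree L G = ∀ r (h : 3 ≤ r) → L r → ¬ (Cycle r h ⊆ G)

module _ {L : ℕ → Set} (L? : ∀ r → Dec (L r)) {ℓ : ℕ} (L-bound : ∀ {r} → L r → r ≤ ℓ) where

  cycleFree? : ∀ G → Dec (CycleFree L G)
  cycleFree? G = map′
    (λ free r h Lr → subst Free′ (Finₚ.toℕ-fromℕ< (s≤s (L-bound Lr))) (free (fromℕ< (s≤s (L-bound Lr)))) h Lr)
    (λ free r h Lr → free (toℕ r) h Lr)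
    (all? {suc ℓ} (λ r → free? (toℕ r)))
    where
    Free′ : ℕ → Set
    Free′ r = (h : 3 ≤ r) → L r → ¬ (Cycle r h ⊆ G)
    free? : ∀ r → Dec (Free′ r)
    free? r with 3 ≤? r | L? r
    ... | no ¬h | _      = yes (λ h _ _ → ¬h h)
    ... | yes _ | no ¬Lr = yes (λ _ Lr _ → ¬Lr Lr)
    ... | yes h | yes Lr with Cycle r h ⊆? G
    ...   | yes c = no (λ free → free h Lr c)
    ...   | no ¬c = yes (λ _ _ → ¬c)

  module Universal (K : ℕ) where

    Code : ℕ
    Code = 2 ^ (K * K)

    Entry : Fin Code → Fin K → Fin K → Set
    Entry m a b = finToFun m (combine a b) ≡ suc zero

    entry? : ∀ m a b → Dec (Entry m a b)
    entry? m a b = finToFun m (combine a b) Finₚ.≟ suc zero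

    -- Requiring both entries and distinct indices makes a simple graph out of every 0/1 matrix.
    matrixGraph : Fin Code → Graph
    matrixGraph m = record
      { n = K
      ; Adj = λ a b → a ≢ b × Entry m a b × Entry m b a
      ; adj? = λ a b → ¬? (a Finₚ.≟ b) ×-dec (entry? m a b ×-dec entry? m b a)
      ; adj-sym = λ (a≢b , ab , ba) → (λ b≡a → a≢b (sym b≡a)) , ba , ab
      ; irrefl = λ (a≢a , _) → a≢a refl
      }

    part : Fin (Code * K) → Fin Code
    part v = proj₁ (remQuot K v)

    inside : Fin (Code * K) → Fin K
    inside v = proj₂ (remQuot {Code} K v)

    -- The union ranges over all codes: a part that contains a forbidden cycle is not dropped but
    -- loses all its edges.
    target : Graph
    target = record
      { n = Code * K
      ; Adj = λ u v → part u ≡ part v × CycleFree L (matrixGraph (part u)) × Adj (matrixGraph (part u)) (inside u) (inside v)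
      ; adj? = λ u v → (part u Finₚ.≟ part v) ×-dec
          (cycleFree? (matrixGraph (part u)) ×-dec adj? (matrixGraph (part u)) (inside u) (inside v))
      ; adj-sym = λ {u} {v} (eq , free , uv) → sym eq ,
          subst (λ m → CycleFree L (matrixGraph m) × Adj (matrixGraph m) (inside v) (inside u)) eq
                (free , adj-sym (matrixGraph (part u)) uv)
      ; irrefl = λ {v} (_ , _ , vv) → irrefl (matrixGraph (part v)) vv
      }

    target-free : CycleFree L target
    target-free r h Lr C⊆target with cycle⇒periodic {target} {h = h} C⊆target
    ... | z , per@(edge , period , inj) , _ with periodic⇒closed {target} per
    ...   | (step , close) , simple =
      proj₁ (proj₂ (edge 0)) r h Lr (closed⇒cycle {matrixGraph m} h
        ((λ i _ → subst (λ m → Adj (matrixGraph m) (inside (z i)) (inside (z (suc i)))) (same i) (proj₂ (proj₂ (edge i)))) ,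
         cong inside close)
        (λ i j i<j j<r eq → simple i j i<j j<r (remQuot-injective (z i) (z j) (cong₂ _,_ (trans (same i) (sym (same j))) eq))))
      where
      m = part (z 0)
      same : ∀ i → part (z i) ≡ m
      same zero    = refl
      same (suc i) = trans (sym (proj₁ (edge i))) (same i)
      remQuot-injective : ∀ u v → remQuot {Code} K u ≡ remQuot K v → u ≡ v
      remQuot-injective u v eq =
        trans (sym (Finₚ.combine-remQuot {Code} K u))
              (trans (cong (λ (a , b) → combine a b) eq) (Finₚ.combine-remQuot {Code} K v))

    module _ (G : Graph) (χ : Fin (n G) → Fin K) (proper : ∀ {x y} → Adj G x y → χ x ≢ χ y) where

      quotientGraph : Graph
      quotientGraph = record
        { n = K
        ; Adj = λ a b → ∃₂ λ x y → χ x ≡ a × χ y ≡ b × Adj G x y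
        ; adj? = λ a b → any? (λ x → any? (λ y → (χ x Finₚ.≟ a) ×-dec ((χ y Finₚ.≟ b) ×-dec adj? G x y)))
        ; adj-sym = λ (x , y , xa , yb , xy) → y , x , yb , xa , adj-sym G xy
        ; irrefl = λ (x , y , xa , ya , xy) → proper xy (trans xa (sym ya))
        }

      code : Fin Code
      code = funToFin (λ ab → bit (adj? quotientGraph (proj₁ (remQuot K ab)) (proj₂ (remQuot {K} K ab))))

      entry-code : ∀ a b → finToFun code (combine a b) ≡ bit (adj? quotientGraph a b)
      entry-code a b = trans (Finₚ.finToFun-funToFin {K * K} {2} _ (combine a b))
        (cong (λ (a , b) → bit (adj? quotientGraph a b)) (Finₚ.remQuot-combine a b))

      bit⇒ : ∀ {A : Set} (A? : Dec A) → bit A? ≡ suc zero → A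
      bit⇒ (yes a) _ = a
      bit⇒ (no _) ()

      ⇒bit : ∀ {A : Set} (A? : Dec A) → A → bit A? ≡ suc zero
      ⇒bit (yes _) _ = refl
      ⇒bit (no ¬a) a = contradiction a ¬a

      quotient-hom : CycleFree L quotientGraph → G ⟶ target
      quotient-hom free = f , hom
        where
        code-free : CycleFree L (matrixGraph code)
        code-free r h Lr (g , inj , g-hom) = free r h Lr (g , inj , λ e →
          bit⇒ (adj? quotientGraph _ _) (trans (sym (entry-code _ _)) (proj₁ (proj₂ (g-hom e)))))
        f : Fin (n G) → Fin (Code * K)
        f x = combine code (χ x)
        f-part : ∀ x → part (f x) ≡ code
        f-part x = cong proj₁ (Finₚ.remQuot-combine code (χ x))
        f-inside : ∀ x → inside (f x) ≡ χ x
        f-inside x = cong proj₂ (Finₚ.remQuot-combine code (χ x))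
        Edge : Fin Code → Fin K → Fin K → Set
        Edge m a b = CycleFree L (matrixGraph m) × Adj (matrixGraph m) a b
        hom : ∀ {x y} → Adj G x y → Adj target (f x) (f y)
        hom {x} {y} xy = trans (f-part x) (sym (f-part y)) ,
          subst (λ m → Edge m (inside (f x)) (inside (f y))) (sym (f-part x))
            (subst₂ (Edge code) (sym (f-inside x)) (sym (f-inside y))
              (code-free , proper xy ,
               trans (entry-code _ _) (⇒bit (adj? quotientGraph _ _) (x , y , refl , refl , xy)) ,
               trans (entry-code _ _) (⇒bit (adj? quotientGraph _ _) (y , x , refl , refl , adj-sym G xy))))

  module _ (1≤ℓ : 1 ≤ ℓ) (L-odd : ∀ {r} → L r → odd r ≡ true) {G : Graph} {S : Fin (n G) → Set}
           (repeats : ∀ {r z} → L r → ClosedWalk G r z → ∃₂ λ i j → i < j × j < r × z i ≡ z j × S (z i)) where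

    open Universal

    -- A monochromatic edge is a closed quotient walk of length 1 and would lift to a loop. A
    -- forbidden cycle would lift to a closed walk repeating a vertex of `S`; there the lift agrees
    -- with the representatives `x`, so the cycle itself would repeat a vertex.
    lifting⇒hom : ∀ {K} → LiftingColouring G S ℓ K → G ⟶ target K
    lifting⇒hom {K} (χ , lift) = quotient-hom K G χ proper free
      where
      proper : ∀ {x y} → Adj G x y → χ x ≢ χ y
      proper {x} {y} xy eq with lift 1 refl 1≤ℓ (λ _ → x) (λ _ → y) (λ _ → xy) (λ _ → sym eq) (λ _ → refl)
      ... | _ , z , step , close , _ = irrefl G (subst (Adj G (z 0)) close (step 0 (s≤s z≤n)))
      free : CycleFree L (quotientGraph K G χ proper)
      free r h Lr C⊆Q with cycle⇒periodic {quotientGraph K G χ proper} {h = h} C⊆Q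
      ... | T , (edge , period , inj) , _ = conclude (lift r (L-odd Lr) (L-bound Lr) x y
              (λ i → proj₂ (proj₂ (proj₂ (proj₂ (edge i))))) χy (λ i → trans (χx (i + r)) (trans (period i) (sym (χx i)))))
        where
        x y : ℕ → Fin (n G)
        x i = proj₁ (edge i)
        y zero    = x 0
        y (suc i) = proj₁ (proj₂ (edge i))
        χx : ∀ i → χ (x i) ≡ T i
        χx i = proj₁ (proj₂ (proj₂ (edge i)))
        χy : ∀ i → χ (y i) ≡ χ (x i)
        χy zero    = refl
        χy (suc i) = trans (proj₁ (proj₂ (proj₂ (proj₂ (edge i))))) (sym (χx (suc i)))
        conclude : ¬ (∃₂ λ a (z : ℕ → Fin (n G)) →
          (∀ i → i < r → Adj G (z i) (z (suc i))) × z r ≡ z 0 × (∀ i → i < r → S (z i) → z i ≡ x (a + i)))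
        conclude (a , z , step , close , agree) with repeats Lr (step , close)
        ... | i , j , i<j , j<r , zi≡zj , zi∈S = inj (a + i) (a + j) (+-monoʳ-< a i<j)
              (≤-trans (+-monoʳ-< a (≤-trans j<r (m≤n+m r i))) (≤-reflexive (sym (+-assoc a i r))))
              (trans (sym (χx (a + i))) (trans (cong χ (trans (sym (agree i (<-trans i<j j<r) zi∈S))
                (trans zi≡zj (agree j j<r (subst S zi≡zj zi∈S))))) (χx (a + j))))

-- For graphs too small for the counting: the quotient is the graph itself.
identity-colouring : ∀ G S ℓ → LiftingColouring G S ℓ (n G)
identity-colouring G S ℓ = id , λ r _ _ x y edge same period →
  0 , x , (λ i _ → subst (Adj G (x i)) (same (suc i)) (edge i)) , period 0 , λ _ _ _ → refl

colouring-mono : ∀ {G S ℓ K K′} → K ≤ K′ → LiftingColouring G S ℓ K → LiftingColouring G S ℓ K′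
colouring-mono le (χ , lift) = (λ v → inject≤ (χ v) le) , λ r r-odd r≤ℓ x y edge same period →
  lift r r-odd r≤ℓ x y edge (λ i → Finₚ.inject≤-injective le le _ _ (same i)) (λ i → Finₚ.inject≤-injective le le _ _ (period i))

card>0 : ∀ {n} {P : Fin n → Set} (P? : ∀ i → Dec (P i)) {i} → P i → 1 ≤ card P?
card>0 {n} P? {i} p = n≢0⇒n>0 (λ eq → <-irrefl (sym eq) (≤-trans (≤-reflexive (sym (𝟙-yes (P? i) p)))
  (≤-trans (m≤n+m _ (sum {n} (λ _ → 0))) (sum-mono-gap {f = λ _ → 0} {g = λ i → 𝟙 (P? i)} (λ _ → z≤n) i ≤-refl))))

card-unique : ∀ {n} {P : Fin n → Set} (P? : ∀ i → Dec (P i)) → (∀ {i j} → P i → P j → i ≡ j) → card P? ≤ 1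
card-unique {zero}  P? unique = z≤n
card-unique {suc n} P? unique with P? zero
... | yes p = ≤-reflexive (cong suc (card-∅ (P? ∘ suc) (λ i q → contradiction (unique p q) (λ ()))))
... | no _  = card-unique (P? ∘ suc) (λ p q → Finₚ.suc-injective (unique p q))

card-injection : ∀ {m n} {P : Fin n → Set} (P? : ∀ i → Dec (P i)) (f : Fin m → Fin n) →
                 (∀ {a b} → f a ≡ f b → a ≡ b) → (∀ a → P (f a)) → m ≤ card P?
card-injection {m} {n} P? f inj f∈P = begin
  m                                            ≡⟨ trans (sum-const m 1) (*-identityʳ m) ⟨
  sum {m} (λ _ → 1)                            ≤⟨ sum-mono {f = λ _ → 1} {g = λ a → card (λ x → f a Finₚ.≟ x)} (λ a → card>0 (λ x → f a Finₚ.≟ x) refl) ⟩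
  sum (λ a → card (λ x → f a Finₚ.≟ x))        ≡⟨ ∑-comm (λ a x → 𝟙 (f a Finₚ.≟ x)) ⟩
  sum (λ x → card (λ a → f a Finₚ.≟ x))        ≤⟨ sum-mono pointwise ⟩
  card P?                                      ∎
  where
  open ≤-Reasoning
  pointwise : ∀ x → card (λ a → f a Finₚ.≟ x) ≤ 𝟙 (P? x)
  pointwise x with P? x
  ... | yes _ = card-unique (λ a → f a Finₚ.≟ x) (λ eq eq′ → inj (trans eq (sym eq′)))
  ... | no ¬p = ≤-reflexive (card-∅ (λ a → f a Finₚ.≟ x) (λ a eq → ¬p (subst _ eq (f∈P a))))

-- Generalised Andrásfai graphs

OddUpTo : ℕ → ℕ → Set
OddUpTo ℓ r = odd r ≡ true × r ≤ ℓ

no-odd-closed-walk : ∀ {G ℓ} → CycleFree (OddUpTo ℓ) G → ∀ {m z} → odd m ≡ true → ClosedWalk G m z → ¬ m ≤ ℓ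
no-odd-closed-walk {G} free {m} {z} m-odd walk m≤ℓ with odd-closed-walk {G} m z m-odd walk
... | inj₁ simple = free m (odd-closed⇒3≤ {G} walk m-odd) (m-odd , m≤ℓ) (closed⇒cycle {G} (odd-closed⇒3≤ {G} walk m-odd) walk simple)
... | inj₂ (_ , _ , _ , _ , _ , r , z′ , r-odd , r<m , walk′ , simple , _) =
  free r (odd-closed⇒3≤ {G} walk′ r-odd) (r-odd , ≤-trans (<⇒≤ r<m) m≤ℓ) (closed⇒cycle {G} (odd-closed⇒3≤ {G} walk′ r-odd) walk′ simple)

-- Adjacent vertices are at cyclic distance within t / 2 of the antipode; the order is (1 + 2κ) t + 2.
module Andrasfai (κ t : ℕ) where

  ℓ s p : ℕ
  ℓ = 1 + (κ + κ)
  s = 1 + κ * t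
  p = s + s + t

  ℓ-odd : odd ℓ ≡ true
  ℓ-odd = cong not (trans (odd-+ κ κ) (lemma (odd κ)))
    where
    lemma : ∀ b → b xor b ≡ false
    lemma true  = refl
    lemma false = refl

  p≡ : p ≡ ℓ * t + 2
  p≡ = lemma κ t
    where
    lemma : ∀ κ t → 1 + κ * t + (1 + κ * t) + t ≡ (1 + (κ + κ)) * t + 2
    lemma = solve-∀

  -- A circulant graph: as `p` is `s + (s + t)`, replacing a difference D by `p` - D preserves the
  -- interval from `s` to `s + t`, so differences of representatives suffice.
  graph : Graph
  graph = record
    { n = p
    ; Adj = λ i j → s ≤ ∣ toℕ i - toℕ j ∣ × ∣ toℕ i - toℕ j ∣ ≤ s + t
    ; adj? = λ i j → (s ≤? _) ×-dec (_ ≤? s + t)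
    ; adj-sym = λ {i} {j} → subst (λ D → s ≤ D × D ≤ s + t) (∣-∣-comm (toℕ i) (toℕ j))
    ; irrefl = λ {i} (s≤ , _) → <⇒≱ (s≤s z≤n) (≤-trans s≤ (≤-reflexive (∣n-n∣≡0 (toℕ i))))
    }

  private
    instance
      p≢0 : NonZero p
      p≢0 = _

    vertex : ℕ → Fin p
    vertex a = fromℕ< (m%n<n a p)

    toℕ-vertex : ∀ a → toℕ (vertex a) ≡ a % p
    toℕ-vertex a = Finₚ.toℕ-fromℕ< (m%n<n a p)

    Near : ℕ → ℕ → Set
    Near a b = s ≤ ∣ a - b ∣ × ∣ a - b ∣ ≤ s + t

  %-+-congˡ : ∀ a b c → a % p ≡ b % p → (a + c) % p ≡ (b + c) % p
  %-+-congˡ a b c eq = trans (%-distribˡ-+ a c p) (trans (cong (λ x → (x + c % p) % p) eq) (sym (%-distribˡ-+ b c p)))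

  distance : ∀ b D → b < p → s ≤ D → D ≤ s + t → Near b ((b + D) % p)
  distance b D b<p s≤D D≤ with b + D <? p
  ... | yes lt = subst (Near b) (sym (m<n⇒m%n≡m lt)) (subst (λ D → s ≤ D × D ≤ s + t) (sym (∣m-m+n∣≡n b D)) (s≤D , D≤))
  ... | no ¬lt with ∃-summand (≮⇒≥ ¬lt) | ∃-summand D≤
  ...   | e , p+e≡b+D | g , D+g≡s+t = subst (Near b) (sym (trans (cong (_% p) (trans (sym p+e≡b+D) (+-comm p e))) (trans ([m+n]%n≡m%n e p) (m<n⇒m%n≡m e<p))))
          (subst (λ b → Near b e) (sym b≡) (subst (λ D → s ≤ D × D ≤ s + t) (sym (trans (∣-∣-comm (e + (s + g)) e) (∣m-m+n∣≡n e (s + g))))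
            (m≤m+n s g , +-monoʳ-≤ s g≤t)))
    where
    open ≤-Reasoning
    p≡D+ : p ≡ D + (s + g)
    p≡D+ = begin-equality
      s + s + t      ≡⟨ lemma s t ⟩
      s + t + s      ≡⟨ cong (_+ s) D+g≡s+t ⟨
      D + g + s      ≡⟨ lemma′ D g s ⟩
      D + (s + g)    ∎
      where
      lemma : ∀ s t → s + s + t ≡ s + t + s
      lemma = solve-∀
      lemma′ : ∀ D g s → D + g + s ≡ D + (s + g)
      lemma′ = solve-∀
    b≡ : b ≡ e + (s + g)
    b≡ = +-cancelˡ-≡ D b (e + (s + g)) (begin-equality
      D + b              ≡⟨ +-comm D b ⟩
      b + D              ≡⟨ p+e≡b+D ⟨
      p + e              ≡⟨ cong (_+ e) p≡D+ ⟩
      D + (s + g) + e    ≡⟨ lemma D (s + g) e ⟩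
      D + (e + (s + g))  ∎)
      where
      lemma : ∀ D a e → D + a + e ≡ D + (e + a)
      lemma = solve-∀
    e<p : e < p
    e<p = ≤-<-trans (≤-trans (m≤m+n e (s + g)) (≤-reflexive (sym b≡))) b<p
    g≤t : g ≤ t
    g≤t = +-cancelˡ-≤ s g t (≤-trans (+-monoˡ-≤ g s≤D) (≤-reflexive D+g≡s+t))

  vertex-edge : ∀ a D → s ≤ D → D ≤ s + t → Adj graph (vertex a) (vertex (a + D))
  vertex-edge a D s≤D D≤ = subst₂ Near (sym (toℕ-vertex a))
    (sym (trans (toℕ-vertex (a + D)) (%-+-congˡ a (a % p) D (sym (m%n%n≡m%n a p)))))
    (distance (a % p) D (m%n<n a p) s≤D D≤)

  t≤degree : ∀ v → t ≤ degree graph v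
  t≤degree v = ≤-trans
    (card-injection (adj? graph v) nbr inj (λ a → subst (λ u → Adj graph u (nbr a)) (vertex-toℕ v)
      (vertex-edge (toℕ v) (s + toℕ a) (m≤m+n s _) (+-monoʳ-≤ s (<⇒≤ (Finₚ.toℕ<n a))))))
    (≤-reflexive (sym (degree≡card graph v)))
    where
    vertex-toℕ : ∀ v → vertex (toℕ v) ≡ v
    vertex-toℕ v = Finₚ.toℕ-injective (trans (toℕ-vertex (toℕ v)) (m<n⇒m%n≡m (Finₚ.toℕ<n v)))
    nbr : Fin t → Fin p
    nbr a = vertex (toℕ v + (s + toℕ a))
    t≤p : t ≤ p
    t≤p = m≤n+m t (s + s)
    shift : ∀ x y → x ≤ p → (x + y + (p ∸ x)) % p ≡ y % p
    shift x y x≤p = trans (cong (_% p) (trans (lemma x y (p ∸ x)) (cong (y +_) (m+[n∸m]≡n x≤p)))) ([m+n]%n≡m%n y p)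
      where
      lemma : ∀ x y c → x + y + c ≡ y + (x + c)
      lemma = solve-∀
    reduce : ∀ a → a < t → (toℕ v + (s + a) + (p ∸ toℕ v) + (p ∸ s)) % p ≡ a
    reduce a a<t = trans (%-+-congˡ (toℕ v + (s + a) + (p ∸ toℕ v)) (s + a) (p ∸ s) (shift (toℕ v) (s + a) (<⇒≤ (Finₚ.toℕ<n v))))
                         (trans (shift s a (≤-trans (m≤m+n s s) (m≤m+n (s + s) t))) (m<n⇒m%n≡m (≤-trans a<t t≤p)))
    inj : ∀ {a b} → nbr a ≡ nbr b → a ≡ b
    inj {a} {b} eq = Finₚ.toℕ-injective (trans (sym (reduce (toℕ a) (Finₚ.toℕ<n a)))
      (trans (%-+-congˡ (x a + (p ∸ toℕ v)) (x b + (p ∸ toℕ v)) (p ∸ s) (%-+-congˡ (x a) (x b) (p ∸ toℕ v) eq′)) (reduce (toℕ b) (Finₚ.toℕ<n b))))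
      where
      x : Fin t → ℕ
      x a = toℕ v + (s + toℕ a)
      eq′ : x a % p ≡ x b % p
      eq′ = trans (sym (toℕ-vertex (x a))) (trans (cong toℕ eq) (toℕ-vertex (x b)))

  -- Each step changes twice the position by p ± t, so a closed walk of odd length r ≤ ℓ would give p ≤ r t.
  no-odd-closed : ∀ {r z} → odd r ≡ true → ClosedWalk graph r z → ¬ r ≤ ℓ
  no-odd-closed {r} {z} r-odd (step , close) r≤ℓ with balance r ≤-refl
    where
    -- `u` and `d` count the steps up and down; twice the displacement differs from `(u - d) * p` by
    -- at most `i * t`. At the end `u + d` is odd, so `u` and `d` differ, while `r * t < p`.
    Balanced : ℕ → Set
    Balanced i = ∃₂ λ u d → u + d ≡ i ×
      2 * toℕ (z i) + d * p ≤ 2 * toℕ (z 0) + u * p + i * t × 2 * toℕ (z 0) + u * p ≤ 2 * toℕ (z i) + d * p + i * t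
    2D≤ : ∀ {D} → D ≤ s + t → 2 * D ≤ p + t
    2D≤ D≤ = ≤-trans (*-monoʳ-≤ 2 D≤) (≤-reflexive (lemma s t))
      where
      lemma : ∀ s t → 2 * (s + t) ≡ s + s + t + t
      lemma = solve-∀
    ≤2D : ∀ {D} → s ≤ D → p ≤ 2 * D + t
    ≤2D s≤ = ≤-trans (≤-reflexive (lemma s t)) (+-monoˡ-≤ t (*-monoʳ-≤ 2 s≤))
      where
      lemma : ∀ s t → s + s + t ≡ 2 * s + t
      lemma = solve-∀
    gain : ∀ {a b D P X} → 2 * a + X ≤ b → 2 * D ≤ P → 2 * (a + D) + X ≤ b + P
    gain {a} {b} {D} {P} {X} le le′ = ≤-trans (≤-reflexive (lemma a D X)) (+-mono-≤ le le′)
      where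
      lemma : ∀ a D X → 2 * (a + D) + X ≡ 2 * a + X + 2 * D
      lemma = solve-∀
    balance : ∀ i → i ≤ r → Balanced i
    balance zero    _   = 0 , 0 , refl , ≤-reflexive (sym (+-identityʳ _)) , ≤-reflexive (sym (+-identityʳ _))
    balance (suc i) i<r with balance i (<⇒≤ i<r) | ≤-total (toℕ (z i)) (toℕ (z (suc i))) | step i i<r
    ... | u , d , eq , up , down | inj₁ le | s≤ , ≤s+t with ∃-summand le
    ...   | D , a+D≡b = suc u , d , cong suc eq ,
        subst (λ b → 2 * b + d * p ≤ 2 * toℕ (z 0) + suc u * p + suc i * t) a+D≡b (≤-trans (gain {toℕ (z i)} {D = D} up (2D≤ (≤-trans (≤-reflexive (sym D≡)) ≤s+t)))
          (≤-reflexive (lemma₁ (2 * toℕ (z 0)) (u * p) (i * t) p t))) ,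
        subst (λ b → 2 * toℕ (z 0) + suc u * p ≤ 2 * b + d * p + suc i * t) a+D≡b (≤-trans (≤-reflexive (lemma₂ (2 * toℕ (z 0)) (u * p) p))
          (≤-trans (+-mono-≤ down (≤2D (≤-trans s≤ (≤-reflexive D≡)))) (≤-reflexive (lemma₃ (toℕ (z i)) (d * p) (i * t) D t))))
      where
      D≡ : ∣ toℕ (z i) - toℕ (z (suc i)) ∣ ≡ D
      D≡ = trans (cong (∣ toℕ (z i) -_∣) (sym a+D≡b)) (∣m-m+n∣≡n (toℕ (z i)) D)
      lemma₁ : ∀ a b c p t → a + b + c + (p + t) ≡ a + (p + b) + (t + c)
      lemma₁ = solve-∀
      lemma₂ : ∀ a b p → a + (p + b) ≡ a + b + p
      lemma₂ = solve-∀
      lemma₃ : ∀ a b c D t → 2 * a + b + c + (2 * D + t) ≡ 2 * (a + D) + b + (t + c)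
      lemma₃ = solve-∀
    balance (suc i) i<r | u , d , eq , up , down | inj₂ ge | s≤ , ≤s+t with ∃-summand ge
    ...   | D , b+D≡a = u , suc d , trans (+-suc u d) (cong suc eq) ,
        +-cancelʳ-≤ (2 * D) _ _ (begin
          2 * toℕ (z (suc i)) + (p + d * p) + 2 * D      ≡⟨ lemma₁ (toℕ (z (suc i))) p (d * p) D ⟩
          2 * (toℕ (z (suc i)) + D) + d * p + p          ≡⟨ cong (λ a → 2 * a + d * p + p) b+D≡a ⟩
          2 * toℕ (z i) + d * p + p                      ≤⟨ +-mono-≤ up (≤2D (≤-trans s≤ (≤-reflexive D≡))) ⟩
          2 * toℕ (z 0) + u * p + i * t + (2 * D + t)    ≡⟨ lemma₂ (2 * toℕ (z 0) + u * p) (i * t) (2 * D) t ⟩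
          2 * toℕ (z 0) + u * p + (t + i * t) + 2 * D    ∎) ,
        (begin
          2 * toℕ (z 0) + u * p                          ≤⟨ down ⟩
          2 * toℕ (z i) + d * p + i * t                  ≡⟨ cong (λ a → 2 * a + d * p + i * t) b+D≡a ⟨
          2 * (toℕ (z (suc i)) + D) + d * p + i * t      ≡⟨ lemma₃ (toℕ (z (suc i))) D (d * p) (i * t) ⟩
          2 * toℕ (z (suc i)) + d * p + i * t + 2 * D    ≤⟨ +-monoʳ-≤ _ (2D≤ (≤-trans (≤-reflexive (sym D≡)) ≤s+t)) ⟩
          2 * toℕ (z (suc i)) + d * p + i * t + (p + t)  ≡⟨ lemma₄ (2 * toℕ (z (suc i))) (d * p) (i * t) p t ⟩
          2 * toℕ (z (suc i)) + (p + d * p) + (t + i * t) ∎)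
      where
      open ≤-Reasoning
      D≡ : ∣ toℕ (z i) - toℕ (z (suc i)) ∣ ≡ D
      D≡ = trans (∣-∣-comm (toℕ (z i)) _) (trans (cong (∣ toℕ (z (suc i)) -_∣) (sym b+D≡a)) (∣m-m+n∣≡n (toℕ (z (suc i))) D))
      lemma₁ : ∀ b p x D → 2 * b + (p + x) + 2 * D ≡ 2 * (b + D) + x + p
      lemma₁ = solve-∀
      lemma₂ : ∀ a b D t → a + b + (D + t) ≡ a + (t + b) + D
      lemma₂ = solve-∀
      lemma₃ : ∀ b D x y → 2 * (b + D) + x + y ≡ 2 * b + x + y + 2 * D
      lemma₃ = solve-∀
      lemma₄ : ∀ a b c p t → a + b + c + (p + t) ≡ a + (p + b) + (t + c)
      lemma₄ = solve-∀
  ... | u , d , eq , up , down = conclude (<-cmp u d)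
    where
    open ≤-Reasoning
    r*t<p : r * t < p
    r*t<p = begin-strict
      r * t         ≤⟨ *-monoˡ-≤ t r≤ℓ ⟩
      ℓ * t         <⟨ m<m+n (ℓ * t) (s≤s z≤n) ⟩
      ℓ * t + 2     ≡⟨ p≡ ⟨
      p             ∎
    impossible : ∀ a {u d} → u < d → ¬ a + d * p ≤ a + u * p + r * t
    impossible a {u} {d} u<d le = <⇒≱ r*t<p (+-cancelˡ-≤ (u * p) p (r * t) (begin
      u * p + p        ≡⟨ +-comm (u * p) p ⟩
      suc u * p        ≤⟨ *-monoˡ-≤ p u<d ⟩
      d * p            ≤⟨ +-cancelˡ-≤ a _ _ (≤-trans le (≤-reflexive (+-assoc a (u * p) (r * t)))) ⟩
      u * p + r * t    ∎))
    conclude : _ → ⊥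
    conclude (tri< u<d _ _) = impossible (2 * toℕ (z 0)) u<d (subst (λ v → 2 * toℕ v + d * p ≤ 2 * toℕ (z 0) + u * p + r * t) close up)
    conclude (tri> _ _ d<u) = impossible (2 * toℕ (z 0)) d<u (subst (λ v → 2 * toℕ (z 0) + u * p ≤ 2 * toℕ v + d * p + r * t) close down)
    conclude (tri≈ _ refl _) = contradiction (trans (sym r-odd) (trans (cong odd (sym eq)) (odd-+ u u))) (λ e → xor-self (odd u) (sym e))
      where
      xor-self : ∀ b → b xor b ≢ true
      xor-self true  ()
      xor-self false ()

  -- ℓ s = κ p + 1, so ℓ steps of lengths in [ s , s + t ] realise every nonzero displacement modulo p.
  joined : ∀ {i j} → i Fin.< j → ∃ λ z → (∀ m → Adj graph (z m) (z (suc m))) × z 0 ≡ i × z ℓ ≡ j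
  joined {i} {j} i<j with ∃-summand i<j
  ... | δ , 1+i+δ≡j = (λ m → vertex (pos m)) , edge , start , end
    where
    -- `ℓ` steps of length `s` move by 1 modulo `p`; the remaining displacement `δ` is spent
    -- greedily, at most `t` per step.
    pos : ℕ → ℕ
    pos m = toℕ i + (m * s + δ ⊓ (m * t))
    increment : ∀ m → ∃ λ e → e ≤ t × δ ⊓ (m * t) + e ≡ δ ⊓ (t + m * t)
    increment m with ≤-total δ (m * t)
    ... | inj₁ le = 0 , z≤n , trans (+-identityʳ _) (trans (m≤n⇒m⊓n≡m le) (sym (m≤n⇒m⊓n≡m (≤-trans le (m≤n+m _ t)))))
    ... | inj₂ ge with ∃-summand ge | ≤-total δ (t + m * t)
    ...   | e , mt+e≡δ | inj₁ le = e , +-cancelˡ-≤ (m * t) e t (≤-trans (≤-reflexive mt+e≡δ) (≤-trans le (≤-reflexive (+-comm t _)))) ,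
              trans (cong (_+ e) (m≥n⇒m⊓n≡n ge)) (trans mt+e≡δ (sym (m≤n⇒m⊓n≡m le)))
    ...   | _ | inj₂ ge′ = t , ≤-refl , trans (cong (_+ t) (m≥n⇒m⊓n≡n ge)) (trans (+-comm (m * t) t) (sym (m≥n⇒m⊓n≡n ge′)))
    edge : ∀ m → Adj graph (vertex (pos m)) (vertex (pos (suc m)))
    edge m with increment m
    ... | e , e≤t , eq = subst (λ a → Adj graph (vertex (pos m)) (vertex a))
          (trans (lemma (toℕ i) (m * s) (δ ⊓ (m * t)) s e) (cong (λ x → toℕ i + (s + m * s + x)) eq))
          (vertex-edge (pos m) (s + e) (m≤m+n s e) (+-monoʳ-≤ s e≤t))
      where
      lemma : ∀ i a b s e → i + (a + b) + (s + e) ≡ i + (s + a + (b + e))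
      lemma = solve-∀
    start : vertex (pos 0) ≡ i
    start = Finₚ.toℕ-injective (trans (toℕ-vertex (pos 0)) (trans (cong (_% p) (trans (cong (toℕ i +_) (m≥n⇒m⊓n≡n {δ} z≤n)) (+-identityʳ _)))
                                (m<n⇒m%n≡m (Finₚ.toℕ<n i))))
    δ≤ : δ ≤ ℓ * t
    δ≤ = +-cancelʳ-≤ 2 δ (ℓ * t) (≤-trans (≤-reflexive (+-comm δ 2)) (≤-trans (s≤s (≤-trans (s≤s (m≤n+m δ (toℕ i))) (≤-reflexive 1+i+δ≡j)))
            (≤-trans (Finₚ.toℕ<n j) (≤-reflexive p≡))))
    end : vertex (pos ℓ) ≡ j
    end = Finₚ.toℕ-injective (trans (toℕ-vertex (pos ℓ)) (trans (cong (_% p) pos≡) (trans ([m+kn]%n≡m%n (toℕ j) κ p) (m<n⇒m%n≡m (Finₚ.toℕ<n j)))))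
      where
      open ≡-Reasoning
      lemma : ∀ i δ κ t → i + ((1 + (κ + κ)) * (1 + κ * t) + δ) ≡ 1 + i + δ + κ * (1 + κ * t + (1 + κ * t) + t)
      lemma = solve-∀
      pos≡ : pos ℓ ≡ toℕ j + κ * p
      pos≡ = begin
        toℕ i + (ℓ * s + δ ⊓ (ℓ * t))     ≡⟨ cong (λ x → toℕ i + (ℓ * s + x)) (m≤n⇒m⊓n≡m δ≤) ⟩
        toℕ i + (ℓ * s + δ)               ≡⟨ lemma (toℕ i) δ κ t ⟩
        suc (toℕ i + δ) + κ * p           ≡⟨ cong (_+ κ * p) 1+i+δ≡j ⟩
        toℕ j + κ * p                     ∎

  no-small-image : ∀ {H} → graph ⟶ H → n H < p → ¬ CycleFree (OddUpTo ℓ) H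
  no-small-image {H} (f , hom) small free =
    let i , j , i<j , fi≡fj = Finₚ.pigeonhole small f
        z , edge , z0 , zℓ = joined i<j
    in no-odd-closed-walk {H} free {z = f ∘ z} ℓ-odd
         ((λ m _ → hom (edge m)) , trans (cong f zℓ) (trans (sym fi≡fj) (cong f (sym z0)))) ≤-refl

-- Paths of prescribed length

_∈ᶠ?_ : ∀ {n} (v : Fin n) xs → Dec (v ∈ xs)
v ∈ᶠ? xs = Any.any? (v Finₚ.≟_) xs

card-∈ : ∀ {n} (xs : List (Fin n)) → card (_∈ᶠ? xs) ≤ length xs
card-∈ {n} []   = ≤-reflexive (card-∅ {n} (_∈ᶠ? []) (λ _ ()))
card-∈ (x ∷ xs) = ≤-trans
  (card-∪ (Finₚ._≟ x) (_∈ᶠ? xs) (_∈ᶠ? (x ∷ xs)) (λ { _ (here eq) → inj₁ eq ; _ (there v∈) → inj₂ v∈ }))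
  (+-mono-≤ (card-unique (Finₚ._≟ x) (λ eq eq′ → trans eq (sym eq′))) (card-∈ xs))

pick : ∀ {n} {W : Fin n → Set} (W? : ∀ v → Dec (W v)) xs → length xs < card W? → ∃ λ v → W v × v ∉ xs
pick W? xs lt = card>0⇒∃ (λ v → W? v ×-dec ¬? (v ∈ᶠ? xs)) (+-cancelʳ-< (length xs) _ _
  (≤-trans lt (≤-trans (card-∪ (λ v → W? v ×-dec ¬? (v ∈ᶠ? xs)) (_∈ᶠ? xs) W? split) (+-monoʳ-≤ _ (card-∈ xs)))))
  where
  split : ∀ v → _ → _
  split v w with v ∈ᶠ? xs
  ... | yes v∈ = inj₂ v∈
  ... | no v∉  = inj₁ (w , v∉)

module _ (G : Graph) where

  data Path : Fin (n G) → Fin (n G) → List (Fin (n G)) → Set where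
    [_] : ∀ v → Path v v (v ∷ [])
    _∷_ : ∀ {u v w xs} → Adj G u w → Path w v xs → Path u v (u ∷ xs)

module Paths (G : Graph) where

  join : ∀ {u v x y xs ys} → Path G u v xs → Adj G v x → Path G x y ys → Path G u y (xs ++ ys)
  join [ _ ]   vx q = vx ∷ q
  join (e ∷ p) vx q = e ∷ join p vx q

  -- The default is the value at index `length xs`; taking the first vertex as default closes the
  -- sequence.
  nth : List (Fin (n G)) → Fin (n G) → ℕ → Fin (n G)
  nth []       d _       = d
  nth (x ∷ xs) d zero    = x
  nth (x ∷ xs) d (suc i) = nth xs d i

  nth-start : ∀ {u v d xs} → Path G u v xs → nth xs d 0 ≡ u
  nth-start [ _ ]   = refl
  nth-start (_ ∷ _) = refl

  nth-end : ∀ {d} xs → nth xs d (length xs) ≡ d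
  nth-end []       = refl
  nth-end (x ∷ xs) = nth-end xs

  nth-step : ∀ {u v d xs} → Path G u v xs → Adj G v d → ∀ i → i < length xs → Adj G (nth xs d i) (nth xs d (suc i))
  nth-step [ _ ]   vd zero    _         = vd
  nth-step [ _ ]   vd (suc i) (s≤s ())
  nth-step (e ∷ p) vd zero    _         = subst (Adj G _) (sym (nth-start p)) e
  nth-step (e ∷ p) vd (suc i) (s≤s i<l) = nth-step p vd i i<l

  nth-∈ : ∀ {d} xs i → i < length xs → nth xs d i ∈ xs
  nth-∈ (x ∷ xs) zero    _         = here refl
  nth-∈ (x ∷ xs) (suc i) (s≤s i<l) = there (nth-∈ xs i i<l)

  nth-distinct : ∀ {d xs} → Unique xs → ∀ i j → i < j → j < length xs → nth xs d i ≢ nth xs d j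
  nth-distinct {d} {x ∷ xs} (x∉ ∷ u) zero    (suc j) _         (s≤s j<l) eq =
    All¬⇒¬Any x∉ (subst (_∈ xs) (sym eq) (nth-∈ xs j j<l))
  nth-distinct {d} {x ∷ xs} (x∉ ∷ u) (suc i) (suc j) (s≤s i<j) (s≤s j<l) = nth-distinct u i j i<j j<l

  close-path : ∀ {u v xs ℓ} (h : 3 ≤ ℓ) → Path G u v xs → Adj G v u → Unique xs → length xs ≡ ℓ → Cycle ℓ h ⊆ G
  close-path {u} {xs = xs} h p vu uniq refl =
    closed⇒cycle {G} {z = nth xs u} h (nth-step p vu , trans (nth-end xs) (sym (nth-start p))) (nth-distinct uniq)

  arc : ∀ {y : ℕ → Fin (n G)} → (∀ k → Adj G (y k) (y (suc k))) → ∀ d → Path G (y 0) (y d) (applyUpTo y (suc d))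
  arc {y} edge zero    = [ y 0 ]
  arc {y} edge (suc d) = edge 0 ∷ arc (edge ∘ suc) d

  rotate : ∀ {r z} a → Periodic G r z → Periodic G r (λ k → z (a + k))
  rotate {r} {z} a (edge , period , inj) =
    (λ k → subst (λ l → Adj G (z (a + k)) (z l)) (sym (+-suc a k)) (edge (a + k))) ,
    (λ k → trans (cong z (sym (+-assoc a k r))) (period (a + k))) ,
    λ i j i<j j< → inj (a + i) (a + j) (+-monoʳ-< a i<j) (≤-trans (+-monoʳ-< a j<) (≤-reflexive (sym (+-assoc a i r))))

  arc-unique : ∀ {r z} → Periodic G r z → ∀ {d} → d ≤ r → Unique (applyUpTo z d)
  arc-unique {r} {z} (_ , _ , inj) {d} d≤r =
    Uniqueₚ.applyUpTo⁺₁ z d (λ {i} {j} i<j j<d → inj i j i<j (≤-trans j<d (≤-trans d≤r (m≤n+m r i))))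

∉-applyUpTo : ∀ {A : Set} {v : A} (z : ℕ → A) {d} → (∀ k → k < d → v ≢ z k) → v ∉ applyUpTo z d
∉-applyUpTo z v≢ v∈ with ∈-applyUpTo⁻ z v∈
... | k , k<d , eq = v≢ k k<d eq

infixr 5 _∷ᵘ_

_∷ᵘ_ : ∀ {A : Set} {v : A} {xs} → v ∉ xs → Unique xs → Unique (v ∷ xs)
v∉ ∷ᵘ u = ¬Any⇒All¬ _ v∉ ∷ u

odd⇒1+2* : ∀ g → odd g ≡ true → ∃ λ s → g ≡ 1 + s * 2
odd⇒1+2* 1 _ = 0 , refl
odd⇒1+2* (suc (suc g)) g-odd with odd⇒1+2* g (trans (sym (not-not (odd g))) g-odd)
  where
  not-not : ∀ b → not (not b) ≡ b
  not-not true  = refl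
  not-not false = refl
... | s , refl = suc s , refl

module Linked (G : Graph) (ℓ : ℕ) (ℓ-odd : odd ℓ ≡ true) (5≤ℓ : 5 ≤ ℓ)
              (free : ∀ h → ¬ (Cycle ℓ h ⊆ G))
              (degrees : ∀ v → n G ≤ ℓ * card (adj? G v))
              (large : 2 * ℓ * ℓ < n G)
  where

  private
    N = n G
    V = Fin N

  open Paths G

  -- Each of at most `ℓ` rounds of `zigzag` keeps at least one in `2 * ℓ` of the candidates; the
  -- last factor leaves enough of them to avoid the vertices already used.
  R : ℕ
  R = (2 * ℓ) ^ ℓ * ℓ

  common? : ∀ u v w → Dec (Adj G u w × Adj G v w)
  common? u v w = adj? G u w ×-dec adj? G v w

  Unlinked : V → V → Set
  Unlinked u v = card (common? u v) < R

  private
    -- By double counting the edges between W and V.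
    popular : ∀ {W : V → Set} (W? : ∀ v → Dec (W v)) F → length F ≤ ℓ → 0 < card W? →
              ∃ λ x → x ∉ F × card W? ≤ 2 * ℓ * card (λ w → W? w ×-dec adj? G w x)
    popular {W} W? F F≤ℓ 0<W with any? (λ x → ¬? (x ∈ᶠ? F) ×-dec (card W? ≤? 2 * ℓ * card (λ w → W? w ×-dec adj? G w x)))
    ... | yes found = found
    ... | no none = contradiction large (≤⇒≯ (*-cancelʳ-≤ N (2 * ℓ * ℓ) (card W?) ⦃ >-nonZero 0<W ⦄ bound))
      where
      open ≤-Reasoning
      deg : V → ℕ
      deg x = card (λ w → W? w ×-dec adj? G w x)
      pointwise : ∀ x → 2 * ℓ * deg x ≤ card W? + 2 * ℓ * card W? * 𝟙 (x ∈ᶠ? F)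
      pointwise x with x ∈ᶠ? F
      ... | yes _ = ≤-trans (*-monoʳ-≤ (2 * ℓ) (card-mono (λ w → W? w ×-dec adj? G w x) W? (λ _ → proj₁)))
                            (≤-trans (≤-reflexive (sym (*-identityʳ _))) (m≤n+m _ (card W?)))
      ... | no x∉ = ≤-trans (<⇒≤ (≰⇒> (λ le → none (x , x∉ , le)))) (m≤m+n _ _)
      edges : sum deg ≡ sum (λ w → 𝟙 (W? w) * card (adj? G w))
      edges = trans (sum-cong-≗ (λ x → sum-cong-≗ (λ w → 𝟙-× (W? w) (adj? G w x))))
        (trans (∑-comm (λ x w → 𝟙 (W? w) * 𝟙 (adj? G w x))) (sum-cong-≗ (λ w → sym (*-distribˡ-sum (𝟙 (W? w)) (λ x → 𝟙 (adj? G w x))))))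
      below : 2 * (N * card W?) ≤ 2 * ℓ * sum deg
      below = begin
        2 * (N * card W?)                                     ≡⟨ cong (2 *_) (*-distribˡ-sum N (λ w → 𝟙 (W? w))) ⟩
        2 * sum (λ w → N * 𝟙 (W? w))
          ≤⟨ *-monoʳ-≤ 2 (sum-mono {f = λ w → N * 𝟙 (W? w)} {g = λ w → ℓ * (𝟙 (W? w) * card (adj? G w))}
               (λ w → ≤-trans (*-monoˡ-≤ (𝟙 (W? w)) (degrees w)) (≤-reflexive (lemma ℓ (card (adj? G w)) (𝟙 (W? w)))))) ⟩
        2 * sum (λ w → ℓ * (𝟙 (W? w) * card (adj? G w)))     ≡⟨ cong (2 *_) (*-distribˡ-sum ℓ (λ w → 𝟙 (W? w) * card (adj? G w))) ⟨
        2 * (ℓ * sum (λ w → 𝟙 (W? w) * card (adj? G w)))     ≡⟨ *-assoc 2 ℓ _ ⟨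
        2 * ℓ * sum (λ w → 𝟙 (W? w) * card (adj? G w))       ≡⟨ cong (2 * ℓ *_) edges ⟨
        2 * ℓ * sum deg                                       ∎
        where
        lemma : ∀ a b c → a * b * c ≡ a * (c * b)
        lemma = solve-∀
      above : 2 * ℓ * sum deg ≤ N * card W? + 2 * ℓ * card W? * ℓ
      above = begin
        2 * ℓ * sum deg                                       ≡⟨ *-distribˡ-sum (2 * ℓ) deg ⟩
        sum (λ x → 2 * ℓ * deg x)                             ≤⟨ sum-mono pointwise ⟩
        sum (λ x → card W? + 2 * ℓ * card W? * 𝟙 (x ∈ᶠ? F))
          ≡⟨ ∑-distrib-+ (λ _ → card W?) (λ x → 2 * ℓ * card W? * 𝟙 (x ∈ᶠ? F)) ⟩
        sum {N} (λ _ → card W?) + sum (λ x → 2 * ℓ * card W? * 𝟙 (x ∈ᶠ? F))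
          ≡⟨ cong₂ _+_ (sum-const N (card W?)) (sym (*-distribˡ-sum (2 * ℓ * card W?) (λ x → 𝟙 (x ∈ᶠ? F)))) ⟩
        N * card W? + 2 * ℓ * card W? * card (_∈ᶠ? F)         ≤⟨ +-monoʳ-≤ (N * card W?) (*-monoʳ-≤ (2 * ℓ * card W?) (≤-trans (card-∈ F) F≤ℓ)) ⟩
        N * card W? + 2 * ℓ * card W? * ℓ                     ∎
      bound : N * card W? ≤ 2 * ℓ * ℓ * card W?
      bound = +-cancelˡ-≤ (N * card W?) _ _ (begin
        N * card W? + N * card W?            ≡⟨ lemma (N * card W?) ⟩
        2 * (N * card W?)                    ≤⟨ ≤-trans below above ⟩
        N * card W? + 2 * ℓ * card W? * ℓ    ≡⟨ cong (N * card W? +_) (lemma′ (2 * ℓ) (card W?) ℓ) ⟩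
        N * card W? + 2 * ℓ * ℓ * card W?    ∎)
        where
        lemma : ∀ a → a + a ≡ 2 * a
        lemma = solve-∀
        lemma′ : ∀ a b c → a * b * c ≡ a * c * b
        lemma′ = solve-∀

    2ℓ>0 : 0 < 2 * ℓ
    2ℓ>0 = ≤-trans (≤-trans (s≤s z≤n) 5≤ℓ) (m≤m+n ℓ _)

    1≤power : ∀ s → 1 ≤ (2 * ℓ) ^ s
    1≤power s = m^n>0 (2 * ℓ) ⦃ >-nonZero 2ℓ>0 ⦄ s

    ℓ≤scaled : ∀ s → ℓ ≤ (2 * ℓ) ^ s * ℓ
    ℓ≤scaled s = ≤-trans (≤-reflexive (sym (*-identityˡ ℓ))) (*-monoˡ-≤ ℓ (1≤power s))

    -- With a popular vertex `x` fixed, the path is built after cutting `W` down to neighbours of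
    -- `x`. Its start and a fresh `w` are both adjacent to `x`, which adds two vertices in front.
    zigzag : ∀ s {W : V → Set} (W? : ∀ v → Dec (W v)) F → s * 2 + suc (length F) ≤ ℓ → (2 * ℓ) ^ s * ℓ ≤ card W? →
             ∃₂ λ a b → ∃ λ xs → Path G a b xs × Unique xs × length xs ≡ 1 + s * 2 × (∀ {v} → v ∈ xs → v ∉ F) × W a × W b
    zigzag zero W? F room big with pick W? F (≤-trans room (≤-trans (ℓ≤scaled 0) big))
    ... | w , w∈W , w∉F = w , w , w ∷ [] , [ w ] , [] ∷ [] , refl , (λ { (here refl) → w∉F }) , w∈W , w∈W
    zigzag (suc s) {W} W? F room big
      with popular W? F (≤-trans (n≤1+n _) (≤-trans (m≤n+m _ (suc s * 2)) room)) (≤-trans (≤-trans (≤-trans (s≤s z≤n) 5≤ℓ) (ℓ≤scaled (suc s))) big)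
    ... | x , x∉F , share
      with zigzag s (λ w → W? w ×-dec adj? G w x) (x ∷ F)
             (≤-trans (≤-reflexive (+-suc (s * 2) _)) (≤-trans (n≤1+n _) room))
             (*-cancelˡ-≤ (2 * ℓ) ⦃ >-nonZero 2ℓ>0 ⦄ (≤-trans (≤-reflexive (sym (*-assoc (2 * ℓ) _ ℓ))) (≤-trans big share)))
    ...   | a , b , xs , p , u , len , avoid , (a∈W , ax) , (b∈W , _)
      with pick (λ w → W? w ×-dec adj? G w x) (xs ++ x ∷ F)
             (≤-trans (≤-reflexive (trans (cong suc (trans (length-++ xs) (cong (_+ suc (length F)) len))) refl)) (≤-trans room
               (≤-trans (ℓ≤scaled s) (*-cancelˡ-≤ (2 * ℓ) ⦃ >-nonZero 2ℓ>0 ⦄ (≤-trans (≤-reflexive (sym (*-assoc (2 * ℓ) _ ℓ))) (≤-trans big share))))))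
    ...     | w , (w∈W , wx) , w∉ =
      w , b , w ∷ x ∷ xs , wx ∷ adj-sym G ax ∷ p ,
      (λ { (here w≡x) → w∉ (∈-++⁺ʳ xs (here w≡x)) ; (there w∈) → w∉ (∈-++⁺ˡ w∈) }) ∷ᵘ (λ x∈ → avoid x∈ (here refl)) ∷ᵘ u ,
      cong (2 +_) len ,
      (λ { (here refl) v∈F → w∉ (∈-++⁺ʳ xs (there v∈F)) ; (there (here refl)) → x∉F ; (there (there v∈)) v∈F → avoid v∈ (there v∈F) }) ,
      w∈W , b∈W

  -- If u and v had many common neighbours, the path could be closed up to a cycle of length ℓ.
  unlinked : ∀ {u v xs} → Path G u v xs → Unique xs → odd (length xs) ≡ false → length xs < ℓ → Unlinked u v
  unlinked {u} {v} {xs} p uniq even short with card (common? u v) <? R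
  ... | yes lt = lt
  ... | no ¬lt with ∃-summand (<⇒≤ short)
  ...   | g , xs+g≡ℓ with odd⇒1+2* g (odd-complement (length xs) g even (trans (cong odd xs+g≡ℓ) ℓ-odd))
  ...     | s , refl with zigzag s (common? u v) xs
                            (≤-reflexive (trans (+-suc (s * 2) (length xs)) (trans (+-comm (suc (s * 2)) (length xs)) xs+g≡ℓ)))
                            (≤-trans (*-monoˡ-≤ ℓ (^-monoʳ-≤ (2 * ℓ) ⦃ >-nonZero 2ℓ>0 ⦄ s≤ℓ)) (≮⇒≥ ¬lt))
    where
    s≤ℓ : s ≤ ℓ
    s≤ℓ = ≤-trans (m≤m*n s 2) (≤-trans (n≤1+n _) (≤-trans (m≤n+m _ (length xs)) (≤-reflexive xs+g≡ℓ)))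
  ...       | a , b , ys , q , uniq′ , len , avoid , (_ , va) , (ub , _) =
    contradiction (close-path 3≤ℓ (join p va q) (adj-sym G ub)
      (Uniqueₚ.++⁺ uniq uniq′ (λ (v∈xs , v∈ys) → avoid v∈ys v∈xs))
      (trans (length-++ xs) (trans (cong (length xs +_) len) xs+g≡ℓ))) (free 3≤ℓ)
    where
    3≤ℓ : 3 ≤ ℓ
    3≤ℓ = ≤-trans (s≤s (s≤s (s≤s z≤n))) 5≤ℓ

  unlinked-sym : ∀ {u v} → Unlinked u v → Unlinked v u
  unlinked-sym {u} {v} = ≤-<-trans (card-mono (common? v u) (common? u v) (λ _ (a , b) → b , a))

  few<degree : ∀ {xs : List V} v → length xs ≤ ℓ → length xs < card (adj? G v)
  few<degree {xs} v le = ≤-<-trans le (*-cancelˡ-< ℓ _ _ (<-≤-trans (≤-<-trans (≤-trans (m≤n*m (ℓ * ℓ) 2)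
    (≤-reflexive (sym (*-assoc 2 ℓ ℓ)))) large) (degrees v)))

  few<linked : ∀ {xs : List V} {u v} → length xs < ℓ → ¬ Unlinked u v → length xs < card (common? u v)
  few<linked lt linked = ≤-trans lt (≤-trans (ℓ≤scaled ℓ) (≮⇒≥ linked))

  module OddCycle {r : ℕ} (r-odd : odd r ≡ true) (r<ℓ : r < ℓ) where

    private
      2+r≤ℓ : 2 + r ≤ ℓ
      2+r≤ℓ = odd-gap r-odd ℓ-odd r<ℓ

      length-arc : ∀ (z : ℕ → V) d → odd d ≡ true → odd (length (applyUpTo z (suc d))) ≡ false
      length-arc z d d-odd = trans (cong odd (length-applyUpTo z (suc d))) (cong not d-odd)

    module _ {z : ℕ → V} (per : Periodic G r z) where

      -- One of the two arcs between two vertices of an odd cycle has odd length, hence evenly many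
      -- vertices, and `unlinked` applies to it.
      unlinked-start : ∀ d → 0 < d → d < r → Unlinked (z 0) (z d)
      unlinked-start d 0<d d<r with odd d in d-parity
      ... | true = unlinked (arc (proj₁ per) d) (arc-unique per d<r) (length-arc z d d-parity)
                     (≤-<-trans (≤-reflexive (length-applyUpTo z (suc d))) (≤-<-trans d<r r<ℓ))
      ... | false with ∃-summand (<⇒≤ d<r)
      ...   | e , refl = unlinked-sym (subst₂ Unlinked (cong z (+-identityʳ d)) (proj₁ (proj₂ per) 0)
              (unlinked (arc (proj₁ per′) e) (arc-unique per′ e<r) (length-arc (λ k → z (d + k)) e (odd-complement d e d-parity r-odd))
                (≤-<-trans (≤-reflexive (length-applyUpTo (λ k → z (d + k)) (suc e))) (≤-<-trans e<r r<ℓ))))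
        where
        per′ : Periodic G (d + e) (λ k → z (d + k))
        per′ = rotate d per
        e<r : e < d + e
        e<r = m<n+m e 0<d

      -- The arc of even length between `z 0` and `z i` is prolonged by the edge to `u`.
      pendant : ∀ {u} → Adj G u (z 0) → (∀ k → k < r → u ≢ z k) → ∀ i → i < r → Unlinked u (z i)
      pendant {u} uz off i i<r with odd i in i-parity
      ... | false = unlinked (uz ∷ arc (proj₁ per) i) (∉-applyUpTo z (λ k k≤i → off k (≤-trans k≤i i<r)) ∷ᵘ arc-unique per i<r)
                      (trans (cong (not ∘ odd) (length-applyUpTo z (suc i))) (cong (not ∘ not) i-parity))
                      (≤-trans (≤-reflexive (cong (2 +_) (length-applyUpTo z (suc i)))) (≤-trans (s≤s (s≤s i<r)) 2+r≤ℓ))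
      ... | true with ∃-summand (<⇒≤ i<r)
      ...   | e , refl = unlinked-sym (subst (λ v → Unlinked v u) (cong z (+-identityʳ i))
              (unlinked (join (arc (proj₁ per′) e) (subst (λ v → Adj G v u) (sym (proj₁ (proj₂ per) 0)) (adj-sym G uz)) [ u ])
                (Uniqueₚ.++⁺ (arc-unique per′ e<r) ([] ∷ []) (λ { (v∈ , here refl) → ∉-applyUpTo (λ k → z (i + k)) u∉ v∈ }))
                (trans (cong odd length≡) (cong not (cong not (even-complement i e i-parity r-odd))))
                (≤-<-trans (≤-reflexive length≡) (≤-<-trans (s≤s e<r) 2+r≤ℓ))))
        where
        per′ : Periodic G (i + e) (λ k → z (i + k))
        per′ = rotate i per
        0<i : ∀ {i} → odd i ≡ true → 0 < i
        0<i {suc i} _ = s≤s z≤n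
        e<r : e < i + e
        e<r = m<n+m e (0<i i-parity)
        length≡ : length (applyUpTo (λ k → z (i + k)) (suc e) ++ u ∷ []) ≡ 2 + e
        length≡ = trans (length-++ (applyUpTo (λ k → z (i + k)) (suc e)))
                        (trans (cong (_+ 1) (length-applyUpTo (λ k → z (i + k)) (suc e))) (+-comm (suc e) 1))
        u∉ : ∀ k → k < suc e → u ≢ z (i + k)
        u∉ k (s≤s k≤e) eq with m≤n⇒m<n∨m≡n k≤e
        ... | inj₁ k<e  = off (i + k) (+-monoʳ-< i k<e) eq
        ... | inj₂ refl = off 0 (≤-<-trans z≤n i<r) (trans eq (proj₁ (proj₂ per) 0))

    unlinked-on : ∀ {z} → Periodic G r z → ∀ i j → i < j → j < i + r → Unlinked (z i) (z j)
    unlinked-on {z} per i j i<j j< with ∃-summand (<⇒≤ i<j)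
    ... | d , refl = subst (λ k → Unlinked (z k) (z (i + d))) (+-identityʳ i)
          (unlinked-start (rotate i per) d (n≢0⇒n>0 (λ { refl → <-irrefl (sym (+-identityʳ i)) i<j })) (+-cancelˡ-< i d r j<))

  -- The two pendant neighbourhoods at consecutive vertices and those of the cycle are ℓ almost disjoint sets.
  no-[ℓ-2]-cycle : ∀ q → (∀ v → (1 + q) * N ≤ q * ℓ * card (adj? G v)) → q * (ℓ * ℓ * R) < N →
                   ∀ {r z} → odd r ≡ true → 2 + r ≡ ℓ → ¬ Periodic G r z
  no-[ℓ-2]-cycle q degrees⁺ large⁺ {r} {z} r-odd 2+r≡ℓ per
    with pick (adj? G (z 0)) (applyUpTo z r) (few<degree {applyUpTo z r} (z 0) (≤-trans (≤-reflexive (length-applyUpTo z r)) r≤ℓ))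
    where
    r≤ℓ : r ≤ ℓ
    r≤ℓ = ≤-trans (m≤n+m r 2) (≤-reflexive 2+r≡ℓ)
  ... | u , z0u , u∉ with pick (adj? G (z 1)) (u ∷ applyUpTo z r) (few<degree {u ∷ applyUpTo z r} (z 1)
                            (≤-trans (≤-reflexive (cong suc (length-applyUpTo z r))) (≤-trans (n≤1+n _) (≤-reflexive 2+r≡ℓ))))
  ...   | u′ , z1u′ , u′∉ = contradiction large⁺ (≤⇒≯ (+-cancelʳ-≤ (q * N) _ _ (begin
      N + q * N                                                ≤⟨ *-cancelˡ-≤ ℓ ⦃ ℓ≢0 ⦄ scaled ⟩
      q * N + q * (ℓ * ℓ * R)                                  ≡⟨ +-comm (q * N) _ ⟩
      q * (ℓ * ℓ * R) + q * N                                  ∎)))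
    where
    open ≤-Reasoning
    ℓ≢0 : NonZero ℓ
    ℓ≢0 = >-nonZero (≤-trans (s≤s z≤n) 5≤ℓ)
    r<ℓ : r < ℓ
    r<ℓ = ≤-trans (n≤1+n _) (≤-reflexive 2+r≡ℓ)
    open OddCycle r-odd r<ℓ
    u-off : ∀ k → k < r → u ≢ z k
    u-off k k<r refl = u∉ (∈-applyUpTo⁺ z k<r)
    u′-off : ∀ k → k < r → u′ ≢ z k
    u′-off k k<r refl = u′∉ (there (∈-applyUpTo⁺ z k<r))
    2≤r : 2 ≤ r
    2≤r = s≤s⁻¹ (s≤s⁻¹ (≤-trans (≤-trans (s≤s (s≤s (s≤s (s≤s z≤n)))) 5≤ℓ) (≤-reflexive (sym 2+r≡ℓ))))
    u′-off′ : ∀ k → k < r → u′ ≢ z (1 + k)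
    u′-off′ k k<r eq with m≤n⇒m<n∨m≡n k<r
    ... | inj₁ 1+k<r = u′-off (suc k) 1+k<r eq
    ... | inj₂ refl  = u′-off 0 (s≤s z≤n) (trans eq (proj₁ (proj₂ per) 0))
    vertex : Fin (2 + r) → V
    vertex zero          = u
    vertex (suc zero)    = u′
    vertex (suc (suc i)) = z (toℕ i)
    pair : ∀ a b → a Fin.< b → Unlinked (vertex a) (vertex b)
    -- The path u, z 0, z 1, u′ has four vertices, which must be fewer than `ℓ`: here `5 ≤ ℓ`
    -- enters.
    pair zero (suc zero) _ = unlinked (adj-sym G z0u ∷ proj₁ per 0 ∷ z1u′ ∷ [ u′ ])
      ((λ { (here eq) → u-off 0 (≤-trans (s≤s z≤n) 2≤r) eq ; (there (here eq)) → u-off 1 2≤r eq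
          ; (there (there (here eq))) → u′∉ (here (sym eq)) }) ∷ᵘ
       (λ { (here eq) → proj₂ (proj₂ per) 0 1 (s≤s z≤n) 2≤r eq
          ; (there (here eq)) → u′-off 0 (≤-trans (s≤s z≤n) 2≤r) (sym eq) }) ∷ᵘ
       (λ { (here eq) → u′-off 1 2≤r (sym eq) }) ∷ᵘ [] ∷ [])
      refl 5≤ℓ
    pair zero (suc (suc i)) _ = pendant per (adj-sym G z0u) u-off (toℕ i) (Finₚ.toℕ<n i)
    pair (suc zero) (suc (suc i)) _ with toℕ i | Finₚ.toℕ<n i
    ... | zero  | _ = subst (Unlinked u′) (trans (cong z (m+[n∸m]≡n (≤-trans (s≤s z≤n) 2≤r))) (proj₁ (proj₂ per) 0))
                        (pendant (rotate 1 per) (adj-sym G z1u′) u′-off′ (r ∸ 1) (≤-reflexive (m+[n∸m]≡n (≤-trans (s≤s z≤n) 2≤r))))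
    ... | suc k | 1+k<r = pendant (rotate 1 per) (adj-sym G z1u′) u′-off′ k (<⇒≤ 1+k<r)
    pair (suc zero) (suc zero) (s≤s ())
    pair (suc (suc i)) (suc (suc j)) (s≤s (s≤s i<j)) =
      unlinked-on per (toℕ i) (toℕ j) i<j (≤-trans (Finₚ.toℕ<n j) (m≤n+m r (toℕ i)))
    nbr? : ∀ (a : Fin (2 + r)) v → Dec (Adj G (vertex a) v)
    nbr? a = adj? G (vertex a)
    scaled : ℓ * ((1 + q) * N) ≤ ℓ * (q * N + q * (ℓ * ℓ * R))
    scaled = begin
      ℓ * ((1 + q) * N)                                 ≡⟨ cong (_* ((1 + q) * N)) (sym 2+r≡ℓ) ⟩
      (2 + r) * ((1 + q) * N)                           ≡⟨ sum-const (2 + r) ((1 + q) * N) ⟨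
      sum {2 + r} (λ _ → (1 + q) * N)
        ≤⟨ sum-mono {f = λ _ → (1 + q) * N} {g = λ a → q * ℓ * card (nbr? a)} (λ a → degrees⁺ (vertex a)) ⟩
      sum (λ a → q * ℓ * card (nbr? a))                 ≡⟨ *-distribˡ-sum (q * ℓ) (λ a → card (nbr? a)) ⟨
      q * ℓ * sum (λ a → card (nbr? a))                 ≡⟨ cong (q * ℓ *_) (*-identityˡ _) ⟨
      q * ℓ * (1 * sum (λ a → card (nbr? a)))
        ≤⟨ *-monoʳ-≤ (q * ℓ) (card-bonferroni nbr? {1} (λ a b a<b → ≤-trans (≤-reflexive (*-identityˡ _)) (<⇒≤ (pair a b a<b)))) ⟩
      q * ℓ * (1 * N + (2 + r) * (2 + r) * R)           ≡⟨ cong (λ t → q * ℓ * (1 * N + t * t * R)) 2+r≡ℓ ⟩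
      q * ℓ * (1 * N + ℓ * ℓ * R)                       ≡⟨ lemma q ℓ N (ℓ * ℓ * R) ⟩
      ℓ * (q * N + q * (ℓ * ℓ * R))                     ∎
      where
      lemma : ∀ q l n x → q * l * (1 * n + x) ≡ l * (q * n + q * x)
      lemma = solve-∀

-- Enumeration of decidable sets and sums over products

member : ∀ {n} {P : Fin n → Set} (P? : ∀ i → Dec (P i)) → Fin (card P?) → ∃ P
member {suc n} P? a with P? zero
member {suc n} P? zero    | yes p = zero , p
member {suc n} P? (suc a) | yes p = let i , q = member (P? ∘ suc) a in suc i , q
member {suc n} P? a       | no _  = let i , q = member (P? ∘ suc) a in suc i , q

member-injective : ∀ {n} {P : Fin n → Set} (P? : ∀ i → Dec (P i)) a b →
                   proj₁ (member P? a) ≡ proj₁ (member P? b) → a ≡ b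
member-injective {suc n} P? a b eq with P? zero
member-injective {suc n} P? zero    zero    eq | yes p = refl
member-injective {suc n} P? (suc a) (suc b) eq | yes p = cong suc (member-injective (P? ∘ suc) a b (Finₚ.suc-injective eq))
member-injective {suc n} P? a       b       eq | no _  = member-injective (P? ∘ suc) a b (Finₚ.suc-injective eq)

index : ∀ {n} {P : Fin n → Set} (P? : ∀ i → Dec (P i)) v → P v → Fin (card P?)
index {suc n} P? v p with P? zero
index {suc n} P? zero    p | yes _ = zero
index {suc n} P? (suc v) p | yes _ = suc (index (P? ∘ suc) v p)
index {suc n} P? zero    p | no ¬p = contradiction p ¬p
index {suc n} P? (suc v) p | no _  = index (P? ∘ suc) v p

index-injective : ∀ {n} {P : Fin n → Set} (P? : ∀ i → Dec (P i)) {u v} (p : P u) (q : P v) →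
                  index P? u p ≡ index P? v q → u ≡ v
index-injective {suc n} P? {u} {v} p q eq with P? zero
index-injective {suc n} P? {zero}  {zero}  p q eq | yes _ = refl
index-injective {suc n} P? {suc u} {suc v} p q eq | yes _ = cong suc (index-injective (P? ∘ suc) p q (Finₚ.suc-injective eq))
index-injective {suc n} P? {zero}  {_}     p q eq | no ¬p = contradiction p ¬p
index-injective {suc n} P? {suc u} {zero}  p q eq | no ¬p = contradiction q ¬p
index-injective {suc n} P? {suc u} {suc v} p q eq | no _  = cong suc (index-injective (P? ∘ suc) p q eq)

sum-↑ : ∀ m {n} (h : Fin (m + n) → ℕ) → sum h ≡ sum (λ i → h (i ↑ˡ n)) + sum (λ j → h (m ↑ʳ j))
sum-↑ zero    h = refl
sum-↑ (suc m) h = trans (cong (h zero +_) (sum-↑ m (h ∘ suc))) (sym (+-assoc (h zero) _ _))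

-- Coding pairs in `Fin (m * n)` brings rectangles within the scope of `bonferroni`.
sum-product : ∀ {m n} (f : Fin m → ℕ) (g : Fin n → ℕ) →
              sum {m * n} (λ k → f (quotient n k) * g (remainder {m} n k)) ≡ sum f * sum g
sum-product {zero}  {n} f g = refl
sum-product {suc m} {n} f g = begin
  sum {n + m * n} h
    ≡⟨ sum-↑ n h ⟩
  sum (λ i → h (i ↑ˡ (m * n))) + sum (λ j → h (n ↑ʳ j))
    ≡⟨ cong₂ _+_ (trans (sum-cong-≗ left) (sym (*-distribˡ-sum (f zero) g)))
                 (trans (sum-cong-≗ right) (sum-product (f ∘ suc) g)) ⟩
  f zero * sum g + sum (f ∘ suc) * sum g
    ≡⟨ *-distribʳ-+ (sum g) (f zero) _ ⟨
  (f zero + sum (f ∘ suc)) * sum g ∎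
  where
  open ≡-Reasoning
  h : Fin (n + m * n) → ℕ
  h k = f (quotient n k) * g (remainder {suc m} n k)
  left : ∀ i → h (i ↑ˡ (m * n)) ≡ f zero * g i
  left i rewrite Finₚ.splitAt-↑ˡ n i (m * n) = refl
  right : ∀ j → h (n ↑ʳ j) ≡ f (suc (quotient n j)) * g (remainder {m} n j)
  right j rewrite Finₚ.splitAt-↑ʳ n (m * n) j = refl

-- Vertices on short odd cycles

module _ (G : Graph) (ℓ : ℕ) where

  CycleThrough : ℕ → Fin (n G) → Set
  CycleThrough r v = Σ[ h ∈ 3 ≤ r ] ∃ λ f → Embedding (Cycle r h) G f × ∃ λ i → f i ≡ v

  cycleThrough? : ∀ r v → Dec (CycleThrough r v)
  cycleThrough? r v with 3 ≤? r
  ... | no ¬h = no (λ (h , _) → ¬h h)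
  ... | yes h = map′ (h ,_) proj₂
      (any-function? {P = λ f → Embedding (Cycle r h) G f × ∃ λ i → f i ≡ v}
        (λ f≗g (emb , i , eq) → embedding-respects (Cycle r h) G f≗g emb , i , trans (sym (f≗g i)) eq)
        (λ f → embedding? (Cycle r h) G f ×-dec any? (λ i → f i Finₚ.≟ v)))

  Short : Fin (n G) → Set
  Short v = ∃ λ (r : Fin ℓ) → odd (toℕ r) ≡ true × CycleThrough (toℕ r) v

  short? : ∀ v → Dec (Short v)
  short? v = any? (λ r → (odd (toℕ r) Bool.≟ true) ×-dec cycleThrough? (toℕ r) v)

  short⇒periodic : ∀ {v} → Short v → ∃₂ λ r z → odd r ≡ true × r < ℓ × Periodic G r z × z 0 ≡ v
  short⇒periodic (r , r-odd , h , f , emb , i , fi≡v) with cycle⇒periodic {G} {h = h} (f , emb)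
  ... | z , per , cover with cover i
  ...   | k , fi≡zk = toℕ r , (λ j → z (k + j)) , r-odd , Finₚ.toℕ<n r , Paths.rotate G k per ,
                      trans (cong z (+-identityʳ k)) (trans (sym fi≡zk) fi≡v)

  through⇒short : ∀ {v} → OddCycleThrough {G} ℓ v → Short v
  through⇒short {v} (r , z , r-odd , r<ℓ , walk , simple , k , k<r , zk≡v) =
    fromℕ< r<ℓ , trans (cong odd r≡) r-odd , subst (λ r → CycleThrough r v) (sym r≡)
      (h , proj₁ cyc , proj₂ cyc , fromℕ< k<r , trans (cong z (Finₚ.toℕ-fromℕ< k<r)) zk≡v)
    where
    r≡ : toℕ (fromℕ< r<ℓ) ≡ r
    r≡ = Finₚ.toℕ-fromℕ< r<ℓ
    h : 3 ≤ r
    h = odd-closed⇒3≤ {G} walk r-odd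
    cyc : Cycle r h ⊆ G
    cyc = closed⇒cycle {G} h walk simple

  -- A repetition splits off an odd cycle shorter than `ℓ` through the repeated vertex. The first
  -- conclusion keeps the cycle of length `ℓ` out of the quotient; the second shows that no odd
  -- closed walk of length at most `ℓ` avoids all short vertices.
  odd-closed-walk-repeats : (∀ h → ¬ (Cycle ℓ h ⊆ G)) → ∀ {r z} → odd r ≡ true → r ≤ ℓ → ClosedWalk G r z →
    (r ≡ ℓ → ∃₂ λ i j → i < j × j < r × z i ≡ z j × Short (z i)) × (∃ λ i → i < r × Short (z i))
  odd-closed-walk-repeats free {r} {z} r-odd r≤ℓ walk with odd-closed-walk {G} r z r-odd walk | m≤n⇒m<n∨m≡n r≤ℓ
  ... | inj₁ simple | inj₁ r<ℓ =
        (λ { refl → contradiction r<ℓ (<-irrefl refl) }) ,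
        0 , 0<r , through⇒short (r , z , r-odd , r<ℓ , walk , simple , 0 , 0<r , refl)
    where
    0<r : 0 < r
    0<r = ≤-trans (s≤s z≤n) (odd-closed⇒3≤ {G} walk r-odd)
  ... | inj₁ simple | inj₂ refl = contradiction (closed⇒cycle {G} (odd-closed⇒3≤ {G} walk r-odd) walk simple) (free (odd-closed⇒3≤ {G} walk r-odd))
  ... | inj₂ (i , j , i<j , j<r , eq , r′ , z′ , r′-odd , r′<r , rest) | _ =
        (λ _ → i , j , i<j , j<r , eq , short) , i , <-trans i<j j<r , short
    where
    short : Short (z i)
    short = through⇒short (r′ , z′ , r′-odd , ≤-trans r′<r r≤ℓ , rest)

module _ (G : Graph) (ℓ : ℕ) (ℓ-odd : odd ℓ ≡ true) (5≤ℓ : 5 ≤ ℓ)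
         (free : ∀ h → ¬ (Cycle ℓ h ⊆ G))
         (degrees : ∀ v → n G ≤ ℓ * card (adj? G v))
         (large : 2 * ℓ * ℓ < n G)
  where

  open Linked G ℓ ℓ-odd 5≤ℓ free degrees large
  open Paths G

  module _ {r z} (r-odd : odd r ≡ true) (4+r≤ℓ : 4 + r ≤ ℓ) (per : Periodic G r z) where

    private
      r<ℓ : r < ℓ
      r<ℓ = ≤-trans (m≤n+m (suc r) 3) 4+r≤ℓ

      2≤r : 2 ≤ r
      2≤r = ≤-trans (n≤1+n 2) (odd-closed⇒3≤ {G} (proj₁ (periodic⇒closed {G} per)) r-odd)

      close : z r ≡ z 0
      close = proj₁ (proj₂ per) 0

      open OddCycle r-odd r<ℓ

      around : Path G (z 1) (z r) (applyUpTo (z ∘ suc) r)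
      around = subst (λ d → Path G (z 1) (z d) (applyUpTo (z ∘ suc) d)) (m+[n∸m]≡n (≤-trans (n≤1+n 1) 2≤r))
                     (arc (λ k → proj₁ per (suc k)) (r ∸ 1))

      around-unique : Unique (applyUpTo (z ∘ suc) r)
      around-unique = arc-unique (rotate 1 per) ≤-refl

      off-suc : ∀ {v} → (∀ k → k < r → v ≢ z k) → v ∉ applyUpTo (z ∘ suc) r
      off-suc {v} off = ∉-applyUpTo (z ∘ suc) λ k k<r → [ off (suc k) , (λ { refl eq → off 0 (≤-trans (s≤s z≤n) 2≤r) (trans eq close) }) ]′ (m≤n⇒m<n∨m≡n k<r)

    -- An edge p q with both ends linked to those of z 0 — z 1 would lengthen the cycle by two.
    linked-edges : ∀ {p q} → Adj G p q → p ≢ z 0 → ¬ (¬ Unlinked p (z 0) × ¬ Unlinked q (z 1))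
    linked-edges {p} {q} pq p≢ (linked-p , linked-q) with q Finₚ.≟ z 1
    ... | yes refl = linked-p (subst (Unlinked p) close (unlinked (pq ∷ around) (off-suc p-off ∷ᵘ around-unique)
            (trans (cong (not ∘ odd) (length-applyUpTo (z ∘ suc) r)) (cong not r-odd))
            (≤-trans (s≤s (s≤s (≤-reflexive (length-applyUpTo (z ∘ suc) r)))) (≤-trans (m≤n+m (2 + r) 2) 4+r≤ℓ))))
      where
      p-off : ∀ k → k < r → p ≢ z k
      p-off zero    _   = p≢
      p-off (suc k) k<r refl = linked-p (unlinked-sym (unlinked-on per 0 (suc k) (s≤s z≤n) k<r))
    -- `p`, `q`, `x` and the way round from `z 1` to `z 0` form a path of `3 + r` vertices, evenly
    -- many and fewer than `ℓ`. For `r = ℓ - 2` there is no room for it, hence the separate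
    -- exclusion of that length.
    ... | no q≢ with pick (common? q (z 1)) (p ∷ q ∷ applyUpTo (z ∘ suc) r)
                       (few<linked {p ∷ q ∷ applyUpTo (z ∘ suc) r} (≤-trans (≤-reflexive (cong (3 +_) (length-applyUpTo (z ∘ suc) r))) (≤-trans (n≤1+n _) 4+r≤ℓ)) linked-q)
    ...   | x , (qx , z1x) , x∉ = linked-p (subst (Unlinked p) close (unlinked (pq ∷ qx ∷ adj-sym G z1x ∷ around)
            ((λ { (here refl) → irrefl G pq ; (there (here eq)) → x∉ (here (sym eq)) ; (there (there p∈)) → off-suc p-off p∈ }) ∷ᵘ
             (λ { (here eq) → x∉ (there (here (sym eq))) ; (there q∈) → off-suc q-off q∈ }) ∷ᵘ
             (λ x∈ → x∉ (there (there x∈))) ∷ᵘ around-unique)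
            (trans (cong (not ∘ not ∘ not ∘ odd) (length-applyUpTo (z ∘ suc) r)) (cong (not ∘ not ∘ not) r-odd))
            (≤-trans (≤-reflexive (cong (4 +_) (length-applyUpTo (z ∘ suc) r))) 4+r≤ℓ)))
      where
      p-off : ∀ k → k < r → p ≢ z k
      p-off zero    _   = p≢
      p-off (suc k) k<r refl = linked-p (unlinked-sym (unlinked-on per 0 (suc k) (s≤s z≤n) k<r))
      q-off : ∀ k → k < r → q ≢ z k
      q-off zero          _   refl = linked-q (unlinked-on per 0 1 (s≤s z≤n) 2≤r)
      q-off 1             _        = q≢
      q-off (suc (suc k)) k<r refl = linked-q (unlinked-sym (unlinked-on per 1 (2 + k) (s≤s (s≤s z≤n)) (m≤n⇒m≤1+n k<r)))

  private
    N t : ℕ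
    N = n G
    t = suc (ℓ * ℓ)

  -- Since linked-edges separates them, the rectangles N (p) × N (q) over the first edges p q of more
  -- than ℓ² short cycles would be almost disjoint subsets of V × V of density at least 1 / ℓ².
  few-short-vertices : ∀ q → (∀ v → (1 + q) * N ≤ q * ℓ * card (adj? G v)) →
                       q * (ℓ * ℓ * R) < N → ℓ * ℓ * (t * t * R) < N → card (short? G ℓ) ≤ ℓ * ℓ
  few-short-vertices q degrees⁺ large⁺ larger = ≮⇒≥ (λ many → impossible many)
    where
    module Many (many : ℓ * ℓ < card (short? G ℓ)) where
      open ≤-Reasoning
      vertex : Fin t → Fin N
      vertex a = proj₁ (member (short? G ℓ) (inject≤ a many))
      vertex-inj : ∀ {a b} → vertex a ≡ vertex b → a ≡ b
      vertex-inj {a} {b} eq = Finₚ.inject≤-injective many many a b (member-injective (short? G ℓ) _ _ eq)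
      cyc : ∀ a → ∃₂ λ r z → odd r ≡ true × r < ℓ × Periodic G r z × z 0 ≡ vertex a
      cyc a = short⇒periodic G ℓ (proj₂ (member (short? G ℓ) (inject≤ a many)))
      p p′ : Fin t → Fin N
      p a  = proj₁ (proj₂ (cyc a)) 0
      p′ a = proj₁ (proj₂ (cyc a)) 1
      pp′ : ∀ a → Adj G (p a) (p′ a)
      pp′ a = let _ , _ , _ , _ , (edge , _) , _ = cyc a in edge 0
      p-inj : ∀ {a b} → p a ≡ p b → a ≡ b
      p-inj {a} {b} eq = let _ , _ , _ , _ , _ , za = cyc a ; _ , _ , _ , _ , _ , zb = cyc b in
        vertex-inj (trans (sym za) (trans eq zb))
      separate : ∀ a b → a Fin.< b → ¬ (¬ Unlinked (p a) (p b) × ¬ Unlinked (p′ a) (p′ b))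
      separate a b a<b = let r , z , r-odd , r<ℓ , per , _ = cyc b in
        linked-edges r-odd (far r-odd r<ℓ per) per (pp′ a) (λ eq → <-irrefl (cong toℕ (p-inj eq)) a<b)
        where
        far : ∀ {r z} → odd r ≡ true → r < ℓ → Periodic G r z → 4 + r ≤ ℓ
        far {r} r-odd r<ℓ per with m≤n⇒m<n∨m≡n (odd-gap r-odd ℓ-odd r<ℓ)
        ... | inj₁ lt = odd-gap {2 + r} (cong (not ∘ not) r-odd) ℓ-odd lt
        ... | inj₂ eq = contradiction per (no-[ℓ-2]-cycle q degrees⁺ large⁺ r-odd eq)
      A B : Fin t → Fin N → ℕ
      A a x = 𝟙 (adj? G (p a) x)
      B a y = 𝟙 (adj? G (p′ a) y)
      w : Fin (N * N) → Fin t → ℕ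
      w k a = A a (quotient N k) * B a (remainder {N} N k)
      w≤1 : ∀ k a → w k a ≤ 1
      w≤1 k a = *-mono-≤ (𝟙≤1 (adj? G (p a) (quotient N k))) (𝟙≤1 (adj? G (p′ a) (remainder {N} N k)))
      meet≡ : ∀ a b → sum (λ k → w k a * w k b) ≡ card (common? (p a) (p b)) * card (common? (p′ a) (p′ b))
      meet≡ a b = trans (sum-cong-≗ (λ k → swap (A a (quotient N k)) (B a (remainder {N} N k)) (A b (quotient N k)) (B b (remainder {N} N k))))
        (trans (sum-product (λ x → A a x * A b x) (λ y → B a y * B b y))
               (cong₂ _*_ (sum-cong-≗ (λ x → sym (𝟙-× (adj? G (p a) x) (adj? G (p b) x))))
                          (sum-cong-≗ (λ y → sym (𝟙-× (adj? G (p′ a) y) (adj? G (p′ b) y))))))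
        where
        swap : ∀ a b c d → a * b * (c * d) ≡ a * c * (b * d)
        swap = solve-∀
      product≤ : ∀ {u v u′ v′} → ¬ (¬ Unlinked u v × ¬ Unlinked u′ v′) →
                 card (common? u v) * card (common? u′ v′) ≤ N * R
      product≤ {u} {v} {u′} {v′} not-both = bound (_ <? R) (_ <? R)
        where
        bound : Dec (Unlinked u v) → Dec (Unlinked u′ v′) → card (common? u v) * card (common? u′ v′) ≤ N * R
        bound (yes lt) _        = ≤-trans (≤-reflexive (*-comm (card (common? u v)) _)) (*-mono-≤ (card≤n (common? u′ v′)) (<⇒≤ lt))
        bound (no _)   (yes lt) = *-mono-≤ (card≤n (common? u v)) (<⇒≤ lt)
        bound (no ¬l)  (no ¬l′) = contradiction (¬l , ¬l′) not-both
      meet : ∀ a b → a Fin.< b → 1 * sum (λ k → w k a * w k b) ≤ N * R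
      meet a b a<b = ≤-trans (≤-reflexive (trans (*-identityˡ _) (meet≡ a b)))
                             (product≤ {p a} {p b} {p′ a} {p′ b} (separate a b a<b))
      area : ∀ a → N * N ≤ ℓ * ℓ * sum (λ k → w k a)
      area a = begin
        N * N                                               ≤⟨ *-mono-≤ (degrees (p a)) (degrees (p′ a)) ⟩
        ℓ * card (adj? G (p a)) * (ℓ * card (adj? G (p′ a))) ≡⟨ lemma ℓ (card (adj? G (p a))) (card (adj? G (p′ a))) ⟩
        ℓ * ℓ * (card (adj? G (p a)) * card (adj? G (p′ a))) ≡⟨ cong (ℓ * ℓ *_) (sum-product (A a) (B a)) ⟨
        ℓ * ℓ * sum (λ k → w k a)                           ∎
        where
        lemma : ∀ l a b → l * a * (l * b) ≡ l * l * (a * b)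
        lemma = solve-∀
      total : N * N + ℓ * ℓ * (N * N) ≤ ℓ * ℓ * (t * t * R) * N + ℓ * ℓ * (N * N)
      total = begin
        t * (N * N)                                         ≡⟨ sum-const t (N * N) ⟨
        sum {t} (λ _ → N * N)                               ≤⟨ sum-mono {f = λ _ → N * N} {g = λ a → ℓ * ℓ * sum (λ k → w k a)} area ⟩
        sum (λ a → ℓ * ℓ * sum (λ k → w k a))               ≡⟨ *-distribˡ-sum (ℓ * ℓ) (λ a → sum (λ k → w k a)) ⟨
        ℓ * ℓ * sum (λ a → sum (λ k → w k a))               ≡⟨ cong (ℓ * ℓ *_) (*-identityˡ _) ⟨
        ℓ * ℓ * (1 * sum (λ a → sum (λ k → w k a)))         ≤⟨ *-monoʳ-≤ (ℓ * ℓ) (bonferroni {c = 1} w w≤1 meet) ⟩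
        ℓ * ℓ * (1 * (N * N) + t * t * (N * R))             ≡⟨ lemma (ℓ * ℓ) N (t * t) R ⟩
        ℓ * ℓ * (t * t * R) * N + ℓ * ℓ * (N * N)           ∎
        where
        lemma : ∀ l n t r → l * (1 * (n * n) + t * (n * r)) ≡ l * (t * r) * n + l * (n * n)
        lemma = solve-∀
    impossible : ¬ ℓ * ℓ < card (short? G ℓ)
    impossible many = <⇒≱ larger (*-cancelʳ-≤ N _ N ⦃ >-nonZero (≤-<-trans z≤n large⁺) ⦄ (+-cancelʳ-≤ (ℓ * ℓ * (N * N)) _ _ (Many.total many)))

-- The upper bounds

-- Large enough for the excess of ℓ times the minimum degree over n, which is at least n / q, to
-- absorb the at most ℓ² + ℓ error terms n / c.
precision : ℕ → ℕ → ℕ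
precision q ℓ = 2 * q * (ℓ * ℓ + ℓ)

module _ (G : Graph) {S : Fin (n G) → Set} (S? : ∀ v → Dec (S v)) (s : ℕ) (few : card S? ≤ s)
         (q ℓ : ℕ) .{{_ : NonZero q}} .{{_ : NonZero ℓ}} (ℓ-odd : odd ℓ ≡ true)
         (degrees : ∀ v → (1 + q) * n G ≤ q * ℓ * card (adj? G v))
         (no-odd : ∀ {m v} → Walk (Outside G S?) m v v → odd m ≡ true → ¬ m ≤ ℓ)
  where

  private
    N X c M d : ℕ
    N = n G
    X = ℓ * ℓ + ℓ
    c = precision q ℓ
    M = c * N + (ℓ * ℓ * N + ℓ * N)

    instance
      X≢0 : NonZero X
      X≢0 = >-nonZero (≤-trans (>-nonZero⁻¹ ℓ) (m≤n+m ℓ (ℓ * ℓ)))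

      c≢0 : NonZero c
      c≢0 = m*n≢0 (2 * q) X ⦃ m*n≢0 2 q ⦄

      ℓc≢0 : NonZero (ℓ * c)
      ℓc≢0 = m*n≢0 ℓ c

    -- The least `d` with `M < ℓ * (c * d)`.
    d = suc (M / (ℓ * c))

    dense : M < ℓ * (c * d)
    dense = ≤-trans (m<n*suc[m/n] M (ℓ * c)) (≤-reflexive (*-assoc ℓ c d))

    -- The factor 2 in `precision` provides `X * N` twice: once for the error terms in `M`, once for
    -- the at most `s` neighbours lost with `S`.
    enough : c * ℓ * s < N → ∀ {x y} → Outside G S? x y → M < card (outside? G S? x) * (ℓ * c)
    enough large {x} (_ , x∉S , _) = +-cancelʳ-< (X * N) _ _ (begin-strict
      M + X * N                                    ≡⟨ lemma₁ q (ℓ * ℓ) ℓ N ⟩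
      2 * X * ((1 + q) * N)                        ≤⟨ *-monoʳ-≤ (2 * X) (degrees x) ⟩
      2 * X * (q * ℓ * card (adj? G x))            ≤⟨ *-monoʳ-≤ (2 * X) (*-monoʳ-≤ (q * ℓ) (≤-trans (card-∪ (outside? G S? x) S? (adj? G x) split) (+-monoʳ-≤ o few))) ⟩
      2 * X * (q * ℓ * (o + s))                    ≡⟨ lemma₂ X q ℓ o s ⟩
      o * (ℓ * c) + c * ℓ * s                      <⟨ +-monoʳ-< (o * (ℓ * c)) (<-≤-trans large (m≤n*m N X)) ⟩
      o * (ℓ * c) + X * N                          ∎)
      where
      open ≤-Reasoning
      o : ℕ
      o = card (outside? G S? x)
      split : ∀ v → Adj G x v → Outside G S? x v ⊎ S v
      split v xv with S? v
      ... | yes v∈ = inj₂ v∈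
      ... | no v∉  = inj₁ (xv , x∉S , v∉)
      lemma₁ : ∀ q a l n → 2 * q * (a + l) * n + (a * n + l * n) + (a + l) * n ≡ 2 * (a + l) * ((1 + q) * n)
      lemma₁ = solve-∀
      lemma₂ : ∀ x q l o s → 2 * x * (q * l * (o + s)) ≡ o * (l * (2 * q * x)) + 2 * q * x * l * s
      lemma₂ = solve-∀

  dense-colouring : c * ℓ * s < N → LiftingColouring G S ℓ (colours s ℓ c)
  dense-colouring large = lifting-colouring G S? (λ v v∈S → inject≤ (index S? v v∈S) few)
    (λ p q eq → index-injective S? p q (Finₚ.inject≤-injective few few _ _ eq))
    ℓ c d ℓ-odd (λ xy → m<n*o⇒m/o<n (enough large xy)) no-odd dense

-- Over the integers, `p / q > 1 / ℓ` gives `1 + q ≤ p * ℓ`: this is the excess that pays for all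
-- errors.
scaled-degrees : ∀ {p q ℓ N D} .{{_ : NonZero q}} → 1 * q < p * ℓ → p * N ≤ q * D → (1 + q) * N ≤ q * ℓ * D
scaled-degrees {p} {q} {ℓ} {N} {D} q<pℓ pN≤qD = begin
  (1 + q) * N     ≤⟨ *-monoˡ-≤ N (≤-trans (≤-reflexive (cong suc (sym (*-identityˡ q)))) q<pℓ) ⟩
  p * ℓ * N       ≡⟨ lemma p ℓ N ⟩
  ℓ * (p * N)     ≤⟨ *-monoʳ-≤ ℓ pN≤qD ⟩
  ℓ * (q * D)     ≡⟨ lemma′ ℓ q D ⟩
  q * ℓ * D       ∎
  where
  open ≤-Reasoning
  lemma : ∀ a b c → a * b * c ≡ b * (a * c)
  lemma = solve-∀
  lemma′ : ∀ a b c → a * (b * c) ≡ b * a * c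
  lemma′ = solve-∀

outside-closed : ∀ {G : Graph} {S : Fin (n G) → Set} (S? : ∀ v → Dec (S v)) {m v} (w : Walk (Outside G S?) m v v) → ClosedWalk G m (at w)
outside-closed S? w = (λ i i<m → proj₁ (at-step w i i<m)) , trans (at-end w) (sym (at-start w))

module _ {ℓ : ℕ} (ℓ-odd : odd ℓ ≡ true) (5≤ℓ : 5 ≤ ℓ) {p q : ℕ} (0<q : 0 < q) (q<pℓ : 1 * q < p * ℓ) where

  private
    instance
      q≢0 : NonZero q
      q≢0 = >-nonZero 0<q

      ℓ≢0 : NonZero ℓ
      ℓ≢0 = >-nonZero (≤-trans (s≤s z≤n) 5≤ℓ)

    1≤ℓ : 1 ≤ ℓ
    1≤ℓ = ≤-trans (s≤s z≤n) 5≤ℓ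

    c : ℕ
    c = precision q ℓ

    module _ (G : Graph) (mindeg : MinDegAtLeast G p q) where

      degrees⁺ : ∀ v → (1 + q) * n G ≤ q * ℓ * card (adj? G v)
      degrees⁺ v = scaled-degrees {p = p} q<pℓ (≤-trans (mindeg v) (≤-reflexive (cong (q *_) (degree≡card G v))))

      degrees : ∀ v → n G ≤ ℓ * card (adj? G v)
      degrees v = *-cancelˡ-≤ q (≤-trans (m≤n+m (q * n G) (n G)) (≤-trans (degrees⁺ v) (≤-reflexive (*-assoc q ℓ _))))

    odd? : ∀ r → Dec (OddUpTo ℓ r)
    odd? r = (odd r Bool.≟ true) ×-dec (r ≤? ℓ)

  all-odd-cycles : ∃ λ H → CycleFree (OddUpTo ℓ) H ×
    (∀ G → CycleFree (OddUpTo ℓ) G → MinDegAtLeast G p q → G ⟶ H)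
  all-odd-cycles = Universal.target odd? proj₂ K , Universal.target-free odd? proj₂ K , hom
    where
    K : ℕ
    K = 0 + colours 0 ℓ c
    hom : ∀ G → CycleFree (OddUpTo ℓ) G → MinDegAtLeast G p q → G ⟶ Universal.target odd? proj₂ K
    hom G free mindeg = lifting⇒hom odd? proj₂ 1≤ℓ proj₁ {G} {λ _ → ⊥}
      (λ (r-odd , r≤ℓ) walk → contradiction r≤ℓ (no-odd-closed-walk {G} free r-odd walk)) (colouring (n G ≤? 0))
      where
      none? : ∀ (v : Fin (n G)) → Dec ⊥
      none? _ = no (λ ())
      -- The empty graph is set apart because `dense-colouring` asks for a strict inequality.
      colouring : Dec (n G ≤ 0) → LiftingColouring G (λ _ → ⊥) ℓ K
      colouring (yes small) = colouring-mono {G} (≤-trans small z≤n) (identity-colouring G (λ _ → ⊥) ℓ)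
      colouring (no ¬small) = dense-colouring G none? 0 (≤-reflexive (card-∅ none? (λ _ ()))) q ℓ ℓ-odd (degrees⁺ G mindeg)
              (λ w m-odd → no-odd-closed-walk {G} free m-odd (outside-closed {G} none? w))
              (≤-<-trans (≤-reflexive (*-zeroʳ (c * ℓ))) (≰⇒> ¬small))

  single-odd-cycle : ∃ λ H → CycleFree (_≡ ℓ) H ×
    (∀ G → CycleFree (_≡ ℓ) G → MinDegAtLeast G p q → G ⟶ H)
  single-odd-cycle = Universal.target (_≟ ℓ) ≤-reflexive K , Universal.target-free (_≟ ℓ) ≤-reflexive K , hom
    where
    R t n₁ n₂ n₃ n₄ n₀ K : ℕ
    R = (2 * ℓ) ^ ℓ * ℓ
    t = suc (ℓ * ℓ)
    n₁ = 2 * ℓ * ℓ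
    n₂ = q * (ℓ * ℓ * R)
    n₃ = ℓ * ℓ * (t * t * R)
    n₄ = c * ℓ * (ℓ * ℓ)
    -- Up to this order graphs are coloured injectively. Beyond it `n₁` yields popular vertices,
    -- `n₂` excludes cycles of length `ℓ - 2`, `n₃` bounds the short vertices, and `n₄` allows their
    -- removal.
    n₀ = n₁ + n₂ + (n₃ + n₄)
    K = n₀ + colours (ℓ * ℓ) ℓ c
    hom : ∀ G → CycleFree (_≡ ℓ) G → MinDegAtLeast G p q → G ⟶ Universal.target (_≟ ℓ) ≤-reflexive K
    hom G cycle-free mindeg = lifting⇒hom (_≟ ℓ) ≤-reflexive 1≤ℓ (λ { refl → ℓ-odd }) {G} {Short G ℓ}
      (λ { refl walk → proj₁ (odd-closed-walk-repeats G ℓ free ℓ-odd ≤-refl walk) refl }) (colouring (n G ≤? n₀))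
      where
      free : ∀ h → ¬ (Cycle ℓ h ⊆ G)
      free h = cycle-free ℓ h refl
      colouring : Dec (n G ≤ n₀) → LiftingColouring G (Short G ℓ) ℓ K
      colouring (yes small) = colouring-mono {G} {Short G ℓ} (≤-trans small (m≤m+n n₀ _)) (identity-colouring G (Short G ℓ) ℓ)
      colouring (no ¬small) = colouring-mono {G} {Short G ℓ} (m≤n+m _ n₀)
        (dense-colouring G (short? G ℓ) (ℓ * ℓ) few q ℓ ℓ-odd (degrees⁺ G mindeg) no-odd
          (≤-<-trans (≤-trans (m≤n+m n₄ n₃) (m≤n+m (n₃ + n₄) (n₁ + n₂))) large))
        where
        large : n₀ < n G
        large = ≰⇒> ¬small
        few : card (short? G ℓ) ≤ ℓ * ℓ
        few = few-short-vertices G ℓ ℓ-odd 5≤ℓ free (degrees G mindeg)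
                (≤-<-trans (≤-trans (m≤m+n n₁ n₂) (m≤m+n (n₁ + n₂) (n₃ + n₄))) large) q (degrees⁺ G mindeg)
                (≤-<-trans (≤-trans (m≤n+m n₂ n₁) (m≤m+n (n₁ + n₂) (n₃ + n₄))) large)
                (≤-<-trans (≤-trans (m≤m+n n₃ n₄) (m≤n+m (n₃ + n₄) (n₁ + n₂))) large)
        no-odd : ∀ {m v} → Walk (Outside G (short? G ℓ)) m v v → odd m ≡ true → ¬ m ≤ ℓ
        no-odd w m-odd m≤ℓ with proj₂ (odd-closed-walk-repeats G ℓ free m-odd m≤ℓ (outside-closed {G} (short? G ℓ) w))
        ... | i , i<m , short = proj₁ (proj₂ (at-step w i i<m)) short

-- The lower bound and the theorem

odd⇒%2≡1 : ∀ {r} → odd r ≡ true → r % 2 ≡ 1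
odd⇒%2≡1 {r} r-odd with odd⇒1+2* r r-odd
... | s , refl = [m+kn]%n≡m%n 1 s 2

%2≡1⇒odd : ∀ r → r % 2 ≡ 1 → odd r ≡ true
%2≡1⇒odd 1             _  = refl
%2≡1⇒odd (suc (suc r)) eq rewrite %2≡1⇒odd r eq = refl

cycleFree⇒free : ∀ {ℓ G} → CycleFree (OddUpTo ℓ) G → Free (OddCyclesUpTo ℓ) G
cycleFree⇒free free (r , h , r%2 , r≤ℓ) = free r h (%2≡1⇒odd r r%2 , r≤ℓ)

free⇒cycleFree : ∀ {ℓ G} → Free (OddCyclesUpTo ℓ) G → CycleFree (OddUpTo ℓ) G
free⇒cycleFree free r h (r-odd , r≤ℓ) = free (r , h , odd⇒%2≡1 {r} r-odd , r≤ℓ)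

lower-bound : ∀ κ → HomThresholdAtLeast (OddCyclesUpTo (1 + (κ + κ))) 1 (1 + (κ + κ))
lower-bound κ p q 0<q _ pℓ<q (H , H-free , hom) = no-small-image {H} (hom graph graph-free mindeg) small (free⇒cycleFree {G = H} H-free)
  where
  t : ℕ
  -- The summand `n H` makes the order exceed that of `H`; `2 * p` absorbs the additive 2 in the
  -- order `ℓ * t + 2`.
  t = 2 * p + n H
  open Andrasfai κ t renaming (p to order)
  small : n H < order
  small = ≤-trans (s≤s (m≤n+m (n H) (2 * p))) (≤-trans (s≤s (m≤n+m t (κ * t + s))) ≤-refl)
  graph-free : Free (OddCyclesUpTo ℓ) graph
  graph-free (r , h , r%2 , r≤ℓ) C⊆graph =
    let z , per , _ = cycle⇒periodic {graph} {h = h} C⊆graph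
    in no-odd-closed {r} {z} (%2≡1⇒odd r r%2) (proj₁ (periodic⇒closed {graph} per)) r≤ℓ
  mindeg : MinDegAtLeast graph p q
  mindeg v = begin
    p * order             ≡⟨ cong (p *_) p≡ ⟩
    p * (ℓ * t + 2)       ≡⟨ lemma p ℓ t ⟩
    p * ℓ * t + 2 * p     ≤⟨ +-monoʳ-≤ (p * ℓ * t) (m≤m+n (2 * p) (n H)) ⟩
    p * ℓ * t + t         ≡⟨ +-comm (p * ℓ * t) t ⟩
    suc (p * ℓ) * t       ≤⟨ *-monoˡ-≤ t (≤-trans pℓ<q (≤-reflexive (*-identityˡ q))) ⟩
    q * t                 ≤⟨ *-monoʳ-≤ q (t≤degree v) ⟩
    q * degree graph v    ∎
    where
    open ≤-Reasoning
    lemma : ∀ p l t → p * (l * t + 2) ≡ p * l * t + 2 * p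
    lemma = solve-∀

theorem1p2 : ∀ (k : ℕ) (hk : 3 ≤ k) →
    HomThresholdAtMost (SingleCycle k hk) 1 (2 * k ∸ 1) ×
    (HomThresholdAtMost (OddCyclesUpTo (2 * k ∸ 1)) 1 (2 * k ∸ 1) ×
    HomThresholdAtLeast (OddCyclesUpTo (2 * k ∸ 1)) 1 (2 * k ∸ 1))
theorem1p2 k@(suc κ) hk@(s≤s 2≤κ) = single , all , lower
  where
  ℓ≡ : 1 + (κ + κ) ≡ 2 * k ∸ 1
  ℓ≡ = trans (sym (+-suc κ κ)) (cong (λ x → κ + suc x) (sym (+-identityʳ κ)))
  ℓ-odd : odd (2 * k ∸ 1) ≡ true
  ℓ-odd = trans (cong odd (sym ℓ≡)) (Andrasfai.ℓ-odd κ 0)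
  5≤ℓ : 5 ≤ 2 * k ∸ 1
  5≤ℓ = ≤-trans (s≤s (+-mono-≤ 2≤κ 2≤κ)) (≤-reflexive ℓ≡)
  single : HomThresholdAtMost (SingleCycle k hk) 1 (2 * k ∸ 1)
  single p q 0<q _ q<pℓ =
    let H , H-free , hom = single-odd-cycle ℓ-odd 5≤ℓ {p} 0<q q<pℓ
    in H , (λ _ → H-free (2 * k ∸ 1) (3≤2k∸1 hk) refl) ,
       λ G free → hom G (λ { r h refl → free tt })
  all : HomThresholdAtMost (OddCyclesUpTo (2 * k ∸ 1)) 1 (2 * k ∸ 1)
  all p q 0<q _ q<pℓ =
    let H , H-free , hom = all-odd-cycles ℓ-odd 5≤ℓ {p} 0<q q<pℓ
    in H , cycleFree⇒free {G = H} H-free , λ G free → hom G (free⇒cycleFree {G = G} free)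
  lower : HomThresholdAtLeast (OddCyclesUpTo (2 * k ∸ 1)) 1 (2 * k ∸ 1)
  lower = subst (λ ℓ → HomThresholdAtLeast (OddCyclesUpTo ℓ) 1 ℓ) ℓ≡ (lower-bound κ)
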